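{- Let $R$ be a ring and let $A$, $B$, $C'$ be $n\times n$ matrices over $R$. Suppose that $C'$ differs from the matrix product $C=A\times B$ in exactly $k$ entries. There is a randomized algorithm that, given $A$, $B$, $C'$ and $k$, identifies these erroneous entries and corrects them (outputting $C$) in $O\big((n\log k+\sqrt{k}\min\{k,n\})\,n\big)$ expected time.
   Context: Running time is measured in a unit-cost model where each ring operation and elementary operation costs $O(1)$.
   Formalization: The factor log k is read as max{1, log k} (for k = 1 the literal bound O(n) is impossible, for k = 0 it is undefined), n is at least 1, R has a unit, and testing equality of ring elements is one of the unit-cost elementary operations. -}

module Defs where

open import Algebra.Bundles using (Ring)
open import Data.Bool.Base using (Bool; true; false; if_then_else_; _∧_)
open import Data.Fin.Base using (Fin; toℕ; fromℕ<)
open import Data.List.Base using (List; []; _∷_; _++_; length; filter; allFin; cartesianProduct)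
open import Data.Nat.Base using (ℕ; zero; suc; _+_; _*_; _∸_; _^_; _⊔_; _⊓_; _≤_; _≡ᵇ_; _<ᵇ_; _≤ᵇ_; ⌊_/2⌋)
open import Data.Nat.Logarithm using (⌊log₂_⌋)
open import Data.Nat.Properties using (_<?_)
open import Data.Product.Base using (_×_; _,_)
open import Data.Vec.Base using (Vec; []; _∷_)
open import Function.Base using (_∘_)
open import Level using (Level)
open import Relation.Binary.Definitions using (Decidable)
open import Relation.Binary.PropositionalEquality.Core using (_≡_)
open import Relation.Nullary.Decidable.Core using (yes; no; does; ¬?)
import Algebra.Properties.Monoid.Sum as MonoidSum

-- ⌊√k⌋ is either ⌊√(k-1)⌋ or one more.
⌊√_⌋ : ℕ → ℕ
⌊√ zero ⌋  = zero
⌊√ suc k ⌋ = next ⌊√ k ⌋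
  where
  next : ℕ → ℕ
  next r = if suc r * suc r ≤ᵇ suc k then suc r else r

-- (n log k + √k · min{k,n}) · n.  Roundings are downwards, and they change the
-- value by at most a constant factor.  The factor log k is read as
-- max{1, log k}: this differs from ⌊log₂ k⌋ only for k ≤ 1, where the vanishing
-- logarithm would leave less time than is needed to read the input.
timeBound : ℕ → ℕ → ℕ
timeBound n k = (n * (1 ⊔ ⌊log₂ k ⌋) + ⌊√ k ⌋ * (k ⊓ n)) * n

-- Programs of a unit-cost randomised random-access machine over a ring.
-- Memory consists of scalars and two-dimensional arrays, each holding either
-- natural numbers or ring elements; a program names finitely many of them.
-- Every instruction carries out at most one operation.  Natural numbers can be
-- added, subtracted, halved and compared but not multiplied, so that unit cost
-- cannot be abused to compute on large packed integers.  Ring elements are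
-- opaque: they are only accessible through the ring operations and equality.
-- The syntax does not depend on the ring or on the input size.

NVar RVar NArr RArr : Set
NVar = ℕ
RVar = ℕ
NArr = ℕ
RArr = ℕ

data Instr : Set where
  const  : NVar → ℕ → Instr
  copy   : NVar → NVar → Instr
  add    : NVar → NVar → NVar → Instr
  monus  : NVar → NVar → NVar → Instr
  half   : NVar → NVar → Instr
  load   : NVar → NArr → NVar → NVar → Instr
  store  : NArr → NVar → NVar → NVar → Instr
  flip   : NVar → Instr
  rzero  : RVar → Instr
  rone   : RVar → Instr
  rcopy  : RVar → RVar → Instr
  radd   : RVar → RVar → RVar → Instr
  rneg   : RVar → RVar → Instr
  rmul   : RVar → RVar → RVar → Instr
  rload  : RVar → RArr → NVar → NVar → Instr
  rstore : RArr → NVar → NVar → RVar → Instr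

data Test : Set where
  less : NVar → NVar → Test
  requ : RVar → RVar → Test

data Stmt : Set where
  instr : Instr → Stmt
  ifte  : Test → List Stmt → List Stmt → Stmt
  while : Test → List Stmt → Stmt

Program : Set
Program = List Stmt

-- The sum of f over all 2 ^ N outcomes of N coin flips.
sumTapes : (N : ℕ) → (Vec Bool N → ℕ) → ℕ
sumTapes zero    f = f []
sumTapes (suc N) f = sumTapes N (f ∘ (false ∷_)) + sumTapes N (f ∘ (true ∷_))

-- Input and output conventions.  The array rC holds C′ initially and is
-- corrected in place; the array nMark receives the positions of the errors.
vN vK : NVar
vN = 0
vK = 1

rA rB rC : RArr
rA = 0
rB = 1
rC = 2

nMark : NArr
nMark = 0

set₁ : ∀ {a} {V : Set a} → (ℕ → V) → ℕ → V → (ℕ → V)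
set₁ f x v y = if x ≡ᵇ y then v else f y

set₃ : ∀ {a} {V : Set a} → (ℕ → ℕ → ℕ → V) → ℕ → ℕ → ℕ → V → (ℕ → ℕ → ℕ → V)
set₃ f x i j v x′ i′ j′ = if (x ≡ᵇ x′) ∧ (i ≡ᵇ i′) ∧ (j ≡ᵇ j′) then v else f x′ i′ j′

-- Equality of ring elements is decidable because the machine tests it in one
-- step.
module Over {c ℓ : Level} (R : Ring c ℓ) (_≟_ : Decidable (Ring._≈_ R)) where

  open Ring R using (Carrier; _≈_; _≉_; 0#; 1#; -_; +-monoid)
    renaming (_+_ to _+ᴿ_; _*_ to _*ᴿ_)
  open MonoidSum +-monoid using (sum)

  Matrix : ℕ → Set c
  Matrix n = Fin n → Fin n → Carrier

  _⊗_ : ∀ {n} → Matrix n → Matrix n → Matrix n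
  (A ⊗ B) i j = sum (λ l → A i l *ᴿ B l j)

  DifferInExactly : ∀ {n} → ℕ → Matrix n → Matrix n → Set
  DifferInExactly {n} k M M′ =
    length (filter (λ (i , j) → ¬? (M i j ≟ M′ i j)) (cartesianProduct (allFin n) (allFin n))) ≡ k

  record Memory : Set c where
    constructor mkMemory
    field
      nvar : NVar → ℕ
      rvar : RVar → Carrier
      narr : NArr → ℕ → ℕ → ℕ
      rarr : RArr → ℕ → ℕ → Carrier

  open Memory public

  setN : NVar → ℕ → Memory → Memory
  setN x v m = record m { nvar = set₁ (nvar m) x v }

  setR : RVar → Carrier → Memory → Memory
  setR x v m = record m { rvar = set₁ (rvar m) x v }

  -- The Boolean is a random bit; only flip looks at it.
  exec : Bool → Instr → Memory → Memory
  exec b (const x v)      m = setN x v m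
  exec b (copy x y)       m = setN x (nvar m y) m
  exec b (add x y z)      m = setN x (nvar m y + nvar m z) m
  exec b (monus x y z)    m = setN x (nvar m y ∸ nvar m z) m
  exec b (half x y)       m = setN x ⌊ nvar m y /2⌋ m
  exec b (load x a y z)   m = setN x (narr m a (nvar m y) (nvar m z)) m
  exec b (store a y z x)  m = record m { narr = set₃ (narr m) a (nvar m y) (nvar m z) (nvar m x) }
  exec b (flip x)         m = setN x (if b then 1 else 0) m
  exec b (rzero x)        m = setR x 0# m
  exec b (rone x)         m = setR x 1# m
  exec b (rcopy x y)      m = setR x (rvar m y) m
  exec b (radd x y z)     m = setR x (rvar m y +ᴿ rvar m z) m
  exec b (rneg x y)       m = setR x (- rvar m y) m
  exec b (rmul x y z)     m = setR x (rvar m y *ᴿ rvar m z) m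
  exec b (rload x a y z)  m = setR x (rarr m a (nvar m y) (nvar m z)) m
  exec b (rstore a y z x) m = record m { rarr = set₃ (rarr m) a (nvar m y) (nvar m z) (rvar m x) }

  holds : Test → Memory → Bool
  holds (less x y) m = nvar m x <ᵇ nvar m y
  holds (requ x y) m = does (rvar m x ≟ rvar m y)

  -- The statements still to be executed; the machine has halted when there are
  -- none.
  Config : Set c
  Config = Program × Memory

  step : Bool → Config → Config
  step b ([]               , m) = [] , m
  step b (instr i     ∷ ss , m) = ss , exec b i m
  step b (ifte t p q  ∷ ss , m) = (if holds t m then p else q) ++ ss , m
  step b (while t p   ∷ ss , m) = (if holds t m then p ++ while t p ∷ ss else ss) , m

  -- Run for N steps, where step number i is supplied with the i-th random bit.
  run : ∀ {N} → Config → Vec Bool N → Config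
  run κ []      = κ
  run κ (b ∷ ω) = run (step b κ) ω

  -- min{T, N}, where T is the number of steps until the machine halts.
  time : ∀ {N} → Config → Vec Bool N → ℕ
  time κ              []      = 0
  time ([]     , m)   (b ∷ ω) = 0
  time (s ∷ ss , m)   (b ∷ ω) = suc (time (step b (s ∷ ss , m)) ω)

  -- E[T] ≤ t.  By monotone convergence E[T] is the supremum over N of
  -- E[min{T, N}], the average of time over the 2 ^ N outcomes of N coin flips.
  ExpectedTime≤ : Config → ℕ → Set
  ExpectedTime≤ κ t = ∀ N → sumTapes N (time κ) ≤ t * 2 ^ N

  -- Q holds whenever the machine halts, whatever the random bits are.
  OnHalting : ∀ {q} → Config → (Memory → Set q) → Set _
  OnHalting κ Q = ∀ {N} (ω : Vec Bool N) (m : Memory) → run κ ω ≡ ([] , m) → Q m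

  entries : ∀ {n} → Matrix n → ℕ → ℕ → Carrier
  entries {n} M i j with i <? n | j <? n
  ... | yes i<n | yes j<n = M (fromℕ< i<n) (fromℕ< j<n)
  ... | _       | _       = 0#

  input : ∀ {n} → Matrix n → Matrix n → Matrix n → ℕ → Memory
  input {n} A B C′ k = mkMemory
    (set₁ (set₁ (λ _ → 0) vN n) vK k)
    (λ _ → 0#)
    (λ _ _ _ → 0)
    (set₁ (set₁ (set₁ (λ _ _ _ → 0#) rA (entries A)) rB (entries B)) rC (entries C′))

  Corrected : ∀ {n} → Matrix n → Memory → Set ℓ
  Corrected C m = ∀ i j → rarr m rC (toℕ i) (toℕ j) ≈ C i j

  ErrorsIdentified : ∀ {n} → Matrix n → Matrix n → Memory → Set ℓ
  ErrorsIdentified C′ C m = ∀ i j →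
    (C′ i j ≉ C i j → narr m nMark (toℕ i) (toℕ j) ≡ 1) ×
    (C′ i j ≈ C i j → narr m nMark (toℕ i) (toℕ j) ≡ 0)

{-# OPTIONS --safe #-}

-- Let k be the current number of errors.  In a round, a random 0/1 vector x
-- with A (B x) compared to C′ x flags rows, and symmetrically a random y flags
-- columns; a line without errors is never flagged, so at most min{k, n} rows and
-- columns are, and a line with an error is flagged with probability at least 1/2.
-- The flagged columns are split into about √k buckets of equal size, and for each
-- bucket and each flagged row a third random test restricted to the bucket is
-- made.  Where it fails, all entries of that row in the bucket are recomputed;
-- since at least one of them is wrong, this happens at most k times.  A round
-- costs O(n² + √k min{k, n} n) and corrects every error with probability at least
-- 1/8.  As k is known exactly, the algorithm stops when it reaches 0 and is then
-- always right.
--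
-- The expected time is bounded by a potential that is piecewise linear in k with
-- breakpoints 4 ^ i: while 4 ^ i ≤ k ≤ 4 ^ suc i, the expected decrease k / 8 pays
-- for the round.  Summed over i, the terms n² contribute n² log k, and the terms
-- √(4 ^ i) min{4 ^ i, n} n grow geometrically.

module Submission where

open import Defs
open import Algebra.Bundles using (Ring)
open import Data.Bool.Base using (Bool; true; false; if_then_else_; _∧_; _∨_; not; T)
open import Data.Bool.Properties using (∨-conicalˡ; ∨-conicalʳ; T-≡)
open import Data.Fin.Base as Fin using (Fin; toℕ)
open import Data.Fin.Properties using (toℕ<n; fromℕ<-toℕ)
open import Data.List.Base using (List; []; _∷_; _++_; [_]; length; filter; map; tabulate; cartesianProduct)
open import Data.List.Properties using (length-++; filter-++; map-tabulate)
open import Data.Nat.Base renaming (_⊔_ to _⊔ⁿ_)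
open import Data.Nat.Logarithm using (⌊log₂_⌋; ⌊log₂⌋-mono-≤; ⌊log₂[2^n]⌋≡n)
open import Data.Nat.Properties hiding (_≟_)
open import Data.Nat.Tactic.RingSolver using (solve-∀)
open import Data.Product.Base using (Σ-syntax; ∃-syntax; _×_; _,_; proj₁; proj₂)
open import Data.Sum.Base using (_⊎_; inj₁; inj₂)
open import Data.Unit.Base using (tt)
open import Data.Vec.Base using (Vec; []; _∷_)
open import Function.Base using (_∘_; id)
open import Function.Bundles using (Equivalence)
open import Level using (Level; _⊔_)
open import Relation.Binary.Definitions using (Decidable)
open import Relation.Binary.PropositionalEquality using (_≡_; _≢_; refl; sym; trans; cong; cong₂; subst; subst₂; module ≡-Reasoning)
open import Relation.Nullary using (¬_; yes; no; does; ¬?; contradiction)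
open import Relation.Unary using (Pred) renaming (Decidable to Decidable₁)
import Algebra.Properties.Group as GroupProperties
open import Data.Nat.DivMod using (_/_; m≡m%n+[m/n]*n; m%n<n; m/n*n≤m)
import Algebra.Properties.Monoid.Sum as MonoidSum

-- Finite sums and sums over coin flips

-- Coins are tossed only while one of the vectors x, y, z is filled; all other code is
-- deterministic. So there are two calculi: `Run` bounds the steps of deterministic code for every
-- outcome, and `Good` bounds expected time. Only the number of rounds is random. With all bits 0
-- nothing is ever flagged, so some outcomes never halt, no measure of the memory decreases for
-- certain, and the induction for the main loop is on the number of observed steps. Repairs change
-- the matrix while tests are still to come. But each pair of a flagged row and a bucket is visited
-- only once, so every test sees the entries from the start of the round and its outcome depends on
-- that matrix and on x, y, z alone. By linearity of expectation it is then enough to bound the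
-- survival of one error by 1 - 1/8; nothing is needed about several errors jointly. All quantities
-- are natural numbers: expectations are sums over tapes, and scale factors stand for the
-- denominators. A round with n bits in each vector has denominator 8 · (2 ^ n)³.

Σ< : ℕ → (ℕ → ℕ) → ℕ
Σ< zero    f = 0
Σ< (suc n) f = Σ< n f + f n

Σ<-mono : ∀ n {f g} → (∀ i → i < n → f i ≤ g i) → Σ< n f ≤ Σ< n g
Σ<-mono zero    h = z≤n
Σ<-mono (suc n) h = +-mono-≤ (Σ<-mono n (λ i i<n → h i (m<n⇒m<1+n i<n))) (h n ≤-refl)

Σ<-cong : ∀ n {f g} → (∀ i → i < n → f i ≡ g i) → Σ< n f ≡ Σ< n g
Σ<-cong n h = ≤-antisym (Σ<-mono n (λ i p → ≤-reflexive (h i p)))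
                        (Σ<-mono n (λ i p → ≤-reflexive (sym (h i p))))

Σ<-const : ∀ n v → Σ< n (λ _ → v) ≡ n * v
Σ<-const zero    v = refl
Σ<-const (suc n) v = trans (cong (_+ v) (Σ<-const n v)) (+-comm (n * v) v)

term≤Σ< : ∀ n f {i} → i < n → f i ≤ Σ< n f
term≤Σ< (suc n) f {i} (s≤s i≤n) with m≤n⇒m<n∨m≡n i≤n
... | inj₁ i<n  = ≤-trans (term≤Σ< n f i<n) (m≤m+n _ _)
... | inj₂ refl = m≤n+m _ _

Σ<-mono-< : ∀ n {f g i} → (∀ i → i < n → f i ≤ g i) → i < n → f i < g i → Σ< n f < Σ< n g
Σ<-mono-< (suc n) {i = i} h (s≤s i≤n) lt with m≤n⇒m<n∨m≡n i≤n
... | inj₁ i<n  = +-mono-<-≤ (Σ<-mono-< n (λ i p → h i (m<n⇒m<1+n p)) i<n lt) (h n ≤-refl)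
... | inj₂ refl = +-mono-≤-< (Σ<-mono n (λ i p → h i (m<n⇒m<1+n p))) lt

Σ<-* : ∀ n a f → Σ< n (λ i → a * f i) ≡ a * Σ< n f
Σ<-* zero    a f = sym (*-zeroʳ a)
Σ<-* (suc n) a f = trans (cong (_+ a * f n) (Σ<-* n a f)) (sym (*-distribˡ-+ a (Σ< n f) (f n)))

Σ<-+ : ∀ n f g → Σ< n (λ i → f i + g i) ≡ Σ< n f + Σ< n g
Σ<-+ zero    f g = refl
Σ<-+ (suc n) f g = trans (cong (_+ (f n + g n)) (Σ<-+ n f g)) (interchange (Σ< n f) (Σ< n g) (f n) (g n))
  where
  interchange : ∀ a b c d → a + b + (c + d) ≡ a + c + (b + d)
  interchange = solve-∀

Σ<-comm : ∀ m n (f : ℕ → ℕ → ℕ) → Σ< m (λ i → Σ< n (f i)) ≡ Σ< n (λ j → Σ< m (λ i → f i j))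
Σ<-comm zero    n f = sym (trans (Σ<-const n 0) (*-zeroʳ n))
Σ<-comm (suc m) n f = trans (cong (_+ Σ< n (f m)) (Σ<-comm m n f))
                            (sym (Σ<-+ n (λ j → Σ< m (λ i → f i j)) (f m)))

sumTapes-mono : ∀ N {f g} → (∀ ω → f ω ≤ g ω) → sumTapes N f ≤ sumTapes N g
sumTapes-mono zero    h = h []
sumTapes-mono (suc N) h = +-mono-≤ (sumTapes-mono N (λ ω → h (false ∷ ω))) (sumTapes-mono N (λ ω → h (true ∷ ω)))

sumTapes-cong : ∀ N {f g} → (∀ ω → f ω ≡ g ω) → sumTapes N f ≡ sumTapes N g
sumTapes-cong zero    h = h []
sumTapes-cong (suc N) h = cong₂ _+_ (sumTapes-cong N (λ ω → h (false ∷ ω))) (sumTapes-cong N (λ ω → h (true ∷ ω)))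

sumTapes-+ : ∀ N f g → sumTapes N (λ ω → f ω + g ω) ≡ sumTapes N f + sumTapes N g
sumTapes-+ zero    f g = refl
sumTapes-+ (suc N) f g =
  trans (cong₂ _+_ (sumTapes-+ N (f ∘ (false ∷_)) (g ∘ (false ∷_))) (sumTapes-+ N (f ∘ (true ∷_)) (g ∘ (true ∷_))))
        (interchange (sumTapes N (f ∘ (false ∷_))) (sumTapes N (g ∘ (false ∷_))) _ _)
  where
  interchange : ∀ a b c d → a + b + (c + d) ≡ a + c + (b + d)
  interchange = solve-∀

sumTapes-* : ∀ N a f → sumTapes N (λ ω → a * f ω) ≡ a * sumTapes N f
sumTapes-* zero    a f = refl
sumTapes-* (suc N) a f =
  trans (cong₂ _+_ (sumTapes-* N a (f ∘ (false ∷_))) (sumTapes-* N a (f ∘ (true ∷_))))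
        (sym (*-distribˡ-+ a (sumTapes N (f ∘ (false ∷_))) _))

sumTapes-const : ∀ N v → sumTapes N (λ _ → v) ≡ v * 2 ^ N
sumTapes-const zero    v = sym (*-identityʳ v)
sumTapes-const (suc N) v = trans (cong₂ _+_ (sumTapes-const N v) (sumTapes-const N v)) (double v (2 ^ N))
  where
  double : ∀ v p → v * p + v * p ≡ v * (p + (p + 0))
  double = solve-∀

sumTapes-Σ< : ∀ N n (f : Vec Bool N → ℕ → ℕ) →
  sumTapes N (λ ω → Σ< n (f ω)) ≡ Σ< n (λ i → sumTapes N (λ ω → f ω i))
sumTapes-Σ< N zero    f = sumTapes-const N 0
sumTapes-Σ< N (suc n) f =
  trans (sumTapes-+ N (λ ω → Σ< n (f ω)) (λ ω → f ω n)) (cong (_+ sumTapes N (λ ω → f ω n)) (sumTapes-Σ< N n f))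

-- Indicators, and toggling one random bit

𝟙 : Bool → ℕ
𝟙 b = if b then 1 else 0

𝟙≤1 : ∀ b → 𝟙 b ≤ 1
𝟙≤1 false = z≤n
𝟙≤1 true  = ≤-refl

-- Positions beyond the end hold the bit false.
bit : ∀ {n} → Vec Bool n → ℕ → Bool
bit []      _       = false
bit (b ∷ x) zero    = b
bit (b ∷ x) (suc p) = bit x p

toggle : ∀ {n} → ℕ → Vec Bool n → Vec Bool n
toggle p       []      = []
toggle zero    (b ∷ x) = not b ∷ x
toggle (suc p) (b ∷ x) = b ∷ toggle p x

bit-toggle : ∀ {n} p (x : Vec Bool n) → p < n → bit (toggle p x) p ≡ not (bit x p)
bit-toggle zero    (b ∷ x) _         = refl
bit-toggle (suc p) (b ∷ x) (s≤s p<n) = bit-toggle p x p<n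

bit-toggle-≢ : ∀ {n} p q (x : Vec Bool n) → q ≢ p → bit (toggle p x) q ≡ bit x q
bit-toggle-≢ p       q       []      q≢p = refl
bit-toggle-≢ zero    zero    (b ∷ x) q≢p = contradiction refl q≢p
bit-toggle-≢ zero    (suc q) (b ∷ x) q≢p = refl
bit-toggle-≢ (suc p) zero    (b ∷ x) q≢p = refl
bit-toggle-≢ (suc p) (suc q) (b ∷ x) q≢p = bit-toggle-≢ p q x (q≢p ∘ cong suc)

sumTapes-toggle : ∀ N p f → sumTapes N (f ∘ toggle p) ≡ sumTapes N f
sumTapes-toggle zero    p       f = refl
sumTapes-toggle (suc N) zero    f = +-comm (sumTapes N (f ∘ (true ∷_))) _
sumTapes-toggle (suc N) (suc p) f = cong₂ _+_ (sumTapes-toggle N p (f ∘ (false ∷_))) (sumTapes-toggle N p (f ∘ (true ∷_)))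

-- Each tape is paired with its toggled copy, and an event that never happens on both members of a
-- pair has probability at most 1/2. Every probability bound of the proof goes back to this pairing.
sumTapes-half : ∀ N p f → (∀ x → f x + f (toggle p x) ≤ 1) → 2 * sumTapes N f ≤ 2 ^ N
sumTapes-half N p f h = begin
  2 * sumTapes N f                            ≡⟨ cong (sumTapes N f +_) (+-identityʳ _) ⟩
  sumTapes N f + sumTapes N f                 ≡⟨ cong (sumTapes N f +_) (sumTapes-toggle N p f) ⟨
  sumTapes N f + sumTapes N (f ∘ toggle p)    ≡⟨ sumTapes-+ N f (f ∘ toggle p) ⟨
  sumTapes N (λ x → f x + f (toggle p x))     ≤⟨ sumTapes-mono N h ⟩
  sumTapes N (λ _ → 1)                        ≡⟨ trans (sumTapes-const N 1) (*-identityˡ _) ⟩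
  2 ^ N                                       ∎
  where open ≤-Reasoning

-- Applied to the rows and again to the columns when a single entry is repaired: the number of
-- errors then drops by exactly one.
Σ<-pred : ∀ n {f g i} → i < n → (∀ j → j < n → j ≢ i → f j ≡ g j) → suc (f i) ≡ g i → suc (Σ< n f) ≡ Σ< n g
Σ<-pred (suc n) {f} {g} {i} (s≤s i≤n) h e with m≤n⇒m<n∨m≡n i≤n
... | inj₁ i<n  = cong₂ _+_ (Σ<-pred n i<n (λ j p → h j (m<n⇒m<1+n p)) e) (h n ≤-refl (λ q → <⇒≢ i<n (sym q)))
... | inj₂ refl = trans (sym (+-suc (Σ< n f) (f n)))
                        (cong₂ _+_ (Σ<-cong n (λ j p → h j (m<n⇒m<1+n p) (<⇒≢ p))) e)

square-cancel-≤ : ∀ {m n} → m * m ≤ n * n → m ≤ n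
square-cancel-≤ {m} {n} h with m ≤? n
... | yes p = p
... | no ¬p = contradiction h (<⇒≱ (*-mono-< (≰⇒> ¬p) (≰⇒> ¬p)))

-- The potential

-- If r exceeded the root, its square would be at least (⌊√k⌋ + 1)², and by `upper` this is beyond
-- k.
≤⌊√⌋ : ∀ {r k} → r * r ≤ k → r ≤ ⌊√ k ⌋
≤⌊√⌋ {r} {k} h = ≤-pred (≰⇒> (λ le → <⇒≱ (upper k) (≤-trans (*-mono-≤ le le) h)))
  where
  upper : ∀ k → k < suc ⌊√ k ⌋ * suc ⌊√ k ⌋
  upper zero = s≤s z≤n
  upper (suc k) with suc ⌊√ k ⌋ * suc ⌊√ k ⌋ ≤ᵇ suc k in e
  ... | false = ≰⇒> (λ le → contradiction (trans (sym e) (Equivalence.to T-≡ (≤⇒≤ᵇ le))) (λ ()))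
  ... | true  = <-≤-trans (s≤s (upper k)) (*-mono-< (≤-refl {suc (suc ⌊√ k ⌋)}) (≤-refl {suc (suc ⌊√ k ⌋)}))

-- `i` is the logarithm of k to base 4, rounded down. Powers of 4 serve as breakpoints because their
-- square roots 2 ^ i are exact.
bracket : ∀ k → 1 ≤ k → ∃[ i ] (4 ^ i ≤ k × k < 4 ^ suc i)
bracket (suc zero)    _ = 0 , ≤-refl , s≤s (s≤s z≤n)
bracket (suc (suc k)) _ with bracket (suc k) (s≤s z≤n)
... | i , lo , hi with suc (suc k) <? 4 ^ suc i
...   | yes lt = i , m≤n⇒m≤1+n lo , lt
...   | no ¬lt = suc i , ≮⇒≥ ¬lt , ≤-trans (s≤s hi) (grow (m^n>0 4 (suc i)))
  where
  grow : ∀ {m} → 1 ≤ m → suc m ≤ 4 * m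
  grow {m} h = ≤-trans (+-monoˡ-≤ m h) (+-monoʳ-≤ m (m≤m+n m _))

4^≡2^*2^ : ∀ i → 4 ^ i ≡ 2 ^ i * 2 ^ i
4^≡2^*2^ zero    = refl
4^≡2^*2^ (suc i) = trans (cong (4 *_) (4^≡2^*2^ i)) (sh (2 ^ i))
  where
  sh : ∀ p → 4 * (p * p) ≡ 2 * p * (2 * p)
  sh = solve-∀

4*⊓ : ∀ i n → 4 ^ suc i ⊓ n ≤ 4 * (4 ^ i ⊓ n)
4*⊓ i n = ≤-trans (⊓-monoʳ-≤ (4 ^ suc i) (m≤n*m n 4)) (≤-reflexive (sym (*-distribˡ-⊓ 4 (4 ^ i) n)))

module Potential (c₁ c₂ n : ℕ) (n≥1 : 1 ≤ n) where

  -- Bounds the cost of a round that starts with at most 4 ^ suc i errors.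
  τ : ℕ → ℕ
  τ i = c₁ * (n * n) + c₂ * (2 ^ i * (4 ^ i ⊓ n) * n)

  -- Slope of the potential between 4 ^ i and 4 ^ suc i errors: removing an eighth of 4 ^ i errors pays for a round.
  σ : ℕ → ℕ
  σ i = suc (_/_ (8 * τ i) (4 ^ i) {{m^n≢0 4 i}})

  -- Potential of 4 ^ i errors.
  S : ℕ → ℕ
  S zero    = 1
  S (suc i) = S i + σ i * 4 ^ suc i

  -- The successor in `σ` rounds the quotient up, so σ i · 4 ^ i lies between 8 · τ i and 8 · τ i +
  -- 4 ^ i. The lower bound pays for the rounds, the upper one keeps the total small.
  8τ≤σ4^ : ∀ i → 8 * τ i ≤ σ i * 4 ^ i
  8τ≤σ4^ i = ≤-trans (≤-reflexive (m≡m%n+[m/n]*n (8 * τ i) (4 ^ i) {{m^n≢0 4 i}})) (+-monoˡ-≤ _ (<⇒≤ (m%n<n (8 * τ i) (4 ^ i) {{m^n≢0 4 i}})))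

  σ4^≤ : ∀ i → σ i * 4 ^ i ≤ 4 ^ i + 8 * τ i
  σ4^≤ i = +-monoʳ-≤ (4 ^ i) (m/n*n≤m (8 * τ i) (4 ^ i) {{m^n≢0 4 i}})

  1≤n² : 1 ≤ n * n
  1≤n² = *-mono-≤ n≥1 n≥1

  1≤S : ∀ i → 1 ≤ S i
  1≤S zero    = ≤-refl
  1≤S (suc i) = ≤-trans (1≤S i) (m≤m+n (S i) _)

  -- A level adds at most 4 · (4 ^ i + 8 · τ i). The n² part of τ is the same on every level, whence
  -- the factor i. The other part at least doubles per level, so 32 X + 32 X fits into the bound for
  -- the next level; so do the rounding terms, as 8 · 4 ^ i is below 16 · 4 ^ i.
  S≤ : ∀ i → S i ≤ 1 + 32 * (c₁ * (i * (n * n))) + 32 * (c₂ * (2 ^ i * (4 ^ i ⊓ n) * n)) + 4 * 4 ^ i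
  S≤ zero    = s≤s z≤n
  S≤ (suc i) = begin
    S i + σ i * (4 * 4 ^ i)
      ≤⟨ +-mono-≤ (S≤ i) (≤-trans (≤-reflexive (swap (σ i) (4 ^ i))) (*-monoʳ-≤ 4 (σ4^≤ i))) ⟩
    1 + 32 * (c₁ * (i * N)) + 32 * (c₂ * X) + 4 * 4 ^ i + 4 * (4 ^ i + 8 * (c₁ * N + c₂ * X))
      ≡⟨ sh c₁ c₂ i N X (4 ^ i) ⟩
    1 + 32 * (c₁ * (suc i * N)) + 32 * (c₂ * (2 * X)) + 8 * 4 ^ i
      ≤⟨ +-mono-≤ (+-monoʳ-≤ (1 + 32 * (c₁ * (suc i * N))) (*-monoʳ-≤ 32 (*-monoʳ-≤ c₂ 2X≤)))
           (≤-trans (m≤m+n (8 * 4 ^ i) (8 * 4 ^ i)) (≤-reflexive (sh′ (4 ^ i)))) ⟩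
    1 + 32 * (c₁ * (suc i * N)) + 32 * (c₂ * (2 ^ suc i * (4 ^ suc i ⊓ n) * n)) + 4 * 4 ^ suc i ∎
    where
    open ≤-Reasoning
    N X : ℕ
    N = n * n
    X = 2 ^ i * (4 ^ i ⊓ n) * n
    swap : ∀ s p → s * (4 * p) ≡ 4 * (s * p)
    swap = solve-∀
    sh : ∀ c d i N X p → 1 + 32 * (c * (i * N)) + 32 * (d * X) + 4 * p + 4 * (p + 8 * (c * N + d * X)) ≡
      1 + 32 * (c * (suc i * N)) + 32 * (d * (2 * X)) + 8 * p
    sh = solve-∀
    sh′ : ∀ p → 8 * p + 8 * p ≡ 4 * (4 * p)
    sh′ = solve-∀
    2X≤ : 2 * X ≤ 2 ^ suc i * (4 ^ suc i ⊓ n) * n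
    2X≤ = ≤-trans (≤-reflexive (sh″ (2 ^ i) (4 ^ i ⊓ n) n)) (*-monoˡ-≤ n (*-monoʳ-≤ (2 ^ suc i) (⊓-monoˡ-≤ n (m≤n*m (4 ^ i) 4))))
      where
      sh″ : ∀ p μ n → 2 * (p * μ * n) ≡ 2 * p * μ * n
      sh″ = solve-∀

  n²≤timeBound : ∀ k → n * n ≤ timeBound n k
  n²≤timeBound k = *-monoˡ-≤ n (≤-trans (≤-trans (≤-reflexive (sym (*-identityʳ n))) (*-monoʳ-≤ n (m≤m⊔n 1 ⌊log₂ k ⌋)))
    (m≤m+n (n * (1 ⊔ⁿ ⌊log₂ k ⌋)) _))

  -- From 4 ^ i ≤ k, both i ≤ log k and 2 ^ i ≤ √k follow; level i + 1 instead of i costs a factor 2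
  -- in the power of 2 and 4 in the minimum. Thus 64 = 32 · 2 and 256 = 32 · 2 · 4, while 17
  -- collects the 1 and the rounding term, which is at most 16 k ≤ 16 n².
  S≤timeBound : ∀ i {k} → 4 ^ i ≤ k → k ≤ n * n → S (suc i) ≤ (17 + 64 * c₁ + 256 * c₂) * timeBound n k
  S≤timeBound i {k} lo k≤n² = begin
    S (suc i)
      ≤⟨ S≤ (suc i) ⟩
    1 + 32 * (c₁ * (suc i * N)) + 32 * (c₂ * (2 ^ suc i * (4 ^ suc i ⊓ n) * n)) + 4 * (4 * 4 ^ i)
      ≤⟨ +-mono-≤ (+-mono-≤ (+-mono-≤ 1≤NL (*-monoʳ-≤ 32 (*-monoʳ-≤ c₁ (*-monoˡ-≤ N i≤2L))))
           (*-monoʳ-≤ 32 (*-monoʳ-≤ c₂ (*-monoˡ-≤ n (*-mono-≤ (*-monoʳ-≤ 2 2^i≤) μ≤)))))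
           (*-monoʳ-≤ 4 (*-monoʳ-≤ 4 (≤-trans lo (≤-trans k≤n² N≤NL)))) ⟩
    N * L + 32 * (c₁ * (2 * L * N)) + 32 * (c₂ * (2 * ⌊√ k ⌋ * (4 * (k ⊓ n)) * n)) + 4 * (4 * (N * L))
      ≡⟨ sh c₁ c₂ n L ⌊√ k ⌋ (k ⊓ n) ⟩
    (17 + 64 * c₁) * (n * L * n) + 256 * c₂ * (⌊√ k ⌋ * (k ⊓ n) * n)
      ≤⟨ +-mono-≤ (*-monoˡ-≤ (n * L * n) (m≤m+n (17 + 64 * c₁) (256 * c₂)))
           (*-monoˡ-≤ (⌊√ k ⌋ * (k ⊓ n) * n) (m≤n+m (256 * c₂) (17 + 64 * c₁))) ⟩
    K * (n * L * n) + K * (⌊√ k ⌋ * (k ⊓ n) * n)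
      ≡⟨ sh′ K (n * L) (⌊√ k ⌋ * (k ⊓ n)) n ⟩
    K * timeBound n k ∎
    where
    open ≤-Reasoning
    N L K : ℕ
    N = n * n
    L = 1 ⊔ⁿ ⌊log₂ k ⌋
    K = 17 + 64 * c₁ + 256 * c₂
    sh : ∀ c d n L q μ → n * n * L + 32 * (c * (2 * L * (n * n))) + 32 * (d * (2 * q * (4 * μ) * n)) + 4 * (4 * (n * n * L)) ≡
      (17 + 64 * c) * (n * L * n) + 256 * d * (q * μ * n)
    sh = solve-∀
    sh′ : ∀ K x y n → K * (x * n) + K * (y * n) ≡ K * ((x + y) * n)
    sh′ = solve-∀
    1≤L : 1 ≤ L
    1≤L = m≤m⊔n 1 ⌊log₂ k ⌋
    N≤NL : N ≤ N * L
    N≤NL = ≤-trans (≤-reflexive (sym (*-identityʳ N))) (*-monoʳ-≤ N 1≤L)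
    1≤NL : 1 ≤ N * L
    1≤NL = *-mono-≤ 1≤n² 1≤L
    2^i≤ : 2 ^ i ≤ ⌊√ k ⌋
    2^i≤ = ≤⌊√⌋ (≤-trans (≤-reflexive (sym (4^≡2^*2^ i))) lo)
    μ≤ : 4 ^ suc i ⊓ n ≤ 4 * (k ⊓ n)
    μ≤ = ≤-trans (4*⊓ i n) (*-monoʳ-≤ 4 (⊓-monoˡ-≤ n lo))
    i≤log : i ≤ ⌊log₂ k ⌋
    i≤log = ≤-trans (≤-reflexive (sym (⌊log₂[2^n]⌋≡n i)))
      (⌊log₂⌋-mono-≤ (≤-trans (≤-trans (≤-trans (≤-reflexive (sym (*-identityʳ (2 ^ i)))) (*-monoʳ-≤ (2 ^ i) (m^n>0 2 i)))
        (≤-reflexive (sym (4^≡2^*2^ i)))) lo))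
    i≤2L : suc i ≤ 2 * L
    i≤2L = ≤-trans (+-mono-≤ 1≤L (≤-trans i≤log (m≤n⊔m 1 ⌊log₂ k ⌋))) (≤-reflexive (cong (L +_) (sym (+-identityʳ L))))

-- The left side is a loop test and a round: three vectors are filled, lines are flagged, and at
-- most 4 · 2 ^ i buckets are swept. Replacing n and 1 by n² gives 135 = 40 + 64 + 31. Of the factor
-- 16, one 4 comes from the number of buckets and one from the minimum at the upper end of the
-- level.
round-cost : ∀ n {k} i → 1 ≤ n → k ≤ 4 ^ suc i →
  suc (3 * (n * 4 + 2) + (24 + n * (n * 40 + 52)) + 121 * (4 * 2 ^ i * (k ⊓ n) * n)) ≤
  135 * (n * n) + 121 * 16 * (2 ^ i * (4 ^ i ⊓ n) * n)
round-cost n {k} i n≥1 h = begin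
  suc (3 * (n * 4 + 2) + (24 + n * (n * 40 + 52)) + 121 * (4 * 2 ^ i * (k ⊓ n) * n))
    ≡⟨ sh n (121 * (4 * 2 ^ i * (k ⊓ n) * n)) ⟩
  40 * (n * n) + 64 * n + 31 * 1 + 121 * (4 * 2 ^ i * (k ⊓ n) * n)
    ≤⟨ +-mono-≤ (+-mono-≤ (+-monoʳ-≤ (40 * (n * n)) (*-monoʳ-≤ 64 (≤-trans (≤-reflexive (sym (*-identityʳ n))) (*-monoʳ-≤ n n≥1)))) (*-monoʳ-≤ 31 (*-mono-≤ n≥1 n≥1)))
         (*-monoʳ-≤ 121 (*-monoˡ-≤ n (*-monoʳ-≤ (4 * 2 ^ i) (≤-trans (⊓-monoˡ-≤ n h) (4*⊓ i n))))) ⟩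
  40 * (n * n) + 64 * (n * n) + 31 * (n * n) + 121 * (4 * 2 ^ i * (4 * (4 ^ i ⊓ n)) * n)
    ≡⟨ cong₂ _+_ (sh′ (n * n)) (trans (cong (121 *_) (sh″ (2 ^ i) (4 ^ i ⊓ n) n)) (sym (*-assoc 121 16 (2 ^ i * (4 ^ i ⊓ n) * n)))) ⟩
  135 * (n * n) + 121 * 16 * (2 ^ i * (4 ^ i ⊓ n) * n) ∎
  where
  open ≤-Reasoning
  sh : ∀ n x → suc (3 * (n * 4 + 2) + (24 + n * (n * 40 + 52)) + x) ≡ 40 * (n * n) + 64 * n + 31 * 1 + x
  sh = solve-∀
  sh′ : ∀ N → 40 * N + 64 * N + 31 * N ≡ 135 * N
  sh′ = solve-∀
  sh″ : ∀ p μ n → 4 * p * (4 * μ) * n ≡ 16 * (p * μ * n)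
  sh″ = solve-∀

-- Counting in lists by sums over indices

Σ<-head : ∀ n g → Σ< (suc n) g ≡ g 0 + Σ< n (g ∘ suc)
Σ<-head zero    g = sym (+-identityʳ (g 0))
Σ<-head (suc n) g = trans (cong (_+ g (suc n)) (Σ<-head n g)) (+-assoc (g 0) _ _)

module _ {x p} {X : Set x} {P : Pred X p} (P? : Decidable₁ P) where

  count-∷ : ∀ v vs → length (filter P? (v ∷ vs)) ≡ 𝟙 (does (P? v)) + length (filter P? vs)
  count-∷ v vs with does (P? v)
  ... | true  = refl
  ... | false = refl

  count-tabulate : ∀ n (h : Fin n → X) (g : ℕ → ℕ) → (∀ i → 𝟙 (does (P? (h i))) ≡ g (toℕ i)) →
    length (filter P? (tabulate h)) ≡ Σ< n g
  count-tabulate zero    h g e = refl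
  count-tabulate (suc n) h g e = trans (count-∷ (h Fin.zero) (tabulate (h ∘ Fin.suc)))
    (trans (cong₂ _+_ (e Fin.zero) (count-tabulate n (h ∘ Fin.suc) (g ∘ suc) (e ∘ Fin.suc))) (sym (Σ<-head n g)))

-- Brings the count over index pairs in `DifferInExactly` into the form of a double sum over natural
-- numbers, in which errors are counted from here on.
count-product : ∀ {x y p} {X : Set x} {Y : Set y} {P : Pred (X × Y) p} (P? : Decidable₁ P) m n (h : Fin m → X) (h′ : Fin n → Y)
  (g : ℕ → ℕ → ℕ) → (∀ i j → 𝟙 (does (P? (h i , h′ j))) ≡ g (toℕ i) (toℕ j)) →
  length (filter P? (cartesianProduct (tabulate h) (tabulate h′))) ≡ Σ< m (λ i → Σ< n (g i))
count-product P? zero    n h h′ g e = refl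
count-product P? (suc m) n h h′ g e = begin
  length (filter P? (map (h Fin.zero ,_) (tabulate h′) ++ rest))
    ≡⟨ cong length (filter-++ P? (map (h Fin.zero ,_) (tabulate h′)) rest) ⟩
  length (filter P? (map (h Fin.zero ,_) (tabulate h′)) ++ filter P? rest)
    ≡⟨ length-++ (filter P? (map (h Fin.zero ,_) (tabulate h′))) ⟩
  length (filter P? (map (h Fin.zero ,_) (tabulate h′))) + length (filter P? rest)
    ≡⟨ cong₂ _+_ (trans (cong (λ l → length (filter P? l)) (map-tabulate h′ (h Fin.zero ,_)))
                        (count-tabulate P? n (λ j → h Fin.zero , h′ j) (g 0) (e Fin.zero)))
                 (count-product P? m n (h ∘ Fin.suc) h′ (g ∘ suc) (e ∘ Fin.suc)) ⟩
  Σ< n (g 0) + Σ< m (λ i → Σ< n (g (suc i)))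
    ≡⟨ Σ<-head m (λ i → Σ< n (g i)) ⟨
  Σ< (suc m) (λ i → Σ< n (g i)) ∎
  where
  open ≡-Reasoning
  rest = cartesianProduct (tabulate (h ∘ Fin.suc)) (tabulate h′)

module Algorithm {c ℓ : Level} (R : Ring c ℓ) (_≟_ : Decidable (Ring._≈_ R)) where

  open Over R _≟_ public
  open Ring R public using (Carrier; _≈_; _≉_; 0#; 1#; -_; +-monoid) renaming (_+_ to _+ᴿ_; _*_ to _*ᴿ_)

  -- Program logic

  -- A whole array is one location: frames speak only of arrays that are not written at all, and
  -- partial writes are treated where they occur.
  data Loc : Set where
    nv rv na ra : ℕ → Loc

  _=ᴸ_ : Loc → Loc → Bool
  nv x =ᴸ nv y = x ≡ᵇ y
  rv x =ᴸ rv y = x ≡ᵇ y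
  na x =ᴸ na y = x ≡ᵇ y
  ra x =ᴸ ra y = x ≡ᵇ y
  _    =ᴸ _    = false

  target : Instr → Loc
  target (const x v)      = nv x
  target (copy x y)       = nv x
  target (add x y z)      = nv x
  target (monus x y z)    = nv x
  target (half x y)       = nv x
  target (load x a y z)   = nv x
  target (store a y z x)  = na a
  target (flip x)         = nv x
  target (rzero x)        = rv x
  target (rone x)         = rv x
  target (rcopy x y)      = rv x
  target (radd x y z)     = rv x
  target (rneg x y)       = rv x
  target (rmul x y z)     = rv x
  target (rload x a y z)  = rv x
  target (rstore a y z x) = ra a

  assigns  : Program → Loc → Bool
  assigns₁ : Stmt → Loc → Bool

  assigns []       l = false
  assigns (s ∷ ss) l = assigns₁ s l ∨ assigns ss l

  assigns₁ (instr i)    l = target i =ᴸ l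
  assigns₁ (ifte t p q) l = assigns p l ∨ assigns q l
  assigns₁ (while t p)  l = assigns p l

  record Frame (S : Loc → Bool) (m m′ : Memory) : Set c where
    field
      frameN  : ∀ x → S (nv x) ≡ false → nvar m′ x ≡ nvar m x
      frameR  : ∀ x → S (rv x) ≡ false → rvar m′ x ≡ rvar m x
      frameNA : ∀ a → S (na a) ≡ false → ∀ i j → narr m′ a i j ≡ narr m a i j
      frameRA : ∀ a → S (ra a) ≡ false → ∀ i j → rarr m′ a i j ≡ rarr m a i j

  open Frame public

  module _ {S : Loc → Bool} {m m′ : Memory} (fr : Frame S m m′) where

    private
      unset : ∀ {b} → T (not b) → b ≡ false
      unset {false} _ = refl

    -- For a concrete program `assigns` evaluates, the hidden argument has the unit type and is
    -- inferred, so most frame conditions need no proof.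
    keepN : ∀ x {_ : T (not (S (nv x)))} → nvar m′ x ≡ nvar m x
    keepN x {h} = frameN fr x (unset h)

    keepNA : ∀ a {_ : T (not (S (na a)))} i j → narr m′ a i j ≡ narr m a i j
    keepNA a {h} = frameNA fr a (unset h)

    keepR : ∀ x {_ : T (not (S (rv x)))} → rvar m′ x ≡ rvar m x
    keepR x {h} = frameR fr x (unset h)

    keepRA : ∀ a {_ : T (not (S (ra a)))} i j → rarr m′ a i j ≡ rarr m a i j
    keepRA a {h} = frameRA fr a (unset h)

  frame-refl : ∀ {S m} → Frame S m m
  frame-refl = record
    { frameN = λ _ _ → refl ; frameR = λ _ _ → refl ; frameNA = λ _ _ _ _ → refl ; frameRA = λ _ _ _ _ → refl }

  frame-trans : ∀ {S m m′ m″} → Frame S m m′ → Frame S m′ m″ → Frame S m m″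
  frame-trans f g = record
    { frameN  = λ x h → trans (frameN g x h) (frameN f x h)
    ; frameR  = λ x h → trans (frameR g x h) (frameR f x h)
    ; frameNA = λ a h i j → trans (frameNA g a h i j) (frameNA f a h i j)
    ; frameRA = λ a h i j → trans (frameRA g a h i j) (frameRA f a h i j)
    }

  frame-⊆ : ∀ {S S′ m m′} → (∀ l → S′ l ≡ false → S l ≡ false) → Frame S m m′ → Frame S′ m m′
  frame-⊆ sub f = record
    { frameN  = λ x h → frameN f x (sub (nv x) h)
    ; frameR  = λ x h → frameR f x (sub (rv x) h)
    ; frameNA = λ a h → frameNA f a (sub (na a) h)
    ; frameRA = λ a h → frameRA f a (sub (ra a) h)
    }

  data Update (m : Memory) : Loc → Memory → Set c where
    updN  : ∀ {x v} → Update m (nv x) (setN x v m)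
    updR  : ∀ {x v} → Update m (rv x) (setR x v m)
    updNA : ∀ {a i j v} → Update m (na a) (record m { narr = set₃ (narr m) a i j v })
    updRA : ∀ {a i j v} → Update m (ra a) (record m { rarr = set₃ (rarr m) a i j v })

  exec-update : ∀ b i m → Update m (target i) (exec b i m)
  exec-update b (const x v)      m = updN
  exec-update b (copy x y)       m = updN
  exec-update b (add x y z)      m = updN
  exec-update b (monus x y z)    m = updN
  exec-update b (half x y)       m = updN
  exec-update b (load x a y z)   m = updN
  exec-update b (store a y z x)  m = updNA {i = nvar m y} {nvar m z}
  exec-update b (flip x)         m = updN
  exec-update b (rzero x)        m = updR
  exec-update b (rone x)         m = updR
  exec-update b (rcopy x y)      m = updR
  exec-update b (radd x y z)     m = updR
  exec-update b (rneg x y)       m = updR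
  exec-update b (rmul x y z)     m = updR
  exec-update b (rload x a y z)  m = updR
  exec-update b (rstore a y z x) m = updRA {i = nvar m y} {nvar m z}

  update-frame : ∀ {m l m′} → Update m l m′ → Frame (l =ᴸ_) m m′
  update-frame {m} (updN {x} {v}) = record
    { frameN = λ y h → cong (λ b → if b then v else nvar m y) h
    ; frameR = λ _ _ → refl ; frameNA = λ _ _ _ _ → refl ; frameRA = λ _ _ _ _ → refl }
  update-frame {m} (updR {x} {v}) = record
    { frameR = λ y h → cong (λ b → if b then v else rvar m y) h
    ; frameN = λ _ _ → refl ; frameNA = λ _ _ _ _ → refl ; frameRA = λ _ _ _ _ → refl }
  update-frame {m} (updNA {a} {i} {j} {v}) = record
    { frameNA = λ a′ h i′ j′ → cong (λ b → if b ∧ (i ≡ᵇ i′) ∧ (j ≡ᵇ j′) then v else narr m a′ i′ j′) h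
    ; frameN = λ _ _ → refl ; frameR = λ _ _ → refl ; frameRA = λ _ _ _ _ → refl }
  update-frame {m} (updRA {a} {i} {j} {v}) = record
    { frameRA = λ a′ h i′ j′ → cong (λ b → if b ∧ (i ≡ᵇ i′) ∧ (j ≡ᵇ j′) then v else rarr m a′ i′ j′) h
    ; frameN = λ _ _ → refl ; frameR = λ _ _ → refl ; frameNA = λ _ _ _ _ → refl }

  exec-frame : ∀ b i m → Frame (target i =ᴸ_) m (exec b i m)
  exec-frame b i m = update-frame (exec-update b i m)

  -- Big-step execution with its exact number of steps. The premise of `instr` makes the outcome
  -- independent of the supplied bit, so a trace is valid on every tape.
  data Exec : Program → Memory → ℕ → Memory → Set c where
    done   : ∀ {m} → Exec [] m 0 m
    instr  : ∀ {i ss m t m′} → (∀ b → exec b i m ≡ exec false i m) →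
             Exec ss (exec false i m) t m′ → Exec (instr i ∷ ss) m (suc t) m′
    ifte   : ∀ {e p q ss m t m₁ t′ m′} → Exec (if holds e m then p else q) m t m₁ → Exec ss m₁ t′ m′ →
             Exec (ifte e p q ∷ ss) m (suc (t + t′)) m′
    leave  : ∀ {e p ss m t m′} → holds e m ≡ false → Exec ss m t m′ → Exec (while e p ∷ ss) m (suc t) m′
    enter  : ∀ {e p ss m t m₁ t′ m′} → holds e m ≡ true → Exec p m t m₁ → Exec (while e p ∷ ss) m₁ t′ m′ →
             Exec (while e p ∷ ss) m (suc (t + t′)) m′

  Exec-≡ : ∀ {p m t u m′} → t ≡ u → Exec p m t m′ → Exec p m u m′
  Exec-≡ refl x = x

  Exec-++ : ∀ {p q m t m₁ t′ m′} → Exec p m t m₁ → Exec q m₁ t′ m′ → Exec (p ++ q) m (t + t′) m′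
  Exec-++ done          y = y
  Exec-++ (instr d x)   y = instr d (Exec-++ x y)
  Exec-++ {t′ = t′} (ifte {e} {p} {q} {t = t} {t′ = t″} z x) y =
    Exec-≡ (cong suc (sym (+-assoc t t″ t′))) (ifte {e} {p} {q} z (Exec-++ x y))
  Exec-++ (leave h x)   y = leave h (Exec-++ x y)
  Exec-++ {t′ = t′} (enter {t = t} {t′ = t″} h z x) y =
    Exec-≡ (cong suc (sym (+-assoc t t″ t′))) (enter h z (Exec-++ x y))

  ∨-left : ∀ {S S′ : Loc → Bool} l → S l ∨ S′ l ≡ false → S l ≡ false
  ∨-left {S} {S′} l = ∨-conicalˡ (S l) (S′ l)

  ∨-right : ∀ {S S′ : Loc → Bool} l → S l ∨ S′ l ≡ false → S′ l ≡ false
  ∨-right {S} {S′} l = ∨-conicalʳ (S l) (S′ l)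

  Exec-frame : ∀ {p m t m′} → Exec p m t m′ → Frame (assigns p) m m′
  Exec-frame done = frame-refl
  Exec-frame (instr {i} {ss} {m} d x) =
    frame-trans (frame-⊆ (∨-left {target i =ᴸ_} {assigns ss}) (exec-frame false i m))
                (frame-⊆ (∨-right {target i =ᴸ_} {assigns ss}) (Exec-frame x))
  Exec-frame (ifte {e} {p} {q} {ss} {m} z x) =
    frame-trans (frame-⊆ sub (Exec-frame z)) (frame-⊆ (∨-right {assigns₁ (ifte e p q)} {assigns ss}) (Exec-frame x))
    where
    sub : ∀ l → (assigns p l ∨ assigns q l) ∨ assigns ss l ≡ false → assigns (if holds e m then p else q) l ≡ false
    sub l h with holds e m
    ... | true  = ∨-conicalˡ _ (assigns q l) (∨-conicalˡ _ (assigns ss l) h)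
    ... | false = ∨-conicalʳ (assigns p l) _ (∨-conicalˡ _ (assigns ss l) h)
  Exec-frame (leave {e} {p} {ss} h x) = frame-⊆ (∨-right {assigns p} {assigns ss}) (Exec-frame x)
  Exec-frame (enter {e} {p} {ss} h z x) =
    frame-trans (frame-⊆ (∨-left {assigns p} {assigns ss}) (Exec-frame z)) (Exec-frame x)

  -- The cost bound is amortised: every decrement of vK pays for W steps.
  record Run {q} (W : ℕ) (p : Program) (m : Memory) (b : ℕ) (Q : Memory → Set q) : Set (c ⊔ q) where
    constructor mkRun
    field
      {final} : Memory
      {steps} : ℕ
      trace   : Exec p m steps final
      cost    : steps + W * nvar final vK ≤ b + W * nvar m vK
      post    : Q final

  module _ {q} {W : ℕ} {Q : Memory → Set q} where

    stop : ∀ {m b} → Q m → Run W [] m b Q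
    stop h = mkRun done (m≤n+m _ _) h

    -- `quiet` excludes writes to `vK`; the credit W · vK is then the same before and after the
    -- instruction.
    ins : ∀ {i ss m b} {quiet : T (not (target i =ᴸ nv vK))} → (∀ b → exec b i m ≡ exec false i m) →
          Run W ss (exec false i m) b Q → Run W (instr i ∷ ss) m (suc b) Q
    ins {i} {ss} {m} {b} {h} d (mkRun {m′} {t} x co po) =
      mkRun (instr d x) (s≤s (subst (λ v → t + W * nvar m′ vK ≤ b + W * v) (keepN (exec-frame false i m) vK {h}) co)) po

    weaken : ∀ {p m b b′} → b ≤ b′ → Run W p m b Q → Run W p m b′ Q
    weaken h (mkRun x co po) = mkRun x (≤-trans co (+-monoˡ-≤ _ h)) po

    bind : ∀ {q′} p {ss m b b′} {Q′ : Memory → Set q′} → Run W p m b Q′ →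
           (∀ m′ → Frame (assigns p) m m′ → Q′ m′ → Run W ss m′ b′ Q) → Run W (p ++ ss) m (b + b′) Q
    bind p {m = m} {b} {b′} (mkRun {m₁} {t} x co po) k with k m₁ (Exec-frame x) po
    ... | mkRun {m₂} {t′} x′ co′ po′ = mkRun (Exec-++ x x′) bound po′
      where
      open ≤-Reasoning
      bound : t + t′ + W * nvar m₂ vK ≤ b + b′ + W * nvar m vK
      bound = begin
        t + t′ + W * nvar m₂ vK    ≡⟨ +-assoc t t′ _ ⟩
        t + (t′ + W * nvar m₂ vK)  ≤⟨ +-monoʳ-≤ t co′ ⟩
        t + (b′ + W * nvar m₁ vK)  ≡⟨ swap t b′ _ ⟩
        b′ + (t + W * nvar m₁ vK)  ≤⟨ +-monoʳ-≤ b′ co ⟩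
        b′ + (b + W * nvar m vK)   ≡⟨ swap′ b′ b _ ⟩
        b + b′ + W * nvar m vK     ∎
        where
        swap : ∀ x y z → x + (y + z) ≡ y + (x + z)
        swap = solve-∀
        swap′ : ∀ x y z → x + (y + z) ≡ y + x + z
        swap′ = solve-∀

    branch : ∀ {e p q m b} → (holds e m ≡ true → Run W p m b Q) → (holds e m ≡ false → Run W q m b Q) →
             Run W [ ifte e p q ] m (suc b) Q
    branch {e} {p} {q} {m} {b} f g = go (holds e m) refl
      where
      go : ∀ v → holds e m ≡ v → Run W [ ifte e p q ] m (suc b) Q
      go v eq with (if v then p else q) | cong (λ v → if v then p else q) eq | chosen v eq
        where
        chosen : ∀ v → holds e m ≡ v → Run W (if v then p else q) m b Q
        chosen true  = f
        chosen false = g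
      ... | r | refl | mkRun {m′} {t} x co po =
        mkRun (ifte x done) (s≤s (subst (λ u → u + W * nvar m′ vK ≤ _) (sym (+-identityʳ t)) co)) po

  Run-map : ∀ {q q′ W p m b} {Q : Memory → Set q} {Q′ : Memory → Set q′} →
            (∀ m′ → Frame (assigns p) m m′ → Q m′ → Q′ m′) → Run W p m b Q → Run W p m b Q′
  Run-map f (mkRun x co po) = mkRun x co (f _ (Exec-frame x) po)

  -- Additions, comparisons and array indices take their operands from variables only, so these two
  -- hold the constants 1 and 0 throughout.
  vOne vZero : NVar
  vOne  = 2
  vZero = 3

  for : NVar → NVar → Program → Stmt
  for v e body = while (less v e) (body ++ [ instr (add v v vOne) ])

  <ᵇ-true : ∀ {m n} → m < n → (m <ᵇ n) ≡ true
  <ᵇ-true h = Equivalence.to T-≡ (<⇒<ᵇ h)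

  <ᵇ-false : ∀ {m n} → n ≤ m → (m <ᵇ n) ≡ false
  <ᵇ-false {m} {n} h with m <ᵇ n in eq
  ... | false = refl
  ... | true  = contradiction (<ᵇ⇒< m n (Equivalence.from T-≡ eq)) (≤⇒≯ h)

  ≡ᵇ-refl : ∀ n → (n ≡ᵇ n) ≡ true
  ≡ᵇ-refl zero    = refl
  ≡ᵇ-refl (suc n) = ≡ᵇ-refl n

  -- Rule for counting loops. `Inv t` is what holds after t iterations; `stable` is there because
  -- the counter is incremented only after the body has established the invariant. An iteration
  -- costs 2 more than the body, for the test and the increment, and the failing test adds 1.
  module _ {q W} {v e : NVar} {body : Program} (Inv : ℕ → Memory → Set q) (m₀ : Memory) (s len b : ℕ)
    {bv : T (not (assigns body (nv v)))} {be : T (not (assigns (body ++ [ instr (add v v vOne) ]) (nv e)))}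
    {b1 : T (not (assigns (body ++ [ instr (add v v vOne) ]) (nv vOne)))} {vk : T (not (v ≡ᵇ vK))}
    (one : nvar m₀ vOne ≡ 1) (end : nvar m₀ e ≡ s + len)
    (stable : ∀ t m x → Inv t m → Inv t (setN v x m))
    (step : ∀ t m → t < len → nvar m v ≡ s + t → Frame (assigns [ for v e body ]) m₀ m → Inv t m →
            Run W body m b (Inv (suc t)))
    where

    private
      full : Program
      full = body ++ [ instr (add v v vOne) ]

      iterate : ∀ r t m → t + r ≡ len → nvar m v ≡ s + t → Frame (assigns [ for v e body ]) m₀ m → Inv t m →
                Run W [ for v e body ] m (r * (b + 2) + 1) (Inv len)
      iterate zero t m eq hv fr inv =
        mkRun (leave stops done) ≤-refl (subst (λ u → Inv u m) eq′ inv)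
        where
        eq′ : t ≡ len
        eq′ = trans (sym (+-identityʳ t)) eq
        stops : holds (less v e) m ≡ false
        stops = trans (cong₂ _<ᵇ_ hv (trans (frameN fr e (unset′ e be)) end)) (<ᵇ-false (≤-reflexive (cong (s +_) (sym eq′))))
          where
          unset′ : ∀ y → T (not (assigns full (nv y))) → assigns [ for v e body ] (nv y) ≡ false
          unset′ y h with assigns full (nv y)
          ... | false = refl
      iterate (suc r) t m eq hv fr inv = go (bind body (step t m t<len hv fr inv) after)
        where
        unset′ : ∀ y → T (not (assigns full (nv y))) → assigns [ for v e body ] (nv y) ≡ false
        unset′ y h with assigns full (nv y)
        ... | false = refl
        t<len : t < len
        t<len = subst (t <_) eq (m<m+n t z<s)
        enters : holds (less v e) m ≡ true
        enters = trans (cong₂ _<ᵇ_ hv (trans (frameN fr e (unset′ e be)) end)) (<ᵇ-true (+-monoʳ-< s t<len))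
        After : Memory → Set _
        After m′ = nvar m′ v ≡ s + suc t × Inv (suc t) m′
        after : ∀ m′ → Frame (assigns body) m m′ → Inv (suc t) m′ → Run W [ instr (add v v vOne) ] m′ 1 After
        after m′ fr′ inv′ = ins {i = add v v vOne} {quiet = vk} (λ _ → refl) (stop (count , stable (suc t) m′ _ inv′))
          where
          one′ : nvar m′ vOne ≡ 1
          one′ = trans (frameN fr′ vOne (∨-free body vOne b1)) (trans (frameN fr vOne (unset′ vOne b1)) one)
            where
            ∨-free : ∀ p y → T (not (assigns (p ++ [ instr (add v v vOne) ]) (nv y))) → assigns p (nv y) ≡ false
            ∨-free []      y h = refl
            ∨-free (x ∷ p) y h with assigns₁ x (nv y)
            ... | false = ∨-free p y h
          count : nvar (setN v (nvar m′ v + nvar m′ vOne) m′) v ≡ s + suc t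
          count rewrite ≡ᵇ-refl v = trans (cong₂ _+_ (trans (keepN fr′ v {bv}) hv) one′) (trans (+-assoc s t 1) (cong (s +_) (+-comm t 1)))
        go : Run W full m (b + 1) After → Run W [ for v e body ] m (suc r * (b + 2) + 1) (Inv len)
        go (mkRun {m₁} {t₁} x co (hv′ , inv′))
          with iterate r (suc t) m₁ (trans (sym (+-suc t r)) eq) hv′ (frame-trans fr (frame-⊆ (λ l h → ∨-conicalˡ _ false h) (Exec-frame x))) inv′
        ... | mkRun {m₂} {t₂} x′ co′ po = mkRun (enter enters x x′) bound po
          where
          open ≤-Reasoning
          k₂ = W * nvar m₂ vK
          k₁ = W * nvar m₁ vK
          k₀ = W * nvar m vK
          shuffle : ∀ x y z → suc (x + y) + z ≡ suc x + (y + z)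
          shuffle = solve-∀
          shuffle′ : ∀ x y z → suc x + (y + z) ≡ suc y + (x + z)
          shuffle′ = solve-∀
          shuffle″ : ∀ r b z → suc (r * (b + 2) + 1) + (b + 1 + z) ≡ suc r * (b + 2) + 1 + z
          shuffle″ = solve-∀
          bound : suc (t₁ + t₂) + k₂ ≤ suc r * (b + 2) + 1 + k₀
          bound = begin
            suc (t₁ + t₂) + k₂                  ≡⟨ shuffle t₁ t₂ k₂ ⟩
            suc t₁ + (t₂ + k₂)                  ≤⟨ +-monoʳ-≤ (suc t₁) co′ ⟩
            suc t₁ + (r * (b + 2) + 1 + k₁)     ≡⟨ shuffle′ t₁ _ k₁ ⟩
            suc (r * (b + 2) + 1) + (t₁ + k₁)   ≤⟨ +-monoʳ-≤ (suc (r * (b + 2) + 1)) co ⟩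
            suc (r * (b + 2) + 1) + (b + 1 + k₀) ≡⟨ shuffle″ r b k₀ ⟩
            suc r * (b + 2) + 1 + k₀            ∎

    for-run : nvar m₀ v ≡ s → Inv 0 m₀ → Run W [ for v e body ] m₀ (len * (b + 2) + 1) (Inv len)
    for-run start inv = iterate len 0 m₀ refl (trans start (sym (+-identityʳ s))) frame-refl inv

  -- Expected running time

  -- D · E[min{T, M}] ≤ a for all M ≤ N; the factor D avoids fractions when coin flips are averaged.
  record Good {q} (Q : Memory → Set q) (D N : ℕ) (κ : Config) (a : ℕ) : Set (c ⊔ q) where
    field
      halting : ∀ {M} → M ≤ N → (ω : Vec Bool M) → ∀ m → run κ ω ≡ ([] , m) → Q m
      average : ∀ {M} → M ≤ N → D * sumTapes M (time κ) ≤ a * 2 ^ M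

  open Good public

  module _ {q} {Q : Memory → Set q} where

    good-mono : ∀ {D N κ a a′} → a ≤ a′ → Good Q D N κ a → Good Q D N κ a′
    good-mono h g = record
      { halting = halting g
      ; average = λ {M} le → ≤-trans (average g le) (*-monoˡ-≤ (2 ^ M) h)
      }

    good-≤ : ∀ {D N N′ κ a} → N′ ≤ N → Good Q D N κ a → Good Q D N′ κ a
    good-≤ h g = record { halting = λ le → halting g (≤-trans le h) ; average = λ le → average g (≤-trans le h) }

    good-scale : ∀ {D N κ a} e → Good Q D N κ a → Good Q (e * D) N κ (e * a)
    good-scale {D} {N} {κ} {a} e g = record
      { halting = halting g
      ; average = λ {M} le → subst₂ _≤_ (sym (*-assoc e D _)) (sym (*-assoc e a _)) (*-monoʳ-≤ e (average g le)) }

    good-unscale : ∀ {D N κ a} e .{{_ : NonZero e}} → Good Q (e * D) N κ (e * a) → Good Q D N κ a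
    good-unscale {D} {N} {κ} {a} e g = record
      { halting = halting g
      ; average = λ {M} le → *-cancelˡ-≤ e (subst₂ _≤_ (*-assoc e D _) (*-assoc e a _) (average g le)) }

    -- An unfinished machine that may make no step satisfies any bound. This is the base case for
    -- the main loop.
    good-zero : ∀ {D s ss m a} → Good Q D 0 (s ∷ ss , m) a
    good-zero {D} = record { halting = λ { z≤n [] _ () } ; average = λ { z≤n → ≤-trans (≤-reflexive (*-zeroʳ D)) z≤n } }

    -- The two continuations are averaged by doubling the scale and adding their bounds. The step
    -- itself costs 1, which is 2 · D at the new scale.
    good-step : ∀ {D N s ss m} (f : Bool → ℕ) → (∀ b → Good Q D N (step b (s ∷ ss , m)) (f b)) →
                Good Q (2 * D) (suc N) (s ∷ ss , m) (2 * D + (f false + f true))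
    good-step {D} {N} {s} {ss} {m} f g = record { halting = hal ; average = ave }
      where
      κ : Config
      κ = s ∷ ss , m
      hal : ∀ {M} → M ≤ suc N → (ω : Vec Bool M) → ∀ m′ → run κ ω ≡ ([] , m′) → Q m′
      hal _          []      m′ ()
      hal (s≤s M≤N) (b ∷ ω) m′ eq = halting (g b) M≤N ω m′ eq
      ave : ∀ {M} → M ≤ suc N → 2 * D * sumTapes M (time κ) ≤ (2 * D + (f false + f true)) * 2 ^ M
      ave {zero} _ = ≤-trans (≤-reflexive (*-zeroʳ (2 * D))) z≤n
      ave {suc M} (s≤s M≤N) = begin
        2 * D * (sumTapes M (λ ω → suc (t false ω)) + sumTapes M (λ ω → suc (t true ω)))
          ≡⟨ cong (2 * D *_) (cong₂ _+_ (split false) (split true)) ⟩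
        2 * D * ((1 * 2 ^ M + sumTapes M (t false)) + (1 * 2 ^ M + sumTapes M (t true)))
          ≡⟨ shuffle D (2 ^ M) _ _ ⟩
        4 * D * 2 ^ M + 2 * (D * sumTapes M (t false) + D * sumTapes M (t true))
          ≤⟨ +-monoʳ-≤ (4 * D * 2 ^ M) (*-monoʳ-≤ 2 (+-mono-≤ (average (g false) M≤N) (average (g true) M≤N))) ⟩
        4 * D * 2 ^ M + 2 * (f false * 2 ^ M + f true * 2 ^ M)
          ≡⟨ shuffle′ D (2 ^ M) (f false) (f true) ⟩
        (2 * D + (f false + f true)) * (2 ^ M + (2 ^ M + 0)) ∎
        where
        open ≤-Reasoning
        t : Bool → Vec Bool M → ℕ
        t b = time (step b κ)
        split : ∀ b → sumTapes M (λ ω → suc (t b ω)) ≡ 1 * 2 ^ M + sumTapes M (t b)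
        split b = trans (sumTapes-+ M (λ _ → 1) (t b)) (cong (_+ sumTapes M (t b)) (sumTapes-const M 1))
        shuffle : ∀ D p x y → 2 * D * ((1 * p + x) + (1 * p + y)) ≡ 4 * D * p + 2 * (D * x + D * y)
        shuffle = solve-∀
        shuffle′ : ∀ D p x y → 4 * D * p + 2 * (x * p + y * p) ≡ (2 * D + (x + y)) * (p + (p + 0))
        shuffle′ = solve-∀

    good-det : ∀ {D N s ss m a} κ′ → (∀ b → step b (s ∷ ss , m) ≡ κ′) → Good Q D N κ′ a →
               Good Q D (suc N) (s ∷ ss , m) (D + a)
    good-det {D} {N} {s} {ss} {m} {a} κ′ eq g =
      good-unscale 2 (good-mono (≤-reflexive (sh D a))
        (good-step (λ _ → a) (λ b → subst (λ κ → Good Q D N κ a) (sym (eq b)) g)))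
      where
      sh : ∀ D a → 2 * D + (a + a) ≡ 2 * (D + a)
      sh = solve-∀

    -- Carries a deterministic trace over to expected time: each step costs 1 at scale D. Every step
    -- would also allow N to grow by one; this gain is discarded, so that the length of the trace
    -- does not enter the step bound.
    good-exec : ∀ {p ss m t m′ D N a} → Exec p m t m′ → Good Q D N (ss , m′) a → Good Q D N (p ++ ss , m) (t * D + a)
    good-exec done g = g
    good-exec {D = D} {N} {a} (instr {i} {t = t} d x) g = good-≤ (n≤1+n N)
      (good-mono (≤-reflexive (sym (+-assoc D (t * D) a))) (good-det _ (λ b → cong (_ ,_) (d b)) (good-exec x g)))
    good-exec {ss = rest} {m} {D = D} {N} {a} (ifte {e} {p} {q} {ss} {t = t} {t′ = t′} z x) g = good-≤ (n≤1+n N)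
      (good-mono (≤-reflexive (sh t t′ D a)) (good-det _ (λ b → refl)
        (good-exec z (good-exec x g))))
      where
      sh : ∀ t t′ D a → D + (t * D + (t′ * D + a)) ≡ suc (t + t′) * D + a
      sh = solve-∀
    good-exec {m = m} {D = D} {N} {a} (leave {t = t} h x) g = good-≤ (n≤1+n N)
      (good-mono (≤-reflexive (sym (+-assoc D (t * D) a)))
        (good-det _ (λ b → cong (λ v → (if v then _ else _) , m) h) (good-exec x g)))
    good-exec {m = m} {D = D} {N} {a} (enter {t = t} {t′ = t′} h z x) g = good-≤ (n≤1+n N)
      (good-mono (≤-reflexive (sh t t′ D a))
        (good-det _ (λ b → cong (λ v → (if v then _ else _) , m) h)
          (good-exec z (good-exec x g))))
      where
      sh : ∀ t t′ D a → D + (t * D + (t′ * D + a)) ≡ suc (t + t′) * D + a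
      sh = solve-∀

  vC vBit : NVar
  vC   = 5
  vBit = 7

  fillBody : NArr → Program
  fillBody a = instr (flip vBit) ∷ instr (store a vZero vC vBit) ∷ []

  fill : NArr → Program
  fill a = instr (const vC 0) ∷ for vC vN (fillBody a) ∷ []

  record Filled (a : NArr) (i : ℕ) {r} (x : Vec Bool r) (m m′ : Memory) : Set c where
    field
      fillFrame : Frame (assigns (fill a)) m m′
      old : ∀ j → j < i → narr m′ a 0 j ≡ narr m a 0 j
      new : ∀ t → t < r → narr m′ a 0 (i + t) ≡ 𝟙 (bit x t)

  open Filled public

  <⇒≡ᵇ-false : ∀ {i j} → j < i → (i ≡ᵇ j) ≡ false
  <⇒≡ᵇ-false {suc i} {zero}  _         = refl
  <⇒≡ᵇ-false {suc i} {suc j} (s≤s h) = <⇒≡ᵇ-false h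

  module _ {q} {Q : Memory → Set q} (a : NArr) {ss : Program} where

    -- Each flip doubles the scale, so after r of them the bounds f x of the continuations, one for
    -- each vector x, are summed. A bit takes four steps: test, flip, store, increment.
    fill-loop : ∀ r i m {D N} (f : Vec Bool r → ℕ) →
      nvar m vC ≡ i → nvar m vN ≡ i + r → nvar m vOne ≡ 1 → nvar m vZero ≡ 0 →
      (∀ x m′ → Filled a i x m m′ → Good Q D N (ss , m′) (f x)) →
      Good Q (2 ^ r * D) N (for vC vN (fillBody a) ∷ ss , m) (2 ^ r * D * (r * 4 + 1) + sumTapes r f)
    fill-loop zero i m {D} {N} f hc hn h1 h0 k =
      good-mono (≤-reflexive (sh D (f []))) (good-scale 1 (good-≤ (n≤1+n N)
        (good-det _ (λ _ → cong (λ v → (if v then fillBody a ++ [ instr (add vC vC vOne) ] ++ for vC vN (fillBody a) ∷ ss else ss) , m) exit)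
          (k [] m (record { fillFrame = frame-refl ; old = λ _ _ → refl ; new = λ _ () })))))
      where
      exit : (nvar m vC <ᵇ nvar m vN) ≡ false
      exit = trans (cong₂ _<ᵇ_ hc hn) (<ᵇ-false (≤-reflexive (+-identityʳ i)))
      sh : ∀ D z → 1 * (D + z) ≡ 1 * D * 1 + z
      sh = solve-∀
    fill-loop (suc r) i m {D} {N} f hc hn h1 h0 k = good-≤ (m≤n+m N 4)
      (subst₂ (λ D′ b → Good Q D′ (4 + N) (for vC vN (fillBody a) ∷ ss , m) b) (scale (2 ^ r) D) (sh (2 ^ r) D r _ _)
        (good-det _ (λ _ → cong (λ v → (if v then body ++ for vC vN (fillBody a) ∷ ss else ss) , m) enters)
          (good-step cost-of (λ b → good-det _ (λ _ → refl) (good-det _ (λ _ → refl) (rec b))))))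
      where
      body : Program
      body = fillBody a ++ [ instr (add vC vC vOne) ]
      enters : (nvar m vC <ᵇ nvar m vN) ≡ true
      enters = trans (cong₂ _<ᵇ_ hc hn) (<ᵇ-true (m<m+n i z<s))
      next : Bool → Memory
      next b = exec b (add vC vC vOne) (exec b (store a vZero vC vBit) (exec b (flip vBit) m))
      cost-of : Bool → ℕ
      cost-of b = 2 ^ r * D + (2 ^ r * D + (2 ^ r * D * (r * 4 + 1) + sumTapes r (f ∘ (b ∷_))))
      scale : ∀ p D → 2 * (p * D) ≡ (p + (p + 0)) * D
      scale = solve-∀
      sh : ∀ p D r u v → 2 * (p * D) + (2 * (p * D) + (p * D + (p * D + (p * D * (r * 4 + 1) + u)) + (p * D + (p * D + (p * D * (r * 4 + 1) + v)))))
           ≡ (p + (p + 0)) * D * (suc r * 4 + 1) + (u + v)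
      sh = solve-∀
      next-frame : ∀ b → Frame (assigns (fill a)) m (next b)
      next-frame b = frame-trans (frame-⊆ s₁ (exec-frame b (flip vBit) m))
        (frame-trans (frame-⊆ s₂ (exec-frame b (store a vZero vC vBit) (exec b (flip vBit) m)))
                     (frame-⊆ s₃ (exec-frame b (add vC vC vOne) (exec b (store a vZero vC vBit) (exec b (flip vBit) m)))))
        where
        s₃ : ∀ l → assigns (fill a) l ≡ false → (nv vC =ᴸ l) ≡ false
        s₃ l h = ∨-conicalˡ _ _ h
        inner : ∀ l → assigns (fill a) l ≡ false → assigns body l ≡ false
        inner l h = ∨-conicalˡ (assigns body l) false (∨-conicalʳ (nv vC =ᴸ l) _ h)
        s₁ : ∀ l → assigns (fill a) l ≡ false → (nv vBit =ᴸ l) ≡ false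
        s₁ l h = ∨-conicalˡ _ _ (inner l h)
        s₂ : ∀ l → assigns (fill a) l ≡ false → (na a =ᴸ l) ≡ false
        s₂ l h = ∨-conicalˡ _ _ (∨-conicalʳ (nv vBit =ᴸ l) _ (inner l h))
      written : ∀ b j → (i ≡ᵇ j) ≡ true → narr (next b) a 0 j ≡ 𝟙 b
      written b j h rewrite ≡ᵇ-refl a | h0 | hc | h = refl
      unwritten : ∀ b j → j < i → narr (next b) a 0 j ≡ narr m a 0 j
      unwritten b j h rewrite ≡ᵇ-refl a | h0 | hc | <⇒≡ᵇ-false h = refl
      rec : ∀ b → Good Q (2 ^ r * D) N (for vC vN (fillBody a) ∷ ss , next b) (2 ^ r * D * (r * 4 + 1) + sumTapes r (f ∘ (b ∷_)))
      rec b = fill-loop r (suc i) (next b) (f ∘ (b ∷_)) (trans (cong₂ _+_ hc h1) (+-comm i 1)) (trans hn (+-suc i r)) h1 h0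
        (λ x m′ fd → k (b ∷ x) m′ (record
          { fillFrame = frame-trans (next-frame b) (fillFrame fd)
          ; old = λ j j<i → trans (old fd j (m<n⇒m<1+n j<i)) (unwritten b j j<i)
          ; new = λ { zero    _         → trans (cong (narr m′ a 0) (+-identityʳ i)) (trans (old fd i ≤-refl) (written b i (≡ᵇ-refl i)))
                    ; (suc t) (s≤s t<r) → trans (cong (narr m′ a 0) (+-suc i t)) (new fd t t<r) }
          }))

    good-fill : ∀ m {n D N} (f : Vec Bool n → ℕ) → nvar m vN ≡ n → nvar m vOne ≡ 1 → nvar m vZero ≡ 0 →
      (∀ x m′ → Frame (assigns (fill a)) m m′ → (∀ t → t < n → narr m′ a 0 t ≡ 𝟙 (bit x t)) → Good Q D N (ss , m′) (f x)) →
      Good Q (2 ^ n * D) N (fill a ++ ss , m) (2 ^ n * D * (n * 4 + 2) + sumTapes n f)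
    good-fill m {n} {D} {N} f hn h1 h0 k = good-≤ (n≤1+n N) (good-mono (≤-reflexive (sh (2 ^ n * D) n (sumTapes n f)))
      (good-det _ (λ _ → refl) (fill-loop n 0 (setN vC 0 m) f refl hn h1 h0
        (λ x m′ fd → k x m′ (frame-trans first (fillFrame fd)) (new fd)))))
      where
      sh : ∀ E n z → E + (E * (n * 4 + 1) + z) ≡ E * (n * 4 + 2) + z
      sh = solve-∀
      first : Frame (assigns (fill a)) m (setN vC 0 m)
      first = frame-⊆ (λ l h → ∨-conicalˡ _ _ h) (exec-frame false (const vC 0) m)

  -- Random tests over the ring

  module Rg = Ring R

  ≈-reflexive : ∀ {x y} → x ≡ y → x ≈ y
  ≈-reflexive = Rg.reflexive

  -- Nested to the left, in the order in which the accumulating loops add; `∑≈sum` relates it to the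
  -- sum in the matrix product.
  ∑ : ℕ → (ℕ → Carrier) → Carrier
  ∑ zero    f = 0#
  ∑ (suc n) f = ∑ n f +ᴿ f n

  ∑-cong : ∀ n {f g} → (∀ i → i < n → f i ≈ g i) → ∑ n f ≈ ∑ n g
  ∑-cong zero    h = Rg.refl
  ∑-cong (suc n) h = Rg.+-cong (∑-cong n (λ i p → h i (m<n⇒m<1+n p))) (h n ≤-refl)

  +ᴿ-interchange : ∀ a b x y → (a +ᴿ b) +ᴿ (x +ᴿ y) ≈ (a +ᴿ x) +ᴿ (b +ᴿ y)
  +ᴿ-interchange a b x y =
    Rg.trans (Rg.+-assoc a b (x +ᴿ y)) (Rg.trans (Rg.+-congˡ (Rg.trans (Rg.sym (Rg.+-assoc b x y))
      (Rg.trans (Rg.+-congʳ (Rg.+-comm b x)) (Rg.+-assoc x b y)))) (Rg.sym (Rg.+-assoc a x (b +ᴿ y))))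

  ∑-0 : ∀ n → ∑ n (λ _ → 0#) ≈ 0#
  ∑-0 zero    = Rg.refl
  ∑-0 (suc n) = Rg.trans (Rg.+-identityʳ _) (∑-0 n)

  ∑-+ : ∀ n f g → ∑ n (λ i → f i +ᴿ g i) ≈ ∑ n f +ᴿ ∑ n g
  ∑-+ zero    f g = Rg.sym (Rg.+-identityʳ 0#)
  ∑-+ (suc n) f g = Rg.trans (Rg.+-congʳ (∑-+ n f g)) (+ᴿ-interchange _ _ _ _)

  mask : Bool → Carrier → Carrier
  mask b v = if b then v else 0#

  mask-cong : ∀ b {v w} → v ≈ w → mask b v ≈ mask b w
  mask-cong true  h = h
  mask-cong false h = Rg.refl

  ∑-mask : ∀ n b f → ∑ n (λ i → mask b (f i)) ≈ mask b (∑ n f)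
  ∑-mask n true  f = Rg.refl
  ∑-mask n false f = ∑-0 n

  -- Column tests are row tests for the transposed matrices over the opposite ring.
  data Side : Set where
    row col : Side

  sel : ∀ {a} {X : Set a} → Side → X → X → X
  sel row x y = x
  sel col x y = y

  get : Side → (ℕ → ℕ → Carrier) → ℕ → ℕ → Carrier
  get row M i j = M i j
  get col M i j = M j i

  mul : Side → Carrier → Carrier → Carrier
  mul row x y = x *ᴿ y
  mul col x y = y *ᴿ x

  mul-cong : ∀ s {x x′ y y′} → x ≈ x′ → y ≈ y′ → mul s x y ≈ mul s x′ y′
  mul-cong row h h′ = Rg.*-cong h h′
  mul-cong col h h′ = Rg.*-cong h′ h

  mul-+ : ∀ s x y z → mul s x (y +ᴿ z) ≈ mul s x y +ᴿ mul s x z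
  mul-+ row = Rg.distribˡ
  mul-+ col = Rg.distribʳ

  mul-mask : ∀ s b x y → mul s x (mask b y) ≈ mask b (mul s x y)
  mul-mask s   true  x y = Rg.refl
  mul-mask row false x y = Rg.zeroʳ x
  mul-mask col false x y = Rg.zeroˡ x

  mul-0 : ∀ s x → mul s x 0# ≈ 0#
  mul-0 row = Rg.zeroʳ
  mul-0 col = Rg.zeroˡ

  -- Associativity P (Q z) = (P Q) z for a 0/1 vector z: a line of the product is tested without
  -- computing its entries.
  ∑-product : ∀ s n len (z : ℕ → Bool) (P : ℕ → Carrier) (Q : ℕ → ℕ → Carrier) →
    ∑ n (λ l → mul s (P l) (∑ len (λ t → mask (z t) (Q l t)))) ≈
    ∑ len (λ t → mask (z t) (∑ n (λ l → mul s (P l) (Q l t))))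
  ∑-product s n zero      z P Q = Rg.trans (∑-cong n (λ l _ → mul-0 s (P l))) (∑-0 n)
  ∑-product s n (suc len) z P Q =
    Rg.trans (∑-cong n (λ l _ → Rg.trans (mul-+ s (P l) _ _) (Rg.+-congˡ (mul-mask s (z len) (P l) (Q l len)))))
    (Rg.trans (∑-+ n _ _) (Rg.+-cong (∑-product s n len z P Q) (∑-mask n (z len) _)))

  ∑-switch : ∀ n (f : ℕ → Carrier) (z z′ : ℕ → Bool) {t₀} → t₀ < n → (∀ t → t ≢ t₀ → z′ t ≡ z t) →
    z t₀ ≡ false → z′ t₀ ≡ true → ∑ n (λ t → mask (z′ t) (f t)) ≈ ∑ n (λ t → mask (z t) (f t)) +ᴿ f t₀
  ∑-switch (suc n) f z z′ {t₀} (s≤s le) same off on with m≤n⇒m<n∨m≡n le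
  ... | inj₁ t₀<n rewrite same n (λ eq → <⇒≢ t₀<n (sym eq)) =
    Rg.trans (Rg.+-congʳ (∑-switch n f z z′ t₀<n same off on))
    (Rg.trans (Rg.+-assoc _ _ _) (Rg.trans (Rg.+-congˡ (Rg.+-comm _ _)) (Rg.sym (Rg.+-assoc _ _ _))))
  ... | inj₂ refl rewrite off | on =
    Rg.+-congʳ (Rg.trans (∑-cong n (λ t t<n → ≈-reflexive (cong (λ b → mask b (f t)) (same t (<⇒≢ t<n)))))
                         (Rg.sym (Rg.+-identityʳ _)))

  agree : (ℕ → Bool) → ℕ → (f g : ℕ → Carrier) → Bool
  agree z n f g = does (∑ n (λ t → mask (z t) (f t)) ≟ ∑ n (λ t → mask (z t) (g t)))

  agree-≈ : ∀ z n {f g} → agree z n f g ≡ true → ∑ n (λ t → mask (z t) (f t)) ≈ ∑ n (λ t → mask (z t) (g t))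
  agree-≈ z n {f} {g} h with ∑ n (λ t → mask (z t) (f t)) ≟ ∑ n (λ t → mask (z t) (g t))
  ... | yes p = p

  ≈-agree : ∀ z n {f g} → (∀ t → t < n → f t ≈ g t) → agree z n f g ≡ true
  ≈-agree z n {f} {g} h with ∑ n (λ t → mask (z t) (f t)) ≟ ∑ n (λ t → mask (z t) (g t))
  ... | yes p = refl
  ... | no ¬p = contradiction (∑-cong n (λ t t<n → mask-cong (z t) (h t t<n))) ¬p

  -- Switching bit t₀ on adds f t₀ to one sum and g t₀ to the other, and sums can be cancelled.
  -- Since all coefficients are 0 or 1, zero divisors of the ring do no harm.
  agree-switch : ∀ n f g (z z′ : ℕ → Bool) {t₀} → t₀ < n → (∀ t → t ≢ t₀ → z′ t ≡ z t) →
    z t₀ ≡ false → z′ t₀ ≡ true → agree z n f g ≡ true → agree z′ n f g ≡ true → f t₀ ≈ g t₀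
  agree-switch n f g z z′ t₀<n same off on e e′ =
    GroupProperties.∙-cancelˡ Rg.+-group _ _ _
      (Rg.trans (Rg.sym (∑-switch n f z z′ t₀<n same off on))
      (Rg.trans (agree-≈ z′ n e′)
      (Rg.trans (∑-switch n g z z′ t₀<n same off on) (Rg.+-congʳ (Rg.sym (agree-≈ z n e))))))

  -- Toggling bit s + t₀ changes the difference of the two sums by f t₀ − g t₀, so the sums agree for at most one of its values.
  agree-half : ∀ N s len (f g : ℕ → Carrier) {t₀} → t₀ < len → s + t₀ < N → f t₀ ≉ g t₀ →
    2 * sumTapes N (λ x → 𝟙 (agree (λ t → bit x (s + t)) len f g)) ≤ 2 ^ N
  agree-half N s len f g {t₀} t₀<len p<N f≉g = sumTapes-half N (s + t₀) _ exclusive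
    where
    Z : Vec Bool N → ℕ → Bool
    Z x t = bit x (s + t)
    same : ∀ x t → t ≢ t₀ → Z (toggle (s + t₀) x) t ≡ Z x t
    same x t ne = bit-toggle-≢ (s + t₀) (s + t) x (ne ∘ +-cancelˡ-≡ s t t₀)
    exclusive : ∀ x → 𝟙 (agree (Z x) len f g) + 𝟙 (agree (Z (toggle (s + t₀) x)) len f g) ≤ 1
    exclusive x with agree (Z x) len f g in e | agree (Z (toggle (s + t₀) x)) len f g in e′
    ... | false | b     = 𝟙≤1 b
    ... | true  | false = ≤-refl
    ... | true  | true  with Z x t₀ in zx
    ...   | false = contradiction
                      (agree-switch len f g (Z x) (Z (toggle (s + t₀) x)) t₀<len (same x) zx
                        (trans (bit-toggle (s + t₀) x p<N) (cong not zx)) e e′) f≉g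
    ...   | true  = contradiction
                      (agree-switch len f g (Z (toggle (s + t₀) x)) (Z x) t₀<len (λ t ne → sym (same x t ne))
                        (trans (bit-toggle (s + t₀) x p<N) (cong not zx)) zx e′ e) f≉g

  -- Evaluating the tests

  -- `vS` and `vE` delimit a window of a list, and `vF` is the line that `masked` runs along. `vQ`
  -- and `vM` are the number and the width of the buckets; `vSq` holds the running square of `vQ`,
  -- later its running multiple. `vB` is the current bucket, `vP` a position in the list of flagged
  -- rows.
  vL vJ vI vS vE vCnt vCntI vCntJ vQ vM vSq vB vP vF : NVar
  vL    = 4
  vJ    = 6
  vI    = 8
  vS    = 9
  vE    = 10
  vCnt  = 11
  vCntI = 12
  vCntJ = 13
  vQ    = 14
  vM    = 15
  vSq   = 16
  vB    = 17
  vP    = 18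
  vF    = 19

  -- Lists and random vectors occupy row 0 of an array: the identity list, the flagged rows and
  -- columns, and the vectors x, y, z.
  nId nI nJ nX nY nZ : NArr
  nId = 1
  nI  = 2
  nJ  = 3
  nX  = 4
  nY  = 5
  nZ  = 6

  rU : RArr
  rU = 3

  dotBody : Side → Program
  dotBody s =
    instr (rload 1 (sel s rA rB) (sel s vI vL) (sel s vL vI)) ∷
    instr (rload 2 rU vZero vL) ∷
    instr (rmul 1 (sel s 1 2) (sel s 2 1)) ∷
    instr (radd 0 0 1) ∷ []

  dot : Side → Program
  dot s = instr (rzero 0) ∷ instr (const vL 0) ∷ for vL vN (dotBody s) ∷ []

  maskedBody : NArr → NArr → Side → RArr → Program
  maskedBody bits list s arr =
    instr (load vBit bits vZero vC) ∷
    instr (load vJ list vZero vC) ∷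
    ifte (less vZero vBit)
      (instr (rload 1 arr (sel s vF vJ) (sel s vJ vF)) ∷ instr (radd 0 0 1) ∷ [])
      [] ∷ []

  masked : NArr → NArr → Side → RArr → Program
  masked bits list s arr = instr (rzero 0) ∷ instr (copy vC vS) ∷ for vC vE (maskedBody bits list s arr) ∷ []

  computeUBody : NArr → NArr → Side → Program
  computeUBody bits list s =
    instr (copy vF vL) ∷ masked bits list s (sel s rB rA) ++ instr (rstore rU vZero vL 0) ∷ []

  computeU : NArr → NArr → Side → Program
  computeU bits list s = instr (const vL 0) ∷ for vL vN (computeUBody bits list s) ∷ []

  compareSides : NArr → NArr → Side → Program
  compareSides bits list s = dot s ++ instr (rcopy 3 0) ∷ instr (copy vF vI) ∷ masked bits list s rC

  get-index : ∀ s (M : ℕ → ℕ → Carrier) (f : NVar → ℕ) x y →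
    M (f (sel s x y)) (f (sel s y x)) ≡ get s M (f x) (f y)
  get-index row M f x y = refl
  get-index col M f x y = refl

  mul-operands : ∀ s (f : RVar → Carrier) → f (sel s 1 2) *ᴿ f (sel s 2 1) ≡ mul s (f 1) (f 2)
  mul-operands row f = refl
  mul-operands col f = refl

  does-cong : ∀ {x x′ y y′} → x ≈ x′ → y ≈ y′ → does (x ≟ y) ≡ does (x′ ≟ y′)
  does-cong {x} {x′} {y} {y′} h h′ with x ≟ y | x′ ≟ y′
  ... | yes p | yes p′ = refl
  ... | no ¬p | no ¬p′ = refl
  ... | yes p | no ¬p′ = contradiction (Rg.trans (Rg.sym h) (Rg.trans p h′)) ¬p′
  ... | no ¬p | yes p′ = contradiction (Rg.trans h (Rg.trans p′ (Rg.sym h′))) ¬p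

  module Problem (n : ℕ) (a b : ℕ → ℕ → Carrier) where

    record Std (m : Memory) : Set c where
      field
        size : nvar m vN ≡ n
        one  : nvar m vOne ≡ 1
        nil  : nvar m vZero ≡ 0
        left : ∀ i j → rarr m rA i j ≡ a i j
        right : ∀ i j → rarr m rB i j ≡ b i j

    open Std public

    Std-frame : ∀ {S m m′} {_ : T (not (S (nv vN)))} {_ : T (not (S (nv vOne)))} {_ : T (not (S (nv vZero)))}
      {_ : T (not (S (ra rA)))} {_ : T (not (S (ra rB)))} → Frame S m m′ → Std m → Std m′
    Std-frame {_} {_} {_} {p} {q} {r} {s} {t} fr st = record
      { size  = trans (keepN fr vN {p}) (size st)
      ; one   = trans (keepN fr vOne {q}) (one st)
      ; nil   = trans (keepN fr vZero {r}) (nil st)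
      ; left  = λ i j → trans (keepRA fr rA {s} i j) (left st i j)
      ; right = λ i j → trans (keepRA fr rB {t} i j) (right st i j)
      }

    factor₁ : ∀ s {m} → Std m → ∀ i j → get s (rarr m (sel s rA rB)) i j ≡ get s (sel s a b) i j
    factor₁ row st i j = left st i j
    factor₁ col st i j = right st j i

    factor₂ : ∀ s {m} → Std m → ∀ i j → get s (rarr m (sel s rB rA)) i j ≡ get s (sel s b a) i j
    factor₂ row st i j = right st i j
    factor₂ col st i j = left st j i

    prod : Side → ℕ → ℕ → Carrier
    prod s i j = ∑ n (λ l → mul s (get s (sel s a b) i l) (get s (sel s b a) l j))

    -- The coordinates sv ≤ p < sv + len of the list g with their random bits z.
    record Window (bits list : NArr) (z : ℕ → Bool) (g : ℕ → ℕ) (sv len : ℕ) (m : Memory) : Set c where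
      field
        start  : nvar m vS ≡ sv
        finish : nvar m vE ≡ sv + len
        coins  : ∀ t → t < len → narr m bits 0 (sv + t) ≡ 𝟙 (z t)
        items  : ∀ t → t < len → narr m list 0 (sv + t) ≡ g t

    open Window public

    Window-frame : ∀ {S bits list z g sv len m m′} {pS : T (not (S (nv vS)))} {pE : T (not (S (nv vE)))}
      {pb : T (not (S (na bits)))} {pl : T (not (S (na list)))} → Frame S m m′ →
      Window bits list z g sv len m → Window bits list z g sv len m′
    Window-frame {bits = bits} {list} {sv = sv} {_} {_} {_} {p} {q} {r} {s} fr w = record
      { start  = trans (keepN fr vS {p}) (start w)
      ; finish = trans (keepN fr vE {q}) (finish w)
      ; coins  = λ t h → trans (keepNA fr bits {r} 0 (sv + t)) (coins w t h)
      ; items  = λ t h → trans (keepNA fr list {s} 0 (sv + t)) (items w t h)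
      }

    UReady : (ℕ → Bool) → (ℕ → ℕ) → ℕ → Side → Memory → Set ℓ
    UReady z g len s m = ∀ l → l < n → rarr m rU 0 l ≈ ∑ len (λ t → mask (z t) (get s (sel s b a) l (g t)))

    module _ {W : ℕ} where

      dot-run : ∀ s m → Std m → Run W (dot s) m (3 + n * 6)
        (λ m′ → rvar m′ 0 ≈ ∑ n (λ l → mul s (get s (sel s a b) (nvar m vI) l) (rarr m rU 0 l)))
      dot-run s m st = ins (λ _ → refl) (ins (λ _ → refl) (weaken (≤-reflexive (+-comm (n * 6) 1))
        (for-run Inv m₁ 0 n 4 (one st) (size st) (λ _ _ _ h → h) body refl Rg.refl)))
        where
        m₁ : Memory
        m₁ = setN vL 0 (setR 0 0# m)
        F : ℕ → Carrier
        F l = mul s (get s (sel s a b) (nvar m vI) l) (rarr m rU 0 l)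
        Inv : ℕ → Memory → Set ℓ
        Inv t m′ = rvar m′ 0 ≈ ∑ t F
        body : ∀ t m′ → t < n → nvar m′ vL ≡ t → Frame (assigns [ for vL vN (dotBody s) ]) m₁ m′ → Inv t m′ →
               Run W (dotBody s) m′ 4 (Inv (suc t))
        body t m′ t<n hl fr inv =
          ins (λ _ → refl) (ins (λ _ → refl) (ins (λ _ → refl) (ins (λ _ → refl) (stop (Rg.+-cong inv term)))))
          where
          st′ : Std m′
          -- Repacking the fields is enough: the initial assignments write nothing that `Std` reads,
          -- so the types agree by computation.
          st′ = Std-frame fr (record { Std st })
          factor : rarr m′ (sel s rA rB) (nvar m′ (sel s vI vL)) (nvar m′ (sel s vL vI)) ≡ get s (sel s a b) (nvar m vI) t
          factor = trans (get-index s (rarr m′ (sel s rA rB)) (nvar m′) vI vL)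
            (trans (cong₂ (get s (rarr m′ (sel s rA rB))) (keepN fr vI) hl) (factor₁ s st′ (nvar m vI) t))
          vector : rarr m′ rU (nvar m′ vZero) (nvar m′ vL) ≡ rarr m rU 0 t
          vector = trans (cong₂ (rarr m′ rU) (nil st′) hl) (keepRA fr rU 0 t)
          m₂ : Memory
          m₂ = exec false (rload 2 rU vZero vL) (exec false (rload 1 (sel s rA rB) (sel s vI vL) (sel s vL vI)) m′)
          term : rvar m₂ (sel s 1 2) *ᴿ rvar m₂ (sel s 2 1) ≈ F t
          term = Rg.trans (≈-reflexive (mul-operands s (rvar m₂))) (mul-cong s (≈-reflexive factor) (≈-reflexive vector))

      module _ {bits list : NArr} {z : ℕ → Bool} {g : ℕ → ℕ} {sv len : ℕ} where

        masked-run : ∀ s arr m → nvar m vOne ≡ 1 → nvar m vZero ≡ 0 → Window bits list z g sv len m →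
          Run W (masked bits list s arr) m (3 + len * 7)
            (λ m′ → rvar m′ 0 ≈ ∑ len (λ t → mask (z t) (get s (rarr m arr) (nvar m vF) (g t))))
        masked-run s arr m h1 h0 w = ins (λ _ → refl) (ins (λ _ → refl) (weaken (≤-reflexive (+-comm (len * 7) 1))
          (for-run Inv m₁ sv len 5 h1 (finish w) (λ _ _ _ h → h) body (start w) Rg.refl)))
          where
          m₁ : Memory
          m₁ = exec false (copy vC vS) (setR 0 0# m)
          F : ℕ → Carrier
          F t = mask (z t) (get s (rarr m arr) (nvar m vF) (g t))
          Inv : ℕ → Memory → Set ℓ
          Inv t m′ = rvar m′ 0 ≈ ∑ t F
          body : ∀ t m′ → t < len → nvar m′ vC ≡ sv + t → Frame (assigns [ for vC vE (maskedBody bits list s arr) ]) m₁ m′ →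
                 Inv t m′ → Run W (maskedBody bits list s arr) m′ 5 (Inv (suc t))
          body t m′ t<len hc fr inv = ins (λ _ → refl) (ins (λ _ → refl) (branch yes′ no′))
            where
            h0′ : nvar m′ vZero ≡ 0
            h0′ = trans (keepN fr vZero) h0
            bitv : narr m′ bits (nvar m′ vZero) (nvar m′ vC) ≡ 𝟙 (z t)
            bitv = trans (cong₂ (narr m′ bits) h0′ hc) (trans (keepNA fr bits 0 (sv + t)) (coins w t t<len))
            item : narr m′ list (nvar m′ vZero) (nvar m′ vC) ≡ g t
            item = trans (cong₂ (narr m′ list) h0′ hc) (trans (keepNA fr list 0 (sv + t)) (items w t t<len))
            m₂ : Memory
            m₂ = exec false (load vJ list vZero vC) (exec false (load vBit bits vZero vC) m′)
            test : ∀ {v} → holds (less vZero vBit) m₂ ≡ v → v ≡ z t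
            test {v} h = trans (sym h) (trans (cong₂ _<ᵇ_ h0′ bitv) (positive (z t)))
              where
              positive : ∀ b → (0 <ᵇ 𝟙 b) ≡ b
              positive true  = refl
              positive false = refl
            entry : rarr m₂ arr (nvar m₂ (sel s vF vJ)) (nvar m₂ (sel s vJ vF)) ≡ get s (rarr m arr) (nvar m vF) (g t)
            entry = trans (get-index s (rarr m₂ arr) (nvar m₂) vF vJ)
              (trans (cong₂ (get s (rarr m₂ arr)) (keepN fr vF) item) (same s (nvar m vF) (g t)))
              where
              same : ∀ s i j → get s (rarr m₂ arr) i j ≡ get s (rarr m arr) i j
              same row i j = keepRA fr arr i j
              same col i j = keepRA fr arr j i
            yes′ : holds (less vZero vBit) m₂ ≡ true → Run W _ m₂ 2 (Inv (suc t))
            yes′ h = ins (λ _ → refl) (ins (λ _ → refl) (stop (Rg.+-cong inv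
              (≈-reflexive (trans entry (cong (λ v → mask v (get s (rarr m arr) (nvar m vF) (g t))) (test h)))))))
            no′ : holds (less vZero vBit) m₂ ≡ false → Run W _ m₂ 2 (Inv (suc t))
            no′ h = stop (Rg.trans (Rg.sym (Rg.+-identityʳ _)) (Rg.+-cong inv
              (≈-reflexive (cong (λ v → mask v (get s (rarr m arr) (nvar m vF) (g t))) (test h)))))

        computeU-run : ∀ s m → Std m → Window bits list z g sv len m →
          Run W (computeU bits list s) m (2 + n * (len * 7 + 7)) (UReady z g len s)
        computeU-run s m st w = ins (λ _ → refl) (weaken (≤-reflexive (+-comm (n * (len * 7 + 7)) 1))
          (weaken (≤-reflexive (sh n len))
          (for-run Inv m₁ 0 n (5 + len * 7) (one st) (size st) (λ _ _ _ h → h) body refl (λ _ ()))))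
          where
          sh : ∀ n len → n * (5 + len * 7 + 2) + 1 ≡ n * (len * 7 + 7) + 1
          sh = solve-∀
          m₁ : Memory
          m₁ = setN vL 0 m
          F : ℕ → Carrier
          F l = ∑ len (λ t → mask (z t) (get s (sel s b a) l (g t)))
          Inv : ℕ → Memory → Set ℓ
          Inv t m′ = ∀ l → l < t → rarr m′ rU 0 l ≈ F l
          body : ∀ t m′ → t < n → nvar m′ vL ≡ t → Frame (assigns [ for vL vN (computeUBody bits list s) ]) m₁ m′ →
                 Inv t m′ → Run W (computeUBody bits list s) m′ (5 + len * 7) (Inv (suc t))
          body t m′ t<n hl fr inv = ins (λ _ → refl) (weaken (≤-reflexive (+-comm (3 + len * 7) 1))
            (bind (masked bits list s (sel s rB rA))
              (masked-run s (sel s rB rA) (exec false (copy vF vL) m′) (one st′) (nil st′) (record { Window w′ })) after))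
            where
            st′ : Std m′
            st′ = Std-frame fr (record { Std st })
            w′ : Window bits list z g sv len m′
            w′ = Window-frame fr (record { Window w })
            after : ∀ m″ → Frame (assigns (masked bits list s (sel s rB rA))) (exec false (copy vF vL) m′) m″ →
              rvar m″ 0 ≈ ∑ len (λ t′ → mask (z t′) (get s (rarr m′ (sel s rB rA)) (nvar m′ vL) (g t′))) →
              Run W (instr (rstore rU vZero vL 0) ∷ []) m″ 1 (Inv (suc t))
            after m″ fr′ eq = ins (λ _ → refl) (stop stored)
              where
              z″ : nvar m″ vZero ≡ 0
              z″ = trans (keepN fr′ vZero) (nil st′)
              l″ : nvar m″ vL ≡ t
              l″ = trans (keepN fr′ vL) hl
              stored : Inv (suc t) (exec false (rstore rU vZero vL 0) m″)
              stored l (s≤s l≤t) rewrite z″ | l″ with m≤n⇒m<n∨m≡n l≤t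
              ... | inj₁ l<t rewrite <⇒≡ᵇ-false l<t = Rg.trans (≈-reflexive (keepRA fr′ rU 0 l)) (inv l l<t)
              ... | inj₂ refl rewrite ≡ᵇ-refl l = Rg.trans eq (∑-cong len (λ t′ _ → mask-cong (z t′)
                        (≈-reflexive (trans (cong (λ u → get s (rarr m′ (sel s rB rA)) u (g t′)) hl) (factor₂ s st′ l (g t′))))))

        -- The program compares A (B z) with C z, and `∑-product` turns the former into (A B) z.
        -- Only the first product with z is as expensive as a matrix traversal, and `UReady` says
        -- that it has been computed beforehand for all lines.
        compare-run : ∀ s m → Std m → Window bits list z g sv len m → UReady z g len s m →
          Run W (compareSides bits list s) m (8 + n * 6 + len * 7)
            (λ m′ → holds (requ 3 0) m′ ≡
               agree z len (λ t → prod s (nvar m vI) (g t)) (λ t → get s (rarr m rC) (nvar m vI) (g t)))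
        compare-run s m st w u = weaken (≤-reflexive (sh n len)) (bind (dot s) (dot-run s m st) after)
          where
          sh : ∀ n len → 3 + n * 6 + (5 + len * 7) ≡ 8 + n * 6 + len * 7
          sh = solve-∀
          after : ∀ m₁ → Frame (assigns (dot s)) m m₁ →
            rvar m₁ 0 ≈ ∑ n (λ l → mul s (get s (sel s a b) (nvar m vI) l) (rarr m rU 0 l)) →
            Run W (instr (rcopy 3 0) ∷ instr (copy vF vI) ∷ masked bits list s rC) m₁ (5 + len * 7) _
          after m₁ fr e₁ = ins (λ _ → refl) (ins (λ _ → refl) (Run-map conclude
            (masked-run s rC m₂ (trans (keepN fr vOne) (one st)) (trans (keepN fr vZero) (nil st)) (record { Window (Window-frame fr w) }))))
            where
            m₂ : Memory
            m₂ = exec false (copy vF vI) (exec false (rcopy 3 0) m₁)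
            same : ∀ s i j → get s (rarr m₁ rC) i j ≡ get s (rarr m rC) i j
            same row i j = keepRA fr rC i j
            same col i j = keepRA fr rC j i
            conclude : ∀ m′ → Frame (assigns (masked bits list s rC)) m₂ m′ →
              rvar m′ 0 ≈ ∑ len (λ t → mask (z t) (get s (rarr m₁ rC) (nvar m₁ vI) (g t))) → _
            conclude m′ fr′ e₂ = does-cong
              (Rg.trans (≈-reflexive (keepR fr′ 3)) (Rg.trans e₁
                (Rg.trans (∑-cong n (λ l l<n → mul-cong s Rg.refl (u l l<n))) (∑-product s n len z _ _))))
              (Rg.trans e₂ (∑-cong len (λ t _ → mask-cong (z t) (≈-reflexive
                (trans (cong (λ i → get s (rarr m₁ rC) i (g t)) (keepN fr vI)) (same s (nvar m vI) (g t)))))))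

  -- Flagging rows and columns

  collectBody : Side → Program
  collectBody s =
    compareSides (sel s nX nY) nId s ++
    ifte (requ 3 0) []
      (instr (store (sel s nI nJ) vZero vCnt vI) ∷ instr (add vCnt vCnt vOne) ∷ []) ∷ []

  collect : Side → Program
  collect s = instr (const vCnt 0) ∷ instr (const vI 0) ∷ for vI vN (collectBody s) ∷ []

  -- The full range is treated as a window of the identity list, so that the same code serves the
  -- tests of whole lines and the tests of buckets.
  findLines : Side → Program
  findLines s = instr (const vS 0) ∷ instr (copy vE vN) ∷ computeU (sel s nX nY) nId s ++ collect s

  module _ {n : ℕ} {a b : ℕ → ℕ → Carrier} where
    open Problem n a b

    -- Does the random test of line i (a row or a column) fail to notice an error?
    silent : Side → (ℕ → Bool) → (ℕ → ℕ → Carrier) → ℕ → Bool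
    silent s z C i = agree z n (prod s i) (get s C i)

    record Listed (s : Side) (z : ℕ → Bool) (C : ℕ → ℕ → Carrier) (t cnt : ℕ) (list : ℕ → ℕ) : Set where
      field
        count    : cnt ≡ Σ< t (λ i → 𝟙 (not (silent s z C i)))
        listed<  : ∀ p → p < cnt → list p < t
        distinct : ∀ p p′ → p < cnt → p′ < cnt → list p ≡ list p′ → p ≡ p′
        complete : ∀ i → i < t → silent s z C i ≡ false → ∃[ p ] (p < cnt × list p ≡ i)

    open Listed public

    Listed-cong : ∀ {s z C t cnt cnt′ list list′} → cnt′ ≡ cnt → (∀ p → list′ p ≡ list p) →
      Listed s z C t cnt list → Listed s z C t cnt′ list′
    Listed-cong refl e L = record
      { count    = count L
      ; listed<  = λ p h → subst (_< _) (sym (e p)) (listed< L p h)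
      ; distinct = λ p p′ h h′ q → distinct L p p′ h h′ (trans (sym (e p)) (trans q (e p′)))
      ; complete = λ i h h′ → let p , q , r = complete L i h h′ in p , q , trans (e p) r
      }

    private
      skip : ∀ {s z C t cnt list} → silent s z C t ≡ true → Listed s z C t cnt list → Listed s z C (suc t) cnt list
      skip {s} {z} {C} {t} e L = record
        { count    = trans (count L) (sym (trans (cong (λ v → Σ< t (λ i → 𝟙 (not (silent s z C i))) + 𝟙 (not v)) e) (+-identityʳ _)))
        ; listed<  = λ p h → m<n⇒m<1+n (listed< L p h)
        ; distinct = distinct L
        ; complete = all }
        where
        all : ∀ i → i < suc t → silent s z C i ≡ false → _
        all i (s≤s i≤t) h with m≤n⇒m<n∨m≡n i≤t
        ... | inj₁ i<t  = complete L i i<t h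
        ... | inj₂ refl = contradiction (trans (sym e) h) (λ ())

      push : ∀ {s z C t cnt list list′} → silent s z C t ≡ false → Listed s z C t cnt list →
        list′ cnt ≡ t → (∀ p → p < cnt → list′ p ≡ list p) → Listed s z C (suc t) (cnt + 1) list′
      push {s} {z} {C} {t} {cnt} {list} {list′} e L new old = record
        { count    = cong₂ _+_ (count L) (cong (λ v → 𝟙 (not v)) (sym e))
        ; listed<  = bounded
        ; distinct = differ
        ; complete = all }
        where
        position : ∀ p → p < cnt + 1 → p < cnt ⊎ p ≡ cnt
        position p h = m≤n⇒m<n∨m≡n (≤-pred (subst (p <_) (+-comm cnt 1) h))
        below : ∀ p → p < cnt → list′ p < t
        below p h = subst (_< t) (sym (old p h)) (listed< L p h)
        bounded : ∀ p → p < cnt + 1 → list′ p < suc t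
        bounded p h with position p h
        ... | inj₁ lt   = m<n⇒m<1+n (below p lt)
        ... | inj₂ refl = ≤-reflexive (cong suc new)
        differ : ∀ p p′ → p < cnt + 1 → p′ < cnt + 1 → list′ p ≡ list′ p′ → p ≡ p′
        differ p p′ h h′ q with position p h | position p′ h′
        ... | inj₁ lt   | inj₁ lt′  = distinct L p p′ lt lt′ (trans (sym (old p lt)) (trans q (old p′ lt′)))
        ... | inj₁ lt   | inj₂ refl = contradiction (trans q new) (<⇒≢ (below p lt))
        ... | inj₂ refl | inj₁ lt′  = contradiction (trans (sym q) new) (<⇒≢ (below p′ lt′))
        ... | inj₂ refl | inj₂ refl = refl
        all : ∀ i → i < suc t → silent s z C i ≡ false → ∃[ p ] (p < cnt + 1 × list′ p ≡ i)
        all i (s≤s i≤t) h with m≤n⇒m<n∨m≡n i≤t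
        ... | inj₁ i<t  = let p , lt , q = complete L i i<t h in p , ≤-trans lt (m≤m+n cnt 1) , trans (old p lt) q
        ... | inj₂ refl = cnt , ≤-reflexive (+-comm 1 cnt) , new

      -- The array that is written depends on the side, so the frame condition evaluates only after
      -- a case distinction.
      keepsBits : ∀ s → T (not (assigns [ for vI vN (collectBody s) ] (na (sel s nX nY))))
      keepsBits row = tt
      keepsBits col = tt

      keepsId : ∀ s → T (not (assigns [ for vI vN (collectBody s) ] (na nId)))
      keepsId row = tt
      keepsId col = tt

    module _ {W : ℕ} {z : ℕ → Bool} where

      collect-run : ∀ s m → Std m → Window (sel s nX nY) nId z id 0 n m →
        UReady z id n s m →
        Run W (collect s) m (3 + n * (n * 13 + 13)) (λ m′ → Listed s z (rarr m rC) n (nvar m′ vCnt) (narr m′ (sel s nI nJ) 0))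
      collect-run s m st w u = ins (λ _ → refl) (ins (λ _ → refl) (weaken (≤-reflexive (sh n))
        (for-run Inv m₁ 0 n (11 + n * 13) (one st) (size st) (λ _ _ _ h → h) body refl
          (record { count = refl ; listed< = λ _ () ; distinct = λ _ _ () ; complete = λ _ () }))))
        where
        sh : ∀ n → n * (11 + n * 13 + 2) + 1 ≡ 1 + n * (n * 13 + 13)
        sh = solve-∀
        m₁ : Memory
        m₁ = setN vI 0 (setN vCnt 0 m)
        out : NArr
        out = sel s nI nJ
        Inv : ℕ → Memory → Set
        Inv t m′ = Listed s z (rarr m rC) t (nvar m′ vCnt) (narr m′ out 0)
        body : ∀ t m′ → t < n → nvar m′ vI ≡ t → Frame (assigns [ for vI vN (collectBody s) ]) m₁ m′ → Inv t m′ →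
               Run W (collectBody s) m′ (11 + n * 13) (Inv (suc t))
        body t m′ t<n hi fr inv = weaken (≤-reflexive (sh′ n)) (bind (compareSides (sel s nX nY) nId s)
          (compare-run {sv = 0} s m′ st′ (Window-frame {pb = keepsBits s} {pl = keepsId s} fr (record { Window w }))
            (λ l l<n → Rg.trans (≈-reflexive (keepRA fr rU 0 l)) (u l l<n))) after)
          where
          sh′ : ∀ n → 8 + n * 6 + n * 7 + 3 ≡ 11 + n * 13
          sh′ = solve-∀
          st′ : Std m′
          st′ = Std-frame fr (record { Std st })
          sameC : agree z n (prod s (nvar m′ vI)) (get s (rarr m′ rC) (nvar m′ vI)) ≡ silent s z (rarr m rC) t
          sameC = trans (cong (λ i → agree z n (prod s i) (get s (rarr m′ rC) i)) hi)
            (does-cong Rg.refl (∑-cong n (λ j _ → mask-cong (z j) (≈-reflexive (same s t j)))))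
            where
            same : ∀ s i j → get s (rarr m′ rC) i j ≡ get s (rarr m rC) i j
            same row i j = keepRA fr rC i j
            same col i j = keepRA fr rC j i
          after : ∀ m″ → Frame (assigns (compareSides (sel s nX nY) nId s)) m′ m″ →
            holds (requ 3 0) m″ ≡ agree z n (prod s (nvar m′ vI)) (get s (rarr m′ rC) (nvar m′ vI)) →
            Run W (ifte (requ 3 0) [] (instr (store out vZero vCnt vI) ∷ instr (add vCnt vCnt vOne) ∷ []) ∷ []) m″ 3 (Inv (suc t))
          after m″ fr′ e = branch
            (λ h → stop (skip (trans (sym sameC) (trans (sym e) h)) inv″))
            (λ h → ins (λ _ → refl) (ins (λ _ → refl) (stop (Listed-cong (cong (nvar m″ vCnt +_) one″) (λ _ → refl)
              (push (trans (sym sameC) (trans (sym e) h)) inv″ written unwritten)))))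
            where
            inv″ : Listed s z (rarr m rC) t (nvar m″ vCnt) (narr m″ out 0)
            inv″ = Listed-cong (keepN fr′ vCnt) (λ p → keepNA fr′ out 0 p) inv
            one″ : nvar m″ vOne ≡ 1
            one″ = trans (keepN fr′ vOne) (one st′)
            i″ : nvar m″ vI ≡ t
            i″ = trans (keepN fr′ vI) hi
            m₃ : Memory
            m₃ = exec false (store out vZero vCnt vI) m″
            written : narr m₃ out 0 (nvar m″ vCnt) ≡ t
            written rewrite ≡ᵇ-refl out | trans (keepN fr′ vZero) (nil st′) | ≡ᵇ-refl (nvar m″ vCnt) = i″
            unwritten : ∀ p → p < nvar m″ vCnt → narr m₃ out 0 p ≡ narr m″ out 0 p
            unwritten p h rewrite ≡ᵇ-refl out | trans (keepN fr′ vZero) (nil st′) | <⇒≡ᵇ-false h = refl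

      findLines-run : ∀ s m → Std m → (∀ t → t < n → narr m (sel s nX nY) 0 t ≡ 𝟙 (z t)) → (∀ t → t < n → narr m nId 0 t ≡ t) →
        Run W (findLines s) m (7 + n * (n * 20 + 20)) (λ m′ → Listed s z (rarr m rC) n (nvar m′ vCnt) (narr m′ (sel s nI nJ) 0))
      findLines-run s m st hb hl = ins (λ _ → refl) (ins (λ _ → refl) (weaken (≤-reflexive (sh n))
        (bind (computeU (sel s nX nY) nId s) (computeU-run {sv = 0} s m₁ (record { Std st }) w) after)))
        where
        sh : ∀ n → 2 + n * (n * 7 + 7) + (3 + n * (n * 13 + 13)) ≡ 5 + n * (n * 20 + 20)
        sh = solve-∀
        m₁ : Memory
        m₁ = exec false (copy vE vN) (setN vS 0 m)
        w : Window (sel s nX nY) nId z id 0 n m₁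
        w = record { start = refl ; finish = size st ; coins = hb ; items = hl }
        after : ∀ m′ → Frame (assigns (computeU (sel s nX nY) nId s)) m₁ m′ → _ → Run W (collect s) m′ _ _
        after m′ fr u = Run-map
          (λ m″ _ L → record
            { count    = trans (count L) (Σ<-cong n (λ i _ → cong (λ v → 𝟙 (not v)) (same i)))
            ; listed<  = listed< L
            ; distinct = distinct L
            ; complete = λ i h e → complete L i h (trans (same i) e) })
          (collect-run s m′ (Std-frame fr (record { Std st })) (Window-frame fr w) u)
          where
          same : ∀ i → silent s z (rarr m′ rC) i ≡ silent s z (rarr m rC) i
          same i = does-cong Rg.refl (∑-cong n (λ j _ → mask-cong (z j) (≈-reflexive (eq s i j))))
            where
            eq : ∀ s i j → get s (rarr m′ rC) i j ≡ get s (rarr m rC) i j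
            eq row i j = keepRA fr rC i j
            eq col i j = keepRA fr rC j i

  -- Number and width of the buckets

  sqrtBody : Program
  sqrtBody = ifte (less vSq vK)
    (instr (add vSq vSq vQ) ∷ instr (add vSq vSq vQ) ∷ instr (add vSq vSq vOne) ∷ instr (add vQ vQ vOne) ∷ []) [] ∷ []

  squareRoot : Program
  squareRoot = instr (const vQ 1) ∷ instr (const vSq 1) ∷ instr (const vC 0) ∷ for vC vN sqrtBody ∷ []

  divideBody : Program
  divideBody = ifte (less vSq vCntJ) (instr (add vSq vSq vQ) ∷ instr (add vM vM vOne) ∷ []) [] ∷ []

  divide : Program
  divide = instr (const vM 0) ∷ instr (const vSq 0) ∷ instr (const vC 0) ∷ for vC vCntJ divideBody ∷ []

  <ᵇ-true⁻¹ : ∀ {m n} → (m <ᵇ n) ≡ true → m < n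
  <ᵇ-true⁻¹ {m} {n} h = <ᵇ⇒< m n (Equivalence.from T-≡ h)

  <ᵇ-false⁻¹ : ∀ {m n} → (m <ᵇ n) ≡ false → n ≤ m
  <ᵇ-false⁻¹ {m} {n} h with m <? n
  ... | yes lt = contradiction (trans (sym h) (<ᵇ-true lt)) (λ ())
  ... | no ¬lt = ≮⇒≥ ¬lt

  -- q is √k up to rounding: `k≤q²` makes the repairs of k errors affordable, `q²≤4k` limits the
  -- number of buckets.
  record Root (k q : ℕ) : Set where
    field
      q≥1    : 1 ≤ q
      k≤q²   : k ≤ q * q
      q²≤4k  : q * q ≤ 4 * k

  open Root public

  -- The root starts at 1 and grows in every iteration until its square reaches k. After n
  -- iterations either this has happened, or the root exceeds n and k ≤ n² finishes. As the machine
  -- does not multiply, the square is updated by q + q + 1.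
  squareRoot-run : ∀ {W} m n → nvar m vN ≡ n → nvar m vOne ≡ 1 → 1 ≤ nvar m vK → nvar m vK ≤ n * n →
    Run W squareRoot m (4 + n * 7) (λ m′ → Root (nvar m vK) (nvar m′ vQ))
  squareRoot-run {W} m n hn h1 k≥1 k≤n² = ins (λ _ → refl) (ins (λ _ → refl) (ins (λ _ → refl)
    (weaken (≤-reflexive (+-comm (n * 7) 1)) (Run-map finish′
      (for-run Inv m₁ 0 n 5 h1 hn (λ _ _ _ h → h) body refl
        (refl , s≤s z≤n , ≤-trans k≥1 (m≤m+n k _) , inj₁ (s≤s z≤n)))))))
    where
    k : ℕ
    k = nvar m vK
    m₁ : Memory
    m₁ = setN vC 0 (setN vSq 1 (setN vQ 1 m))
    Inv : ℕ → Memory → Set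
    Inv t m′ = nvar m′ vSq ≡ nvar m′ vQ * nvar m′ vQ × 1 ≤ nvar m′ vQ × nvar m′ vQ * nvar m′ vQ ≤ 4 * k ×
               (t < nvar m′ vQ ⊎ k ≤ nvar m′ vQ * nvar m′ vQ)
    finish′ : ∀ m′ → Frame (assigns [ for vC vN sqrtBody ]) m₁ m′ → Inv n m′ → Root k (nvar m′ vQ)
    finish′ m′ _ (_ , p , q , inj₁ n<q) = record
      { q≥1 = p ; k≤q² = ≤-trans k≤n² (*-mono-≤ (<⇒≤ n<q) (<⇒≤ n<q)) ; q²≤4k = q }
    finish′ m′ _ (_ , p , q , inj₂ r) = record { q≥1 = p ; k≤q² = r ; q²≤4k = q }
    body : ∀ t m′ → t < n → nvar m′ vC ≡ t → Frame (assigns [ for vC vN sqrtBody ]) m₁ m′ → Inv t m′ →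
           Run W sqrtBody m′ 5 (Inv (suc t))
    body t m′ t<n hc fr (e , p , q , r) = branch below above
      where
      k′ : nvar m′ vK ≡ k
      k′ = keepN fr vK
      Q : ℕ
      Q = nvar m′ vQ
      one′ : nvar m′ vOne ≡ 1
      one′ = trans (keepN fr vOne) h1
      square : ∀ {s o} Q → s ≡ Q * Q → o ≡ 1 → s + Q + Q + o ≡ (Q + o) * (Q + o)
      square Q refl refl = identity Q
        where
        identity : ∀ Q → Q * Q + Q + Q + 1 ≡ (Q + 1) * (Q + 1)
        identity = solve-∀
      below : holds (less vSq vK) m′ ≡ true → Run W _ m′ 4 (Inv (suc t))
      below h = ins (λ _ → refl) (ins (λ _ → refl) (ins (λ _ → refl) (ins (λ _ → refl) (stop
        (square Q e one′ , ≤-trans p (m≤m+n Q _) , small , far r)))))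
        where
        Q²<k : Q * Q < k
        Q²<k = subst₂ _<_ e k′ (<ᵇ-true⁻¹ h)
        small : (Q + nvar m′ vOne) * (Q + nvar m′ vOne) ≤ 4 * k
        small rewrite one′ = begin
          -- Since Q is positive, Q + 1 ≤ 2 Q; this is the source of the factor 4.
          (Q + 1) * (Q + 1)  ≤⟨ *-mono-≤ (+-monoʳ-≤ Q p) (+-monoʳ-≤ Q p) ⟩
          (Q + Q) * (Q + Q)  ≡⟨ dbl Q ⟩
          4 * (Q * Q)        ≤⟨ *-monoʳ-≤ 4 (<⇒≤ Q²<k) ⟩
          4 * k              ∎
          where
          open ≤-Reasoning
          dbl : ∀ Q → (Q + Q) * (Q + Q) ≡ 4 * (Q * Q)
          dbl = solve-∀
        far : t < Q ⊎ k ≤ Q * Q → _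
        far (inj₁ t<Q) = inj₁ (subst (suc t <_) (trans (+-comm 1 Q) (cong (Q +_) (sym one′))) (s≤s t<Q))
        far (inj₂ big) = contradiction big (<⇒≱ Q²<k)
      above : holds (less vSq vK) m′ ≡ false → Run W _ m′ 4 (Inv (suc t))
      above h = stop (e , p , q , inj₂ (subst₂ _≤_ k′ e (<ᵇ-false⁻¹ h)))

  -- The width is the number of columns divided by q, rounded up, found by adding q repeatedly. As q
  -- is positive, as many iterations as there are columns suffice, and the last multiple overshoots
  -- by at most q.
  divide-run : ∀ {W} m → nvar m vOne ≡ 1 → 1 ≤ nvar m vQ →
    Run W divide m (4 + nvar m vCntJ * 5)
      (λ m′ → nvar m vCntJ ≤ nvar m′ vM * nvar m vQ × nvar m′ vM * nvar m vQ ≤ nvar m vCntJ + nvar m vQ)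
  divide-run {W} m h1 q≥1 = ins (λ _ → refl) (ins (λ _ → refl) (ins (λ _ → refl)
    (weaken (≤-reflexive (+-comm (nvar m vCntJ * 5) 1)) (Run-map finish′
      (for-run Inv m₁ 0 J 3 h1 refl (λ _ _ _ h → h) body refl (refl , z≤n , inj₁ z≤n))))))
    where
    J q : ℕ
    J = nvar m vCntJ
    q = nvar m vQ
    m₁ : Memory
    m₁ = setN vC 0 (setN vSq 0 (setN vM 0 m))
    Inv : ℕ → Memory → Set
    Inv t m′ = nvar m′ vSq ≡ nvar m′ vM * q × nvar m′ vSq ≤ J + q × (t ≤ nvar m′ vSq ⊎ J ≤ nvar m′ vSq)
    finish′ : ∀ m′ → Frame (assigns [ for vC vCntJ divideBody ]) m₁ m′ → Inv J m′ → _
    finish′ m′ _ (e , p , inj₁ r) = subst (J ≤_) e r , subst (_≤ J + q) e p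
    finish′ m′ _ (e , p , inj₂ r) = subst (J ≤_) e r , subst (_≤ J + q) e p
    body : ∀ t m′ → t < J → nvar m′ vC ≡ t → Frame (assigns [ for vC vCntJ divideBody ]) m₁ m′ → Inv t m′ →
           Run W divideBody m′ 3 (Inv (suc t))
    body t m′ t<J hc fr (e , p , r) = branch below above
      where
      J′ : nvar m′ vCntJ ≡ J
      J′ = keepN fr vCntJ
      q′ : nvar m′ vQ ≡ q
      q′ = keepN fr vQ
      one′ : nvar m′ vOne ≡ 1
      one′ = trans (keepN fr vOne) h1
      below : holds (less vSq vCntJ) m′ ≡ true → Run W _ m′ 2 (Inv (suc t))
      below h = ins (λ _ → refl) (ins (λ _ → refl) (stop
        ( trans (cong₂ _+_ e q′) (trans (sh (nvar m′ vM) q) (cong (λ o → (nvar m′ vM + o) * q) (sym one′)))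
        , subst (λ u → nvar m′ vSq + u ≤ J + q) (sym q′) (+-monoˡ-≤ q (<⇒≤ lt))
        , far r)))
        where
        lt : nvar m′ vSq < J
        lt = subst (nvar m′ vSq <_) J′ (<ᵇ-true⁻¹ h)
        sh : ∀ x q → x * q + q ≡ (x + 1) * q
        sh = solve-∀
        far : t ≤ nvar m′ vSq ⊎ J ≤ nvar m′ vSq → suc t ≤ nvar m′ vSq + nvar m′ vQ ⊎ J ≤ nvar m′ vSq + nvar m′ vQ
        far (inj₁ t≤) = inj₁ (subst (_≤ nvar m′ vSq + nvar m′ vQ) (+-comm t 1) (+-mono-≤ t≤ (subst (1 ≤_) (sym q′) q≥1)))
        far (inj₂ J≤) = contradiction J≤ (<⇒≱ lt)
      above : holds (less vSq vCntJ) m′ ≡ false → Run W _ m′ 2 (Inv (suc t))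
      above h = stop (e , p , inj₂ (subst (_≤ nvar m′ vSq) J′ (<ᵇ-false⁻¹ h)))

  -- Correcting entries

  entryBody : Program
  entryBody = instr (rload 1 rA vI vL) ∷ instr (rload 2 rB vL vJ) ∷ instr (rmul 1 1 2) ∷ instr (radd 0 0 1) ∷ []

  entry : Program
  entry = instr (rzero 0) ∷ instr (const vL 0) ∷ for vL vN entryBody ∷ []

  repair : Program
  repair = instr (rstore rC vI vJ 0) ∷ instr (store nMark vI vJ vOne) ∷ instr (monus vK vK vOne) ∷ []

  fixBody : Program
  fixBody = instr (load vJ nJ vZero vC) ∷ entry ++ instr (rload 1 rC vI vJ) ∷ ifte (requ 1 0) [] repair ∷ []

  fixRow : Program
  fixRow = instr (copy vC vS) ∷ for vC vE fixBody ∷ []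

  data Hit (i j i′ j′ : ℕ) : Bool → Set where
    hit  : i ≡ i′ → j ≡ j′ → Hit i j i′ j′ true
    miss : ¬ (i ≡ i′ × j ≡ j′) → Hit i j i′ j′ false

  hit? : ∀ i j i′ j′ → Hit i j i′ j′ ((i ≡ᵇ i′) ∧ (j ≡ᵇ j′))
  hit? i j i′ j′ with i ≡ᵇ i′ in e | j ≡ᵇ j′ in e′
  ... | true  | true  = hit (≡ᵇ⇒≡ i i′ (Equivalence.from T-≡ e)) (≡ᵇ⇒≡ j j′ (Equivalence.from T-≡ e′))
  ... | true  | false = miss λ { (_ , refl) → contradiction (trans (sym e′) (≡ᵇ-refl j)) (λ ()) }
  ... | false | _     = miss λ { (refl , _) → contradiction (trans (sym e) (≡ᵇ-refl i)) (λ ()) }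

  same-entry? : ∀ i j i′ j′ → (i ≡ i′ × j ≡ j′) ⊎ ¬ (i ≡ i′ × j ≡ j′)
  same-entry? i j i′ j′ with (i ≡ᵇ i′) ∧ (j ≡ᵇ j′) | hit? i j i′ j′
  ... | _ | hit p q = inj₁ (p , q)
  ... | _ | miss ne = inj₂ ne

  module Correction (n : ℕ) (a b c′ : ℕ → ℕ → Carrier) where
    open Problem n a b public

    err : (ℕ → ℕ → Carrier) → ℕ → ℕ → ℕ
    err M i j = 𝟙 (not (does (M i j ≟ prod row i j)))

    errors : (ℕ → ℕ → Carrier) → ℕ
    errors M = Σ< n (λ i → Σ< n (err M i))

    err-1 : ∀ M i j → M i j ≉ prod row i j → err M i j ≡ 1
    err-1 M i j h with M i j ≟ prod row i j
    ... | yes p = contradiction p h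
    ... | no _  = refl

    err-0 : ∀ M i j → M i j ≈ prod row i j → err M i j ≡ 0
    err-0 M i j h with M i j ≟ prod row i j
    ... | yes _ = refl
    ... | no ¬p = contradiction h ¬p

    -- Leaves open whether an untouched entry is correct; this is decided at the end, when the error
    -- count is 0.
    Status : Carrier → ℕ → ℕ → ℕ → Set _
    Status v mark i j = (v ≡ c′ i j × mark ≡ 0) ⊎ (v ≈ prod row i j × c′ i j ≉ prod row i j × mark ≡ 1)

    record State (m : Memory) : Set (c ⊔ ℓ) where
      field
        std      : Std m
        identity : ∀ t → t < n → narr m nId 0 t ≡ t
        status   : ∀ i j → i < n → j < n → Status (rarr m rC i j) (narr m nMark i j) i j
        number   : nvar m vK ≡ errors (rarr m rC)

    open State public

    Status-cong : ∀ {v v′ mark mark′ i j} → v′ ≡ v → mark′ ≡ mark → Status v mark i j → Status v′ mark′ i j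
    Status-cong e e′ (inj₁ (p , q))     = inj₁ (trans e p , trans e′ q)
    Status-cong e e′ (inj₂ (p , q , r)) = inj₂ (Rg.trans (≈-reflexive e) p , q , trans e′ r)

    errors-cong : ∀ {M M′} → (∀ i j → M′ i j ≡ M i j) → errors M′ ≡ errors M
    errors-cong e = Σ<-cong n (λ i _ → Σ<-cong n (λ j _ → cong (λ v → 𝟙 (not (does (v ≟ prod row i j)))) (e i j)))

    State-frame : ∀ {S m m′} {pn : T (not (S (nv vN)))} {p1 : T (not (S (nv vOne)))} {p0 : T (not (S (nv vZero)))}
      {pa : T (not (S (ra rA)))} {pb : T (not (S (ra rB)))} {pk : T (not (S (nv vK)))} {pi : T (not (S (na nId)))}
      {pm : T (not (S (na nMark)))} {pc : T (not (S (ra rC)))} → Frame S m m′ → State m → State m′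
    State-frame {_} {m} {m′} {pn} {p1} {p0} {pa} {pb} {pk} {pi} {pm} {pc} fr st = record
      { std      = Std-frame {_} {_} {_} {pn} {p1} {p0} {pa} {pb} fr (std st)
      ; identity = λ t h → trans (keepNA fr nId {pi} 0 t) (identity st t h)
      ; status   = λ i j hi hj → Status-cong (keepRA fr rC {pc} i j) (keepNA fr nMark {pm} i j) (status st i j hi hj)
      ; number   = trans (keepN fr vK {pk}) (trans (number st) (sym (errors-cong (keepRA fr rC {pc}))))
      }

    Improves : (M M′ : ℕ → ℕ → Carrier) → Set _
    Improves M M′ = ∀ i j → i < n → j < n → M i j ≈ prod row i j → M′ i j ≈ prod row i j

    improves-trans : ∀ {M M′ M″} → Improves M M′ → Improves M′ M″ → Improves M M″
    improves-trans f g i j hi hj e = g i j hi hj (f i j hi hj e)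

    err-mono : ∀ {M M′} → Improves M M′ → ∀ i j → i < n → j < n → err M′ i j ≤ err M i j
    err-mono {M} {M′} im i j hi hj with M i j ≟ prod row i j
    ... | yes p = ≤-reflexive (err-0 M′ i j (im i j hi hj p))
    ... | no _  = 𝟙≤1 _

    errors-mono : ∀ {M M′} → Improves M M′ → errors M′ ≤ errors M
    errors-mono im = Σ<-mono n (λ i hi → Σ<-mono n (λ j hj → err-mono im i j hi hj))

    errors-mono-< : ∀ {M M′} → Improves M M′ → ∀ i j → i < n → j < n → M i j ≉ prod row i j → M′ i j ≈ prod row i j →
      errors M′ < errors M
    errors-mono-< {M} {M′} im i j hi hj bad good =
      Σ<-mono-< n (λ i hi → Σ<-mono n (λ j hj → err-mono im i j hi hj)) hi
        (Σ<-mono-< n (λ j hj → err-mono im i j hi hj) hj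
          (subst₂ _<_ (sym (err-0 M′ i j good)) (sym (err-1 M i j bad)) (s≤s z≤n)))

    entry-run : ∀ {W} m → Std m → Run W entry m (3 + n * 6) (λ m′ → rvar m′ 0 ≈ prod row (nvar m vI) (nvar m vJ))
    entry-run {W} m st = ins (λ _ → refl) (ins (λ _ → refl) (weaken (≤-reflexive (+-comm (n * 6) 1))
      (for-run Inv m₁ 0 n 4 (one st) (size st) (λ _ _ _ h → h) body refl Rg.refl)))
      where
      m₁ : Memory
      m₁ = setN vL 0 (setR 0 0# m)
      Inv : ℕ → Memory → Set ℓ
      Inv t m′ = rvar m′ 0 ≈ ∑ t (λ l → a (nvar m vI) l *ᴿ b l (nvar m vJ))
      body : ∀ t m′ → t < n → nvar m′ vL ≡ t → Frame (assigns [ for vL vN entryBody ]) m₁ m′ → Inv t m′ →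
             Run W entryBody m′ 4 (Inv (suc t))
      body t m′ t<n hl fr inv =
        ins (λ _ → refl) (ins (λ _ → refl) (ins (λ _ → refl) (ins (λ _ → refl) (stop (Rg.+-cong inv (≈-reflexive
          (cong₂ _*ᴿ_ (trans (cong₂ (rarr m′ rA) (keepN fr vI) hl) (left st′ _ t))
                      (trans (cong₂ (rarr m′ rB) hl (keepN fr vJ)) (right st′ t _)))))))))
        where
        st′ : Std m′
        st′ = Std-frame fr (record { Std st })

    -- Without amortisation an instruction may also change vK.
    insK : ∀ {q i ss m b} {Q : Memory → Set q} → (∀ b → exec b i m ≡ exec false i m) →
           Run 0 ss (exec false i m) b Q → Run 0 (instr i ∷ ss) m (suc b) Q
    insK d (mkRun x co po) = mkRun (instr d x) (s≤s co) po

    -- Exactly one wrong entry becomes right, so `vK` and the number of errors drop together. That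
    -- the input was wrong there follows from `status`, since an entry that had been repaired before
    -- would be right.
    repaired : ∀ {m} → State m → ∀ i j → i < n → j < n → nvar m vI ≡ i → nvar m vJ ≡ j →
      rvar m 0 ≈ prod row i j → rarr m rC i j ≉ prod row i j →
      let m′ = exec false (monus vK vK vOne) (exec false (store nMark vI vJ vOne) (exec false (rstore rC vI vJ 0) m)) in
      State m′ × Improves (rarr m rC) (rarr m′ rC) × rarr m′ rC i j ≈ prod row i j ×
      (∀ i′ j′ → ¬ (i ≡ i′ × j ≡ j′) → rarr m′ rC i′ j′ ≡ rarr m rC i′ j′)
    repaired {m} st i j hi hj refl refl acc bad = st′ , better , here , elsewhere
      where
      m′ : Memory
      m′ = exec false (monus vK vK vOne) (exec false (store nMark vI vJ vOne) (exec false (rstore rC vI vJ 0) m))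
      here : rarr m′ rC i j ≈ prod row i j
      here rewrite ≡ᵇ-refl i | ≡ᵇ-refl j = acc
      elsewhere : ∀ i′ j′ → ¬ (i ≡ i′ × j ≡ j′) → rarr m′ rC i′ j′ ≡ rarr m rC i′ j′
      elsewhere i′ j′ ne with (i ≡ᵇ i′) ∧ (j ≡ᵇ j′) | hit? i j i′ j′
      ... | _ | hit p q  = contradiction (p , q) ne
      ... | _ | miss _   = refl
      marks : ∀ i′ j′ → ¬ (i ≡ i′ × j ≡ j′) → narr m′ nMark i′ j′ ≡ narr m nMark i′ j′
      marks i′ j′ ne with (i ≡ᵇ i′) ∧ (j ≡ᵇ j′) | hit? i j i′ j′
      ... | _ | hit p q  = contradiction (p , q) ne
      ... | _ | miss _   = refl
      marked : narr m′ nMark i j ≡ 1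
      marked rewrite ≡ᵇ-refl i | ≡ᵇ-refl j = one (std st)
      better : Improves (rarr m rC) (rarr m′ rC)
      better i′ j′ hi′ hj′ e with (i ≡ᵇ i′) ∧ (j ≡ᵇ j′) | hit? i j i′ j′
      ... | _ | hit refl refl = acc
      ... | _ | miss _        = e
      wrong : c′ i j ≉ prod row i j
      wrong with status st i j hi hj
      ... | inj₁ (p , _) = λ e → bad (Rg.trans (≈-reflexive p) e)
      ... | inj₂ (p , _) = contradiction p bad
      status′ : ∀ i′ j′ → i′ < n → j′ < n → Status (rarr m′ rC i′ j′) (narr m′ nMark i′ j′) i′ j′
      status′ i′ j′ hi′ hj′ with same-entry? i j i′ j′
      ... | inj₁ (refl , refl) = inj₂ (here , wrong , marked)
      ... | inj₂ ne            = Status-cong (elsewhere i′ j′ ne) (marks i′ j′ ne) (status st i′ j′ hi′ hj′)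
      drop : suc (errors (rarr m′ rC)) ≡ errors (rarr m rC)
      drop = Σ<-pred n hi
        (λ i′ _ ne → Σ<-cong n (λ j′ _ → cong (λ v → 𝟙 (not (does (v ≟ prod row i′ j′)))) (elsewhere i′ j′ (λ { (p , _) → ne (sym p) }))))
        (Σ<-pred n hj
          (λ j′ _ ne → cong (λ v → 𝟙 (not (does (v ≟ prod row i j′)))) (elsewhere i j′ (λ { (_ , p) → ne (sym p) })))
          (trans (cong suc (err-0 (rarr m′ rC) i j here)) (sym (err-1 (rarr m rC) i j bad))))
      st′ : State m′
      st′ = record
        { std      = record { Std (std st) }
        ; identity = identity st
        ; status   = status′
        ; number   = trans (cong₂ _∸_ (trans (number st) (sym drop)) (one (std st))) refl
        }

    module _ {g : ℕ → ℕ} {len : ℕ} where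

      record Fixed (i : ℕ) (M M′ : ℕ → ℕ → Carrier) (t : ℕ) : Set (c ⊔ ℓ) where
        field
          improves  : Improves M M′
          fixed     : ∀ u → u < t → M′ i (g u) ≈ prod row i (g u)
          unchanged : ∀ i′ j′ → i ≢ i′ ⊎ (∀ u → u < len → g u ≢ j′) → M′ i′ j′ ≡ M i′ j′

      open Fixed public

      -- Stated with W = 0, as the full cost: the decrease of `vK` is exchanged for it only in
      -- `amortise`, where the test is known to have failed.
      fixRow-run : ∀ {bits z sv} m → State m → Window bits nJ z g sv len m → (∀ u → u < len → g u < n) → nvar m vI < n →
        Run 0 fixRow m (2 + len * (11 + n * 6)) (λ m′ → State m′ × Fixed (nvar m vI) (rarr m rC) (rarr m′ rC) len)
      fixRow-run {sv = sv} m st w g<n hi = ins (λ _ → refl) (weaken (≤-reflexive (sh n len))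
        (for-run Inv m₁ sv len (9 + n * 6) (one (std st)) (finish w)
          (λ _ _ _ (s , f) → record { std = record { Std (std s) } ; identity = identity s ; status = status s ; number = number s } , f)
          body (start w)
          (record { std = record { Std (std st) } ; identity = identity st ; status = status st ; number = number st }
          , record { improves = λ _ _ _ _ e → e ; fixed = λ _ () ; unchanged = λ _ _ _ → refl })))
        where
        sh : ∀ n len → len * (9 + n * 6 + 2) + 1 ≡ 1 + len * (11 + n * 6)
        sh = solve-∀
        i : ℕ
        i = nvar m vI
        m₁ : Memory
        m₁ = exec false (copy vC vS) m
        Inv : ℕ → Memory → Set (c ⊔ ℓ)
        Inv t m′ = State m′ × Fixed i (rarr m rC) (rarr m′ rC) t
        body : ∀ t m′ → t < len → nvar m′ vC ≡ sv + t → Frame (assigns [ for vC vE fixBody ]) m₁ m′ → Inv t m′ →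
               Run 0 fixBody m′ (9 + n * 6) (Inv (suc t))
        body t m′ t<len hc fr (s , f) = ins (λ _ → refl) (weaken (≤-reflexive (sh′ n)) (bind entry (entry-run m₂ (record { Std (std s) })) after))
          where
          sh′ : ∀ n → 3 + n * 6 + 5 ≡ 8 + n * 6
          sh′ = solve-∀
          j : ℕ
          j = g t
          m₂ : Memory
          m₂ = exec false (load vJ nJ vZero vC) m′
          hj : narr m′ nJ (nvar m′ vZero) (nvar m′ vC) ≡ j
          hj = trans (cong₂ (narr m′ nJ) (nil (std s)) hc) (trans (keepNA fr nJ 0 (sv + t)) (items w t t<len))
          extend : ∀ {M′} → Improves (rarr m′ rC) M′ → M′ i j ≈ prod row i j →
            (∀ i′ j′ → ¬ (i ≡ i′ × j ≡ j′) → M′ i′ j′ ≡ rarr m′ rC i′ j′) → Fixed i (rarr m rC) M′ (suc t)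
          extend {M′} im ok un = record
            { improves  = improves-trans (improves f) im
            ; fixed     = fixed′
            ; unchanged = λ i′ j′ h → trans (un i′ j′ (outside i′ j′ h)) (unchanged f i′ j′ h) }
            where
            fixed′ : ∀ u → u < suc t → M′ i (g u) ≈ prod row i (g u)
            fixed′ u (s≤s u≤t) with m≤n⇒m<n∨m≡n u≤t
            ... | inj₁ u<t  = im i (g u) hi (g<n u (<-trans u<t t<len)) (fixed f u u<t)
            ... | inj₂ refl = ok
            outside : ∀ i′ j′ → i ≢ i′ ⊎ (∀ u → u < len → g u ≢ j′) → ¬ (i ≡ i′ × j ≡ j′)
            outside i′ j′ (inj₁ ne) (p , q) = ne p
            outside i′ j′ (inj₂ ne) (p , q) = ne t t<len q
          after : ∀ m₃ → Frame (assigns entry) m₂ m₃ → rvar m₃ 0 ≈ prod row (nvar m′ vI) (nvar m₂ vJ) →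
            Run 0 (instr (rload 1 rC vI vJ) ∷ ifte (requ 1 0) [] repair ∷ []) m₃ 5 (Inv (suc t))
          after m₃ fr₃ acc = ins (λ _ → refl) (branch good bad)
            where
            i₃ : nvar m₃ vI ≡ i
            i₃ = trans (keepN fr₃ vI) (keepN fr vI)
            j₃ : nvar m₃ vJ ≡ j
            j₃ = trans (keepN fr₃ vJ) hj
            m₄ : Memory
            m₄ = exec false (rload 1 rC vI vJ) m₃
            s₃ : State m₃
            s₃ = State-frame fr₃ (record { std = record { Std (std s) } ; identity = identity s ; status = status s ; number = number s })
            s₄ : State m₄
            s₄ = record { std = record { Std (std s₃) } ; identity = identity s₃ ; status = status s₃ ; number = number s₃ }
            acc′ : rvar m₃ 0 ≈ prod row i j
            acc′ = Rg.trans acc (≈-reflexive (cong₂ (prod row) (keepN fr vI) hj))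
            same : ∀ i′ j′ → rarr m₃ rC i′ j′ ≡ rarr m′ rC i′ j′
            same = keepRA fr₃ rC
            loaded : rvar m₄ 1 ≡ rarr m₃ rC i j
            loaded = cong₂ (rarr m₃ rC) i₃ j₃
            good : holds (requ 1 0) m₄ ≡ true → Run 0 [] m₄ 3 (Inv (suc t))
            good h with rvar m₄ 1 ≟ rvar m₄ 0
            ... | yes eq = stop (s₄ , extend (λ i′ j′ _ _ e → Rg.trans (≈-reflexive (same i′ j′)) e)
                                  (Rg.trans (≈-reflexive (sym loaded)) (Rg.trans eq acc′)) (λ i′ j′ _ → same i′ j′))
            bad : holds (requ 1 0) m₄ ≡ false → Run 0 repair m₄ 3 (Inv (suc t))
            bad h with rvar m₄ 1 ≟ rvar m₄ 0
            ... | no ne with repaired s₄ i j hi (g<n t t<len) i₃ j₃ acc′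
                             (λ e → ne (Rg.trans (≈-reflexive loaded) (Rg.trans e (Rg.sym acc′))))
            ...   | s₅ , im , ok , un = insK (λ _ → refl) (insK (λ _ → refl) (insK (λ _ → refl) (stop
                      (s₅ , extend (λ i′ j′ hi′ hj′ e → im i′ j′ hi′ hj′ (Rg.trans (≈-reflexive (same i′ j′)) e)) ok
                              (λ i′ j′ ne → trans (un i′ j′ ne) (same i′ j′))))))

  -- Sweeping the buckets

  rowBody : Program
  rowBody = instr (load vI nI vZero vP) ∷ compareSides nZ nJ row ++ ifte (requ 3 0) [] fixRow ∷ []

  checkRows : Program
  checkRows = instr (const vP 0) ∷ for vP vCntI rowBody ∷ []

  bucketBody : Program
  bucketBody =
    -- The end of the bucket is capped at the number J of flagged columns: min{J, e} is computed as
    -- J ∸ (J ∸ e).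
    instr (add vE vS vM) ∷ instr (monus vF vCntJ vE) ∷ instr (monus vE vCntJ vF) ∷
    computeU nZ nJ row ++ checkRows ++ instr (copy vS vE) ∷ []

  checkBuckets : Program
  checkBuckets = instr (const vB 0) ∷ instr (const vS 0) ∷ for vB vQ bucketBody ∷ []

  -- A single decrement of `vK` releases W, which covers the whole cost F, so the run is free in the
  -- amortised count.
  amortise : ∀ {q W F p m b} {Q : Memory → Set q} → F ≤ W → (∀ m′ → Q m′ → nvar m′ vK < nvar m vK) →
    Run 0 p m F Q → Run W p m b Q
  amortise {W = W} {F} {p} {m} {b} F≤W lower (mkRun {m′} {t} x co po) = mkRun x bound po
    where
    open ≤-Reasoning
    bound : t + W * nvar m′ vK ≤ b + W * nvar m vK
    bound = begin
      t + W * nvar m′ vK     ≤⟨ +-monoˡ-≤ _ (≤-trans (subst₂ _≤_ (+-identityʳ t) (+-identityʳ F) co) F≤W) ⟩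
      W + W * nvar m′ vK     ≡⟨ *-suc W (nvar m′ vK) ⟨
      W * suc (nvar m′ vK)   ≤⟨ *-monoʳ-≤ W (lower m′ po) ⟩
      W * nvar m vK          ≤⟨ m≤n+m _ b ⟩
      b + W * nvar m vK      ∎

  agree-cong : ∀ z n {f f′ g g′} → (∀ t → t < n → f t ≈ f′ t) → (∀ t → t < n → g t ≈ g′ t) → agree z n f g ≡ agree z n f′ g′
  agree-cong z n h h′ = does-cong (∑-cong n (λ t p → mask-cong (z t) (h t p))) (∑-cong n (λ t p → mask-cong (z t) (h′ t p)))

  cut : ∀ J s M → J ∸ (J ∸ (s ⊓ J + M)) ≡ (M + s) ⊓ J
  cut J s M = trans (cap J (s ⊓ J + M)) (begin
    J ⊓ (s ⊓ J + M)         ≡⟨ ⊓-comm J _ ⟩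
    (s ⊓ J + M) ⊓ J         ≡⟨ cong (_⊓ J) (+-distribʳ-⊓ M s J) ⟩
    (s + M) ⊓ (J + M) ⊓ J   ≡⟨ ⊓-assoc (s + M) (J + M) J ⟩
    (s + M) ⊓ ((J + M) ⊓ J) ≡⟨ cong ((s + M) ⊓_) (m≥n⇒m⊓n≡n (m≤m+n J M)) ⟩
    (s + M) ⊓ J             ≡⟨ cong (_⊓ J) (+-comm s M) ⟩
    (M + s) ⊓ J             ∎)
    where
    open ≡-Reasoning
    cap : ∀ m n → m ∸ (m ∸ n) ≡ m ⊓ n
    cap m n with ≤-total n m
    ... | inj₁ n≤m = trans (m∸[m∸n]≡n n≤m) (sym (m≥n⇒m⊓n≡n n≤m))
    ... | inj₂ m≤n = trans (cong (m ∸_) (m≤n⇒m∸n≡0 m≤n)) (sym (m≤n⇒m⊓n≡m m≤n))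

  record Listing (n cnt : ℕ) (list : ℕ → ℕ) : Set where
    field
      in-range  : ∀ p → p < cnt → list p < n
      injective : ∀ p p′ → p < cnt → p′ < cnt → list p ≡ list p′ → p ≡ p′

  open Listing public

  module Sweep (n : ℕ) (a b c′ : ℕ → ℕ → Carrier) (W : ℕ) (I : ℕ → ℕ) (cI : ℕ) (LI : Listing n cI I) where
    open Correction n a b c′ public

    module _ {z : ℕ → Bool} {g : ℕ → ℕ} {len : ℕ} where

      -- `caught` speaks of tests on M, the matrix before this bucket, although earlier rows have
      -- been repaired since. `later` makes the two agree: a row is still in its old state when its
      -- turn comes, because no row is listed twice.
      record Checked (M M′ : ℕ → ℕ → Carrier) (t : ℕ) : Set (c ⊔ ℓ) where
        field
          better  : Improves M M′
          caught  : ∀ p → p < t → agree z len (λ u → prod row (I p) (g u)) (λ u → M (I p) (g u)) ≡ false →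
                    ∀ u → u < len → M′ (I p) (g u) ≈ prod row (I p) (g u)
          later   : ∀ p → t ≤ p → p < cI → ∀ j → M′ (I p) j ≡ M (I p) j
          outside : ∀ i j → (∀ u → u < len → g u ≢ j) → M′ i j ≡ M i j

      open Checked public

      -- Only tests appear in the bound. A failed test proves an error in the window, its repair
      -- decreases `vK`, and so the recomputation counts as 0 steps.
      checkRows-run : ∀ {sv} → (∀ u → u < len → g u < n) → 2 + len * (11 + n * 6) ≤ W → ∀ m → State m → Window nZ nJ z g sv len m →
        UReady z g len row m →
        nvar m vCntI ≡ cI → (∀ p → p < cI → narr m nI 0 p ≡ I p) →
        Run W checkRows m (2 + cI * (12 + n * 6 + len * 7)) (λ m′ → State m′ × Checked (rarr m rC) (rarr m′ rC) cI)
      checkRows-run {sv} g<n affordable m st w u hc hI = ins (λ _ → refl) (weaken (≤-reflexive (sh n len cI))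
        (for-run Inv m₁ 0 cI (10 + n * 6 + len * 7) (one (std st)) hc
          (λ _ m x (s , f) → State-frame (update-frame (updN {m} {vP} {x})) s , f) body refl
          (State-frame (update-frame (updN {m} {vP} {0})) st
          , record { better = λ _ _ _ _ e → e ; caught = λ _ () ; later = λ _ _ _ _ → refl ; outside = λ _ _ _ → refl })))
        where
        sh : ∀ n len cI → cI * (10 + n * 6 + len * 7 + 2) + 1 ≡ 1 + cI * (12 + n * 6 + len * 7)
        sh = solve-∀
        m₁ : Memory
        m₁ = setN vP 0 m
        M : ℕ → ℕ → Carrier
        M = rarr m rC
        Inv : ℕ → Memory → Set (c ⊔ ℓ)
        Inv t m′ = State m′ × Checked M (rarr m′ rC) t
        body : ∀ t m′ → t < cI → nvar m′ vP ≡ t → Frame (assigns [ for vP vCntI rowBody ]) m₁ m′ → Inv t m′ →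
               Run W rowBody m′ (10 + n * 6 + len * 7) (Inv (suc t))
        body t m′ t<cI hp fr (s , f) = ins (λ _ → refl) (weaken (≤-reflexive (+-comm (8 + n * 6 + len * 7) 1))
          (bind (compareSides nZ nJ row)
            (compare-run row m₂ (std s₂) w₂ (λ l l<n → Rg.trans (≈-reflexive (keepRA fr rU 0 l)) (u l l<n))) after))
          where
          m₂ : Memory
          m₂ = exec false (load vI nI vZero vP) m′
          s₂ : State m₂
          s₂ = State-frame (exec-frame false (load vI nI vZero vP) m′) s
          w₂ : Window nZ nJ z g sv len m₂
          w₂ = Window-frame (exec-frame false (load vI nI vZero vP) m′) (Window-frame fr (record { Window w }))
          i : ℕ
          i = I t
          hi : nvar m₂ vI ≡ i
          hi = trans (cong₂ (narr m′ nI) (nil (std s)) hp) (trans (keepNA fr nI 0 t) (hI t t<cI))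
          i<n : i < n
          i<n = in-range LI t t<cI
          current : agree z len (λ v → prod row (nvar m₂ vI) (g v)) (λ v → rarr m₂ rC (nvar m₂ vI) (g v)) ≡
                    agree z len (λ v → prod row i (g v)) (λ v → M i (g v))
          current = trans (cong (λ i → agree z len (λ v → prod row i (g v)) (λ v → rarr m₂ rC i (g v))) hi)
            (agree-cong z len (λ _ _ → Rg.refl) (λ v _ → ≈-reflexive (later f t ≤-refl t<cI (g v))))
          after : ∀ m₃ → Frame (assigns (compareSides nZ nJ row)) m₂ m₃ →
            holds (requ 3 0) m₃ ≡ agree z len (λ v → prod row (nvar m₂ vI) (g v)) (λ v → rarr m₂ rC (nvar m₂ vI) (g v)) →
            Run W (ifte (requ 3 0) [] fixRow ∷ []) m₃ 1 (Inv (suc t))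
          after m₃ fr₃ e = branch quiet noisy
            where
            s₃ : State m₃
            s₃ = State-frame fr₃ s₂
            same : ∀ i′ j′ → rarr m₃ rC i′ j′ ≡ rarr m′ rC i′ j′
            same = keepRA fr₃ rC
            quiet : holds (requ 3 0) m₃ ≡ true → Run W [] m₃ 0 (Inv (suc t))
            quiet h = stop (s₃ , record
              { better  = λ i j hi hj e → Rg.trans (≈-reflexive (same i j)) (better f i j hi hj e)
              ; caught  = caught′
              ; later   = λ p t<p p<cI j → trans (same (I p) j) (later f p (<⇒≤ t<p) p<cI j)
              ; outside = λ i j h → trans (same i j) (outside f i j h) })
              where
              caught′ : ∀ p → p < suc t → agree z len (λ u → prod row (I p) (g u)) (λ u → M (I p) (g u)) ≡ false →
                ∀ u → u < len → rarr m₃ rC (I p) (g u) ≈ prod row (I p) (g u)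
              caught′ p (s≤s p≤t) h′ u u<len with m≤n⇒m<n∨m≡n p≤t
              ... | inj₁ p<t  = Rg.trans (≈-reflexive (same (I p) (g u))) (caught f p p<t h′ u u<len)
              ... | inj₂ refl = contradiction (trans (sym h) (trans e (trans current h′))) (λ ())
            noisy : holds (requ 3 0) m₃ ≡ false → Run W fixRow m₃ 0 (Inv (suc t))
            noisy h = Run-map done′ (amortise affordable decrease
              (fixRow-run m₃ s₃ (Window-frame fr₃ w₂) g<n (subst (_< n) (sym i₃) i<n)))
              where
              i₃ : nvar m₃ vI ≡ i
              i₃ = trans (keepN fr₃ vI) hi
              done′ : ∀ m₄ → Frame (assigns fixRow) m₃ m₄ →
                State m₄ × Fixed {g} {len} (nvar m₃ vI) (rarr m₃ rC) (rarr m₄ rC) len → Inv (suc t) m₄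
              done′ m₄ _ (s₄ , F) rewrite i₃ = s₄ , record
                { better  = λ i j hi hj e → improves F i j hi hj (Rg.trans (≈-reflexive (same i j)) (better f i j hi hj e))
                ; caught  = caught′
                ; later   = λ p t<p p<cI j → trans (unchanged F (I p) j (inj₁ (λ q → <⇒≢ t<p (injective LI t p t<cI p<cI q))))
                                               (trans (same (I p) j) (later f p (<⇒≤ t<p) p<cI j))
                ; outside = λ i j h → trans (unchanged F i j (inj₂ h)) (trans (same i j) (outside f i j h)) }
                where
                caught′ : ∀ p → p < suc t → agree z len (λ u → prod row (I p) (g u)) (λ u → M (I p) (g u)) ≡ false →
                  ∀ u → u < len → rarr m₄ rC (I p) (g u) ≈ prod row (I p) (g u)
                caught′ p (s≤s p≤t) h′ u u<len with m≤n⇒m<n∨m≡n p≤t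
                ... | inj₁ p<t  = improves F (I p) (g u) (in-range LI p (<-trans p<t t<cI)) (g<n u u<len)
                                    (Rg.trans (≈-reflexive (same (I p) (g u))) (caught f p p<t h′ u u<len))
                ... | inj₂ refl = fixed F u u<len
              -- If no error of the window were removed, there would be none, and the two sums would agree.
              decrease : ∀ m₄ → State m₄ × Fixed {g} {len} (nvar m₃ vI) (rarr m₃ rC) (rarr m₄ rC) len →
                nvar m₄ vK < nvar m₃ vK
              decrease m₄ (s₄ , F) rewrite i₃ with nvar m₄ vK <? nvar m₃ vK
              ... | yes lt = lt
              ... | no ¬lt = contradiction (trans (sym h) (trans e (trans (agree-cong z len (λ _ _ → Rg.refl) (λ _ _ → Rg.refl))
                               (trans (cong (λ i → agree z len (λ v → prod row i (g v)) (λ v → rarr m₂ rC i (g v))) hi)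
                                 (≈-agree z len (λ v v<len → Rg.sym (Rg.trans (≈-reflexive (sym (same i (g v)))) (allright v v<len)))))))) (λ ())
                where
                allright : ∀ v → v < len → rarr m₃ rC i (g v) ≈ prod row i (g v)
                allright v v<len with rarr m₃ rC i (g v) ≟ prod row i (g v)
                ... | yes p = p
                ... | no ¬p = contradiction (subst₂ _<_ (sym (number s₄)) (sym (number s₃))
                                (errors-mono-< (improves F) i (g v) i<n (g<n v v<len) ¬p (fixed F v v<len))) ¬lt

  module Buckets (n : ℕ) (a b c′ : ℕ → ℕ → Carrier) (W : ℕ) (I : ℕ → ℕ) (cI : ℕ) (LI : Listing n cI I)
    (J : ℕ → ℕ) (cJ : ℕ) (LJ : Listing n cJ J) (cJ≤n : cJ ≤ n) (Mw q : ℕ) (Z : ℕ → Bool)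
    (affordable : 2 + Mw * (11 + n * 6) ≤ W) where
    open Sweep n a b c′ W I cI LI public

    -- Bucket t consists of the positions from `first t` up to `first (suc t)` in the list of
    -- flagged columns. Because of the cap, the last buckets may be shorter or empty.
    first : ℕ → ℕ
    first t = t * Mw ⊓ cJ

    width : ℕ → ℕ
    width t = first (suc t) ∸ first t

    first-mono : ∀ t → first t ≤ first (suc t)
    first-mono t = ⊓-monoˡ-≤ cJ (m≤n+m (t * Mw) Mw)

    first+width : ∀ t → first t + width t ≡ first (suc t)
    first+width t = m+[n∸m]≡n (first-mono t)

    width≤Mw : ∀ t → width t ≤ Mw
    width≤Mw t = m≤n+o⇒m∸n≤o _ (first t) (begin
      (Mw + t * Mw) ⊓ cJ          ≤⟨ ⊓-monoʳ-≤ (Mw + t * Mw) (m≤n+m cJ Mw) ⟩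
      (Mw + t * Mw) ⊓ (Mw + cJ)   ≡⟨ +-distribˡ-⊓ Mw (t * Mw) cJ ⟨
      Mw + first t                ≡⟨ +-comm Mw _ ⟩
      first t + Mw                ∎)
      where open ≤-Reasoning

    width≤n : ∀ t → width t ≤ n
    width≤n t = ≤-trans (m∸n≤m _ (first t)) (≤-trans (m⊓n≤n (suc t * Mw) cJ) cJ≤n)

    inside : ∀ t u → u < width t → first t + u < first (suc t)
    inside t u h = subst (first t + u <_) (first+width t) (+-monoʳ-< (first t) h)

    inside-cJ : ∀ t u → u < width t → first t + u < cJ
    inside-cJ t u h = ≤-trans (inside t u h) (m⊓n≤n (suc t * Mw) cJ)

    -- A bit belongs to a position in the list of flagged columns, not to a column index, and the
    -- buckets use disjoint segments of one random vector.
    coin : ℕ → ℕ → Bool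
    coin t u = Z (first t + u)

    item : ℕ → ℕ → ℕ
    item t u = J (first t + u)

    overlooked : (ℕ → ℕ → Carrier) → ℕ → ℕ → Bool
    overlooked M t i = agree (coin t) (width t) (λ u → prod row i (item t u)) (λ u → M i (item t u))

    record Swept (M M′ : ℕ → ℕ → Carrier) (t : ℕ) : Set (c ⊔ ℓ) where
      field
        sweptImproves : Improves M M′
        sweptCaught   : ∀ t′ → t′ < t → ∀ p → p < cI → overlooked M t′ (I p) ≡ false →
                        ∀ u → u < width t′ → M′ (I p) (item t′ u) ≈ prod row (I p) (item t′ u)
        untouched     : ∀ p → first t ≤ p → p < cJ → ∀ i → M′ i (J p) ≡ M i (J p)

    open Swept public

    -- All tests of a bucket share one product of B with the bits, computed in O(n · Mw + n) steps;
    -- a flagged row then takes O(n). Widths are bounded by Mw in the first term and by n in the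
    -- second.
    checkBuckets-run : ∀ m → State m → nvar m vCntI ≡ cI → (∀ p → p < cI → narr m nI 0 p ≡ I p) →
      nvar m vCntJ ≡ cJ → (∀ p → p < cJ → narr m nJ 0 p ≡ J p) → nvar m vQ ≡ q → nvar m vM ≡ Mw →
      (∀ p → p < n → narr m nZ 0 p ≡ 𝟙 (Z p)) →
      Run W checkBuckets m (3 + q * (10 + n * (Mw * 7 + 7) + cI * (12 + n * 13)))
        (λ m′ → State m′ × Swept (rarr m rC) (rarr m′ rC) q)
    checkBuckets-run m st hcI hI hcJ hJ hq hM hZ = ins (λ _ → refl) (ins (λ _ → refl)
      (weaken (≤-reflexive (sh n Mw q cI)) (Run-map (λ _ _ (_ , s , f) → s , f)
      (for-run Inv m₁ 0 q (8 + n * (Mw * 7 + 7) + cI * (12 + n * 13)) (one (std st)) hq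
        (λ { _ m x (e , s , f) → e , State-frame (update-frame (updN {m} {vB} {x})) s , f }) body refl
        (refl , State-frame (update-frame (updN {setN vB 0 m} {vS} {0})) (State-frame (update-frame (updN {m} {vB} {0})) st)
        , record { sweptImproves = λ _ _ _ _ e → e ; sweptCaught = λ _ () ; untouched = λ _ _ _ _ → refl })))))
      where
      sh : ∀ n Mw q cI → q * (8 + n * (Mw * 7 + 7) + cI * (12 + n * 13) + 2) + 1 ≡
                         1 + q * (10 + n * (Mw * 7 + 7) + cI * (12 + n * 13))
      sh = solve-∀
      m₁ : Memory
      m₁ = setN vS 0 (setN vB 0 m)
      M : ℕ → ℕ → Carrier
      M = rarr m rC
      Inv : ℕ → Memory → Set (c ⊔ ℓ)
      Inv t m′ = nvar m′ vS ≡ first t × State m′ × Swept M (rarr m′ rC) t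
      body : ∀ t m′ → t < q → nvar m′ vB ≡ t → Frame (assigns [ for vB vQ bucketBody ]) m₁ m′ → Inv t m′ →
             Run W bucketBody m′ (8 + n * (Mw * 7 + 7) + cI * (12 + n * 13)) (Inv (suc t))
      body t m′ t<q hb fr (hs , s , f) = ins (λ _ → refl) (ins (λ _ → refl) (ins (λ _ → refl) (weaken bound
        (bind (computeU nZ nJ row) (computeU-run row m₂ (std s₂) w₂) afterU))))
        where
        e₁ e₂ e₃ : Instr
        e₁ = add vE vS vM
        e₂ = monus vF vCntJ vE
        e₃ = monus vE vCntJ vF
        m₂ : Memory
        m₂ = exec false e₃ (exec false e₂ (exec false e₁ m′))
        s₂ : State m₂
        s₂ = State-frame (exec-frame false e₃ (exec false e₂ (exec false e₁ m′)))
               (State-frame (exec-frame false e₂ (exec false e₁ m′)) (State-frame (exec-frame false e₁ m′) s))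
        bound : 2 + n * (width t * 7 + 7) + (2 + cI * (12 + n * 6 + width t * 7) + 1) ≤
                5 + n * (Mw * 7 + 7) + cI * (12 + n * 13)
        bound = ≤-trans (+-mono-≤ (+-monoʳ-≤ 2 (*-monoʳ-≤ n (+-monoˡ-≤ 7 (*-monoˡ-≤ 7 (width≤Mw t)))))
          (+-monoˡ-≤ 1 (+-monoʳ-≤ 2 (*-monoʳ-≤ cI (+-monoʳ-≤ (12 + n * 6) (*-monoˡ-≤ 7 (width≤n t)))))))
          (≤-reflexive (sh′ n (Mw * 7 + 7) cI))
          where
          sh′ : ∀ n x cI → 2 + n * x + (2 + cI * (12 + n * 6 + n * 7) + 1) ≡ 5 + n * x + cI * (12 + n * 13)
          sh′ = solve-∀
        ends : nvar m₂ vE ≡ first (suc t)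
        ends = trans (cong₂ (λ J x → J ∸ (J ∸ x)) (trans (keepN fr vCntJ) hcJ) (cong₂ _+_ hs (trans (keepN fr vM) hM)))
          (cut cJ (t * Mw) Mw)
        w₂ : Window nZ nJ (coin t) (item t) (first t) (width t) m₂
        w₂ = record
          { start  = hs
          ; finish = trans ends (sym (first+width t))
          ; coins  = λ u h → trans (keepNA fr nZ 0 (first t + u)) (hZ (first t + u) (≤-trans (inside-cJ t u h) cJ≤n))
          ; items  = λ u h → trans (keepNA fr nJ 0 (first t + u)) (hJ (first t + u) (inside-cJ t u h))
          }
        item<n : ∀ u → u < width t → item t u < n
        item<n u h = in-range LJ (first t + u) (inside-cJ t u h)
        afford : 2 + width t * (11 + n * 6) ≤ W
        afford = ≤-trans (+-monoʳ-≤ 2 (*-monoˡ-≤ (11 + n * 6) (width≤Mw t))) affordable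
        afterU : ∀ m₃ → Frame (assigns (computeU nZ nJ row)) m₂ m₃ → _ →
          Run W (checkRows ++ instr (copy vS vE) ∷ []) m₃ _ (Inv (suc t))
        afterU m₃ fr₃ u = bind checkRows
          (checkRows-run item<n afford m₃ (State-frame fr₃ s₂) (Window-frame fr₃ w₂) u
            (trans (keepN fr₃ vCntI) (trans (keepN fr vCntI) hcI))
            (λ p h → trans (keepNA fr₃ nI 0 p) (trans (keepNA fr nI 0 p) (hI p h)))) afterRows
          where
          same : ∀ i j → rarr m₃ rC i j ≡ rarr m′ rC i j
          same = keepRA fr₃ rC
          afterRows : ∀ m₄ → Frame (assigns checkRows) m₃ m₄ →
            State m₄ × Checked {coin t} {item t} {width t} (rarr m₃ rC) (rarr m₄ rC) cI →
            Run W (instr (copy vS vE) ∷ []) m₄ 1 (Inv (suc t))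
          afterRows m₄ fr₄ (s₄ , k) = ins (λ _ → refl) (stop
            ( trans (keepN fr₄ vE) (trans (keepN fr₃ vE) ends)
            , State-frame (exec-frame false (copy vS vE) m₄) s₄
            , record
              { sweptImproves = λ i j hi hj e → better k i j hi hj (Rg.trans (≈-reflexive (same i j)) (sweptImproves f i j hi hj e))
              ; sweptCaught   = caught′
              ; untouched     = λ p h p<cJ i → trans (outside k i (J p) (apart p h p<cJ)) (trans (same i (J p)) (untouched f p (≤-trans (first-mono t) h) p<cJ i)) }))
            where
            apart : ∀ p → first (suc t) ≤ p → p < cJ → ∀ u → u < width t → item t u ≢ J p
            apart p h p<cJ u hu e = <⇒≢ (<-≤-trans (inside t u hu) h) (injective LJ (first t + u) p (inside-cJ t u hu) p<cJ e)
            caught′ : ∀ t′ → t′ < suc t → ∀ p → p < cI → overlooked M t′ (I p) ≡ false →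
              ∀ u → u < width t′ → rarr m₄ rC (I p) (item t′ u) ≈ prod row (I p) (item t′ u)
            caught′ t′ (s≤s t′≤t) p p<cI h u hu with m≤n⇒m<n∨m≡n t′≤t
            ... | inj₁ t′<t = better k (I p) (item t′ u) (in-range LI p p<cI) (in-range LJ (first t′ + u) (inside-cJ t′ u hu))
                    (Rg.trans (≈-reflexive (same (I p) (item t′ u))) (sweptCaught f t′ t′<t p p<cI h u hu))
            -- No column of bucket t has been touched yet, so its tests see the entries from before
            -- the sweep.
            ... | inj₂ refl = caught k p p<cI (trans (agree-cong (coin t) (width t) (λ _ _ → Rg.refl)
                    (λ v hv → ≈-reflexive (trans (same (I p) (item t v))
                      (untouched f (first t + v) (m≤m+n (first t) v) (inside-cJ t v hv) (I p))))) h) u hu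

    locate : ∀ t p → p < first t → ∃[ t′ ] ∃[ u ] (t′ < t × u < width t′ × first t′ + u ≡ p)
    locate zero    p ()
    locate (suc t) p h with p <? first t
    ... | yes lt = let t′ , u , r , v = locate t p lt in t′ , u , m<n⇒m<1+n r , v
    ... | no ¬lt = t , p ∸ first t , ≤-refl , ∸-monoˡ-< h (≮⇒≥ ¬lt) , m+[n∸m]≡n (≮⇒≥ ¬lt)

  -- One round

  detect : Program
  detect = findLines row ++ instr (copy vCntI vCnt) ∷ findLines col ++ instr (copy vCntJ vCnt) ∷ squareRoot ++ divide

  module Detection (n : ℕ) (a b c′ : ℕ → ℕ → Carrier) where
    open Correction n a b c′

    silentIn : Side → (ℕ → Bool) → (ℕ → ℕ → Carrier) → ℕ → Bool
    silentIn = silent {n} {a} {b}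

    silent-cong : ∀ s z {M M′ : ℕ → ℕ → Carrier} → (∀ i j → M i j ≡ M′ i j) → ∀ i → silentIn s z M i ≡ silentIn s z M′ i
    silent-cong s z e i = agree-cong z n (λ _ _ → Rg.refl) (λ j _ → ≈-reflexive (same s j))
      where
      same : ∀ s j → get s _ i j ≡ get s _ i j
      same row j = e i j
      same col j = e j i

    Listed-matrix : ∀ {s z M M′ t cnt list} → (∀ i j → M i j ≡ M′ i j) →
      Listed {n} {a} {b} s z M t cnt list → Listed {n} {a} {b} s z M′ t cnt list
    Listed-matrix {s} {z} {t = t} e L = record
      { count    = trans (count L) (Σ<-cong t (λ i _ → cong (λ v → 𝟙 (not v)) (silent-cong s z e i)))
      ; listed<  = listed< L
      ; distinct = distinct L
      ; complete = λ i h q → complete L i h (trans (silent-cong s z e i) q)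
      }

    Listed⇒Listing : ∀ {s z M cnt list} → Listed {n} {a} {b} s z M n cnt list → Listing n cnt list
    Listed⇒Listing L = record { in-range = listed< L ; injective = distinct L }

    count≤n : ∀ {s z M cnt list} → Listed {n} {a} {b} s z M n cnt list → cnt ≤ n
    count≤n {s} {z} {M} L = ≤-trans (≤-reflexive (count L))
      (≤-trans (Σ<-mono n (λ i _ → 𝟙≤1 _)) (≤-reflexive (trans (Σ<-const n 1) (*-identityʳ n))))

    lineErr : Side → (ℕ → ℕ → Carrier) → ℕ → ℕ → ℕ
    lineErr row M i j = err M i j
    lineErr col M i j = err M j i

    lineErr-0 : ∀ s M i j → lineErr s M i j ≤ 0 → prod s i j ≈ get s M i j
    lineErr-0 row M i j h with M i j ≟ prod row i j
    ... | yes p = Rg.sym p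
    lineErr-0 col M i j h with M j i ≟ prod row j i
    ... | yes p = Rg.sym p

    -- A line without errors passes every test, so a flagged line contains an error. Hence the
    -- number of flagged lines is bounded by the number of errors on every tape, not merely on
    -- average.
    noisy-line : ∀ s z M i → 𝟙 (not (silentIn s z M i)) ≤ Σ< n (lineErr s M i)
    noisy-line s z M i with silentIn s z M i in e
    ... | true  = z≤n
    ... | false with 1 ≤? Σ< n (lineErr s M i)
    ...   | yes p = p
    ...   | no ¬p = contradiction
              (trans (sym e) (≈-agree z n (λ j j<n → lineErr-0 s M i j
                (≤-trans (term≤Σ< n (lineErr s M i) j<n) (≤-pred (≰⇒> ¬p)))))) (λ ())

    count≤errors : ∀ {s z M cnt list} → Listed {n} {a} {b} s z M n cnt list → cnt ≤ errors M
    count≤errors {row} {z} {M} L = ≤-trans (≤-reflexive (count L)) (Σ<-mono n (λ i _ → noisy-line row z M i))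
    count≤errors {col} {z} {M} L = ≤-trans (≤-reflexive (count L))
      (≤-trans (Σ<-mono n (λ i _ → noisy-line col z M i)) (≤-reflexive (Σ<-comm n n (λ i j → err M j i))))

    errors≤n² : ∀ M → errors M ≤ n * n
    errors≤n² M = ≤-trans (Σ<-mono n (λ i _ → ≤-trans (Σ<-mono n (λ j _ → 𝟙≤1 _)) (≤-reflexive (trans (Σ<-const n 1) (*-identityʳ n)))))
      (≤-reflexive (Σ<-const n n))

    record Detected (x y : ℕ → Bool) (M : ℕ → ℕ → Carrier) (k : ℕ) (m′ : Memory) : Set (c ⊔ ℓ) where
      field
        stateD  : State m′
        rows    : Listed {n} {a} {b} row x M n (nvar m′ vCntI) (narr m′ nI 0)
        columns : Listed {n} {a} {b} col y M n (nvar m′ vCntJ) (narr m′ nJ 0)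
        root    : Root k (nvar m′ vQ)
        covers  : nvar m′ vCntJ ≤ nvar m′ vM * nvar m′ vQ
        narrow  : nvar m′ vM * nvar m′ vQ ≤ nvar m′ vCntJ + nvar m′ vQ

    open Detected public

    detect-run : ∀ {W x y} m → State m → 1 ≤ nvar m vK →
      (∀ t → t < n → narr m nX 0 t ≡ 𝟙 (x t)) → (∀ t → t < n → narr m nY 0 t ≡ 𝟙 (y t)) →
      Run W detect m (24 + n * (n * 40 + 52)) (Detected x y (rarr m rC) (nvar m vK))
    detect-run {W} {x} {y} m st k≥1 hx hy = weaken (≤-reflexive (sh n))
      (bind (findLines row) (findLines-run row m (std st) hx (identity st)) afterRows)
      where
      sh : ∀ n → 7 + n * (n * 20 + 20) + suc (7 + n * (n * 20 + 20) + suc (4 + n * 7 + (4 + n * 5))) ≡ 24 + n * (n * 40 + 52)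
      sh = solve-∀
      M : ℕ → ℕ → Carrier
      M = rarr m rC
      afterRows : ∀ m₁ → Frame (assigns (findLines row)) m m₁ → Listed {n} {a} {b} row x M n (nvar m₁ vCnt) (narr m₁ nI 0) →
        Run W (instr (copy vCntI vCnt) ∷ findLines col ++ instr (copy vCntJ vCnt) ∷ squareRoot ++ divide) m₁
          (suc (7 + n * (n * 20 + 20) + suc (4 + n * 7 + (4 + n * 5)))) (Detected x y M (nvar m vK))
      afterRows m₁ f₁ L₁ = ins (λ _ → refl) (bind (findLines col)
        (findLines-run col m₂ (std s₂) (λ t h → trans (keepNA f₁ nY 0 t) (hy t h)) (identity s₂)) afterCols)
        where
        m₂ : Memory
        m₂ = exec false (copy vCntI vCnt) m₁
        s₂ : State m₂
        s₂ = State-frame (exec-frame false (copy vCntI vCnt) m₁) (State-frame f₁ st)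
        afterCols : ∀ m₃ → Frame (assigns (findLines col)) m₂ m₃ →
          Listed {n} {a} {b} col y (rarr m₁ rC) n (nvar m₃ vCnt) (narr m₃ nJ 0) →
          Run W (instr (copy vCntJ vCnt) ∷ squareRoot ++ divide) m₃ (suc (4 + n * 7 + (4 + n * 5))) (Detected x y M (nvar m vK))
        afterCols m₃ f₃ L₃ = ins (λ _ → refl) (bind squareRoot
          (squareRoot-run m₄ n (size (std s₄)) (one (std s₄)) (subst (1 ≤_) (sym k₄) k≥1)
            (≤-trans (≤-reflexive (number s₄)) (errors≤n² _))) afterRoot)
          where
          m₄ : Memory
          m₄ = exec false (copy vCntJ vCnt) m₃
          s₃ : State m₃
          s₃ = State-frame f₃ s₂
          s₄ : State m₄
          s₄ = State-frame (exec-frame false (copy vCntJ vCnt) m₃) s₃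
          k₄ : nvar m₃ vK ≡ nvar m vK
          k₄ = trans (keepN f₃ vK) (keepN f₁ vK)
          afterRoot : ∀ m₅ → Frame (assigns squareRoot) m₄ m₅ → Root (nvar m₃ vK) (nvar m₅ vQ) →
            Run W divide m₅ (4 + n * 5) (Detected x y M (nvar m vK))
          afterRoot m₅ f₅ r = weaken (+-monoʳ-≤ 4 (*-monoˡ-≤ 5 (≤-trans (≤-reflexive (keepN f₅ vCntJ)) (count≤n L₃))))
            (Run-map conclude (divide-run m₅ (trans (keepN f₅ vOne) (one (std s₄))) (q≥1 r)))
            where
            conclude : ∀ m₆ → Frame (assigns divide) m₅ m₆ →
              nvar m₅ vCntJ ≤ nvar m₆ vM * nvar m₅ vQ × nvar m₆ vM * nvar m₅ vQ ≤ nvar m₅ vCntJ + nvar m₅ vQ →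
              Detected x y M (nvar m vK) m₆
            conclude m₆ f₆ (cov , nar) = record
              { stateD  = State-frame f₆ (State-frame f₅ s₄)
              ; rows    = Listed-cong (trans (keepN f₆ vCntI) (trans (keepN f₅ vCntI) (keepN f₃ vCntI)))
                            (λ p → trans (keepNA f₆ nI 0 p) (trans (keepNA f₅ nI 0 p) (keepNA f₃ nI 0 p))) L₁
              ; columns = Listed-cong (trans (keepN f₆ vCntJ) (keepN f₅ vCntJ))
                            (λ p → trans (keepNA f₆ nJ 0 p) (keepNA f₅ nJ 0 p))
                            (Listed-matrix (keepRA f₁ rC) L₃)
              ; root    = subst₂ Root k₄ (sym (keepN f₆ vQ)) r
              ; covers  = subst₂ (λ J q → J ≤ nvar m₆ vM * q) (sym (keepN f₆ vCntJ)) (sym (keepN f₆ vQ)) cov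
              ; narrow  = subst₂ (λ J q → nvar m₆ vM * q ≤ J + q) (sym (keepN f₆ vCntJ)) (sym (keepN f₆ vQ)) nar
              }

  -- q² is at most 4 k, and k is at most k² as well as n².
  root≤ : ∀ {k q n} → 1 ≤ k → k ≤ n * n → Root k q → q ≤ 2 * (k ⊓ n)
  root≤ {k} {q} {n} k≥1 k≤n² r = ≤-trans (⊓-glb (via k k≤k²) (via n k≤n²)) (≤-reflexive (sym (*-distribˡ-⊓ 2 k n)))
    where
    k≤k² : k ≤ k * k
    k≤k² = ≤-trans (≤-reflexive (sym (*-identityʳ k))) (*-monoʳ-≤ k k≥1)
    via : ∀ x → k ≤ x * x → q ≤ 2 * x
    via x h = square-cancel-≤ (≤-trans (q²≤4k r) (≤-trans (*-monoʳ-≤ 4 h) (≤-reflexive (four x))))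
      where
      four : ∀ x → 4 * (x * x) ≡ 2 * x * (2 * x)
      four = solve-∀

  -- Every term is a multiple of X = q · μ · n. The key bounds are M q ≤ J + q ≤ 3 μ for the
  -- products with B, and M k ≤ M q² ≤ 3 q μ for the repairs, where q² ≥ k enters. The coefficients
  -- add up to 121.
  sweep-cost : ∀ {k q n μ I J M} → 1 ≤ n → 1 ≤ μ → Root k q → q ≤ 2 * μ → I ≤ μ → J ≤ μ → M * q ≤ J + q →
    3 + q * (10 + n * (M * 7 + 7) + I * (12 + n * 13)) + (2 + M * (11 + n * 6)) * k ≤ 121 * (q * μ * n)
  sweep-cost {k} {q} {n} {μ} {I} {J} {M} n≥1 μ≥1 r q≤2μ I≤μ J≤μ Mq = begin
    3 + q * (10 + n * (M * 7 + 7) + I * (12 + n * 13)) + (2 + M * (11 + n * 6)) * k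
      ≡⟨ expand n k q M I ⟩
    3 * 1 + 10 * q + 7 * (n * (M * q)) + 7 * (q * n) + 12 * (q * I) + 13 * (q * I * n) + 2 * k + 11 * (M * k) + 6 * (M * k * n)
      ≤⟨ +-mono-≤ (+-mono-≤ (+-mono-≤ (+-mono-≤ (+-mono-≤ (+-mono-≤ (+-mono-≤ (+-mono-≤
           (*-monoʳ-≤ 3 1≤X) (*-monoʳ-≤ 10 q≤X)) (*-monoʳ-≤ 7 nMq≤3X)) (*-monoʳ-≤ 7 qn≤X)) (*-monoʳ-≤ 12 qI≤X))
           (*-monoʳ-≤ 13 qIn≤X)) (*-monoʳ-≤ 2 k≤2X)) (*-monoʳ-≤ 11 Mk≤3X)) (*-monoʳ-≤ 6 Mkn≤3X) ⟩
    3 * X + 10 * X + 7 * (3 * X) + 7 * X + 12 * X + 13 * X + 2 * (2 * X) + 11 * (3 * X) + 6 * (3 * X)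
      ≡⟨ collect′ X ⟩
    121 * X ∎
    where
    open ≤-Reasoning
    X : ℕ
    X = q * μ * n
    expand : ∀ n k q M I → 3 + q * (10 + n * (M * 7 + 7) + I * (12 + n * 13)) + (2 + M * (11 + n * 6)) * k ≡
      3 * 1 + 10 * q + 7 * (n * (M * q)) + 7 * (q * n) + 12 * (q * I) + 13 * (q * I * n) + 2 * k + 11 * (M * k) + 6 * (M * k * n)
    expand = solve-∀
    collect′ : ∀ X → 3 * X + 10 * X + 7 * (3 * X) + 7 * X + 12 * X + 13 * X + 2 * (2 * X) + 11 * (3 * X) + 6 * (3 * X) ≡ 121 * X
    collect′ = solve-∀
    1* : ∀ {x y} → 1 ≤ y → x ≤ x * y
    1* {x} h = ≤-trans (≤-reflexive (sym (*-identityʳ x))) (*-monoʳ-≤ x h)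
    qμ≤X : q * μ ≤ X
    qμ≤X = 1* n≥1
    q≤X : q ≤ X
    q≤X = ≤-trans (1* μ≥1) qμ≤X
    1≤X : 1 ≤ X
    1≤X = ≤-trans (q≥1 r) q≤X
    qn≤X : q * n ≤ X
    qn≤X = *-monoˡ-≤ n (1* {q} μ≥1)
    qI≤X : q * I ≤ X
    qI≤X = ≤-trans (*-monoʳ-≤ q I≤μ) qμ≤X
    qIn≤X : q * I * n ≤ X
    qIn≤X = *-monoˡ-≤ n (*-monoʳ-≤ q I≤μ)
    Mq≤3μ : M * q ≤ 3 * μ
    Mq≤3μ = ≤-trans Mq (+-mono-≤ J≤μ q≤2μ)
    nMq≤3X : n * (M * q) ≤ 3 * X
    nMq≤3X = ≤-trans (*-monoʳ-≤ n Mq≤3μ) (≤-trans (1* (q≥1 r)) (≤-reflexive (sh n μ q)))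
      where
      sh : ∀ n μ q → n * (3 * μ) * q ≡ 3 * (q * μ * n)
      sh = solve-∀
    k≤2X : k ≤ 2 * X
    k≤2X = ≤-trans (k≤q² r) (≤-trans (*-monoʳ-≤ q q≤2μ) (≤-trans (≤-reflexive (sh q μ)) (*-monoʳ-≤ 2 qμ≤X)))
      where
      sh : ∀ q μ → q * (2 * μ) ≡ 2 * (q * μ)
      sh = solve-∀
    Mk≤ : M * k ≤ 3 * (q * μ)
    Mk≤ = ≤-trans (*-monoʳ-≤ M (k≤q² r)) (≤-trans (≤-reflexive (sym (*-assoc M q q)))
      (≤-trans (*-monoˡ-≤ q Mq≤3μ) (≤-reflexive (sh μ q))))
      where
      sh : ∀ μ q → 3 * μ * q ≡ 3 * (q * μ)
      sh = solve-∀
    Mk≤3X : M * k ≤ 3 * X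
    Mk≤3X = ≤-trans Mk≤ (*-monoʳ-≤ 3 qμ≤X)
    Mkn≤3X : M * k * n ≤ 3 * X
    Mkn≤3X = ≤-trans (*-monoˡ-≤ n Mk≤) (≤-reflexive (*-assoc 3 (q * μ) n))

  -- If a line test was silent, the error is counted as surviving for certain; otherwise only the
  -- bucket test can overlook it, with probability at most 1/2. The leading factors 1 are the value
  -- of `err` at a wrong entry.
  half-unless : ∀ N r s (o : Vec Bool N → Bool) → (s ≡ false → 2 * sumTapes N (λ z → 𝟙 (o z)) ≤ 2 ^ N) →
    2 * sumTapes N (λ z → 1 * (if r ∨ s then 1 else 𝟙 (o z))) ≤ 2 ^ N * (1 * (1 + 𝟙 (r ∨ s)))
  half-unless N r s o even = go (r ∨ s) (∨-conicalʳ r s)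
    where
    two : ∀ P → 2 * (1 * P) ≡ P * (1 * 2)
    two = solve-∀
    go : ∀ v → (v ≡ false → s ≡ false) →
      2 * sumTapes N (λ z → 1 * (if v then 1 else 𝟙 (o z))) ≤ 2 ^ N * (1 * (1 + 𝟙 v))
    go true  h = ≤-reflexive (trans (cong (2 *_) (sumTapes-const N 1)) (two (2 ^ N)))
    go false h = ≤-trans (≤-reflexive (cong (2 *_) (sumTapes-cong N (λ z → *-identityˡ _))))
      (≤-trans (even (h refl)) (≤-reflexive (sym (*-identityʳ (2 ^ N)))))

  bounded-unless : ∀ {v} r s o → v ≤ 1 → (r ≡ false → s ≡ false → o ≡ false → v ≤ 0) → v ≤ 1 * (if r ∨ s then 1 else 𝟙 o)
  bounded-unless true  s     o     v≤1 h = v≤1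
  bounded-unless false true  o     v≤1 h = v≤1
  bounded-unless false false true  v≤1 h = v≤1
  bounded-unless false false false v≤1 h = h refl refl refl

  -- Expected number of errors after a sweep

  module SweepLayer (n : ℕ) (a b c′ : ℕ → ℕ → Carrier) (n≥1 : 1 ≤ n) where
    open Correction n a b c′ using (State; err; errors; err-0; State-frame; number; std; size; one; nil; prod)
    open Detection n a b c′

    -- Bounds twice the probability, over the bits z, that an error at (i , j) survives the round.
    weight : (x y : ℕ → Bool) → (ℕ → ℕ → Carrier) → ℕ → ℕ → ℕ
    weight x y M i j = 1 + 𝟙 (silentIn row x M i ∨ silentIn col y M j)

    module _ {q′} {Q : Memory → Set q′} {ss : Program} {N B σ k : ℕ} (M : ℕ → ℕ → Carrier) (k≡ : k ≡ errors M) (k≥1 : 1 ≤ k)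
      (cont : ∀ m′ → State m′ → nvar m′ vK ≤ k → Good Q 1 N (ss , m′) (B + σ * nvar m′ vK))
      (x y : ℕ → Bool) (m : Memory) (eqC : ∀ i j → rarr m rC i j ≡ M i j) (D : Detected x y M k m) (Qb : ℕ) (q≤Qb : nvar m vQ ≤ Qb)
      where

      private
        I J : ℕ → ℕ
        I = narr m nI 0
        J = narr m nJ 0
        cI cJ Mw q μ W Tc P : ℕ
        cI = nvar m vCntI
        cJ = nvar m vCntJ
        Mw = nvar m vM
        q  = nvar m vQ
        μ  = k ⊓ n
        W  = 2 + Mw * (11 + n * 6)
        Tc = 121 * (Qb * μ * n)
        P  = 2 ^ n

        module Bk (Z : ℕ → Bool) = Buckets n a b c′ W I cI (Listed⇒Listing (rows D)) J cJ (Listed⇒Listing (columns D))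
          (count≤n (columns D)) Mw q Z ≤-refl

        -- The division into buckets does not depend on the random vector, so any instance serves.
        open Bk (λ _ → false) using (width; item; first; locate)

        k≤n² : k ≤ n * n
        k≤n² = ≤-trans (≤-reflexive k≡) (errors≤n² M)

        cost≤ : 3 + q * (10 + n * (Mw * 7 + 7) + cI * (12 + n * 13)) + W * k ≤ Tc
        cost≤ = ≤-trans (sweep-cost {I = cI} {cJ} {Mw} n≥1 (⊓-glb k≥1 n≥1) (root D) (root≤ k≥1 k≤n² (root D))
            (⊓-glb (≤-trans (count≤errors (rows D)) (≤-reflexive (sym k≡))) (count≤n (rows D)))
            (⊓-glb (≤-trans (count≤errors (columns D)) (≤-reflexive (sym k≡))) (count≤n (columns D))) (narrow D))
          (*-monoʳ-≤ 121 (*-monoˡ-≤ n (*-monoˡ-≤ μ q≤Qb)))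

        locateColumn : ∀ j → j < n → silentIn col y M j ≡ false → ∃[ t ] ∃[ u ] (t < q × u < width t × item t u ≡ j)
        locateColumn j j<n e with complete (columns D) j j<n e
        ... | p , p<cJ , Jp≡j with locate q p (subst (p <_) (sym (m≥n⇒m⊓n≡n (≤-trans (covers D) (≤-reflexive (*-comm Mw q))))) p<cJ)
        ...   | t , u , t<q , u<w , eq = t , u , t<q , u<w , trans (cong J eq) Jp≡j

        -- The lists of flagged lines are fixed before z is drawn, so the bucket of a column is the
        -- same for all z and the survival of an error is one event about z. The value 0 is a
        -- placeholder for columns that are not flagged.
        bucketFrom : ∀ j v → silentIn col y M j ≡ v → ℕ
        bucketFrom j true  e = 0
        bucketFrom j false e with j <? n
        ... | yes j<n = proj₁ (locateColumn j j<n e)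
        ... | no _    = 0

        bucketFrom-spec : ∀ j v (e : silentIn col y M j ≡ v) → j < n → v ≡ false →
          let t = bucketFrom j v e in ∃[ u ] (t < q × u < width t × item t u ≡ j)
        bucketFrom-spec j false e j<n _ with j <? n
        ... | yes h = proj₂ (locateColumn j h e)
        ... | no ¬h = contradiction j<n ¬h

        bucket : ℕ → ℕ
        bucket j = bucketFrom j (silentIn col y M j) refl

        missed : Vec Bool n → ℕ → ℕ → ℕ
        missed z i j = if silentIn row x M i ∨ silentIn col y M j then 1 else 𝟙 (Bk.overlooked (bit z) M (bucket j) i)

        remaining : Vec Bool n → ℕ
        remaining z = Σ< n (λ i → Σ< n (λ j → err M i j * missed z i j))

        missed-half : ∀ i j → i < n → j < n → 2 * sumTapes n (λ z → err M i j * missed z i j) ≤ P * (err M i j * weight x y M i j)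
        missed-half i j i<n j<n with M i j ≟ prod row i j
        ... | yes _ = ≤-trans (≤-reflexive (trans (cong (2 *_) (sumTapes-const n 0)) refl)) z≤n
        ... | no ne = half-unless n (silentIn row x M i) (silentIn col y M j) (λ z → Bk.overlooked (bit z) M (bucket j) i) likely
          where
          likely : silentIn col y M j ≡ false → 2 * sumTapes n (λ z → 𝟙 (Bk.overlooked (bit z) M (bucket j) i)) ≤ P
          likely e = let u , _ , u<w , eq = bucketFrom-spec j (silentIn col y M j) refl j<n e in
            agree-half n (first (bucket j)) (width (bucket j)) (λ v → prod row i (item (bucket j) v)) (λ v → M i (item (bucket j) v)) u<w
              (≤-trans (Bk.inside-cJ (λ _ → false) (bucket j) u u<w) (count≤n (columns D)))
              (λ h → ne (Rg.sym (subst (λ v → prod row i v ≈ M i v) eq h)))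

        average-remaining : 2 * sumTapes n remaining ≤ P * Σ< n (λ i → Σ< n (λ j → err M i j * weight x y M i j))
        average-remaining = begin
          2 * sumTapes n remaining
            ≡⟨ cong (2 *_) (trans (sumTapes-Σ< n n _) (Σ<-cong n (λ i _ → sumTapes-Σ< n n _))) ⟩
          2 * Σ< n (λ i → Σ< n (λ j → sumTapes n (λ z → err M i j * missed z i j)))
            ≡⟨ trans (sym (Σ<-* n 2 _)) (Σ<-cong n (λ i _ → sym (Σ<-* n 2 _))) ⟩
          Σ< n (λ i → Σ< n (λ j → 2 * sumTapes n (λ z → err M i j * missed z i j)))
            ≤⟨ Σ<-mono n (λ i i<n → Σ<-mono n (λ j j<n → missed-half i j i<n j<n)) ⟩
          Σ< n (λ i → Σ< n (λ j → P * (err M i j * weight x y M i j)))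
            ≡⟨ trans (Σ<-cong n (λ i _ → Σ<-* n P _)) (Σ<-* n P _) ⟩
          P * Σ< n (λ i → Σ< n (λ j → err M i j * weight x y M i j)) ∎
          where open ≤-Reasoning

        -- Right entries stay right. A wrong entry in a flagged row and a flagged column lies in
        -- some bucket, and unless the test of its row there overlooks it, this segment of the row
        -- has been recomputed.
        remaining-bound : ∀ z M₀ M′ → (∀ i j → M₀ i j ≡ M i j) → Bk.Swept (bit z) M₀ M′ q → errors M′ ≤ remaining z
        remaining-bound z M₀ M′ e₀ S = Σ<-mono n (λ i i<n → Σ<-mono n (λ j j<n → pointwise i j i<n j<n))
          where
          pointwise : ∀ i j → i < n → j < n → err M′ i j ≤ err M i j * missed z i j
          pointwise i j i<n j<n with M i j ≟ prod row i j
          ... | yes p = ≤-reflexive (err-0 M′ i j (Bk.sweptImproves S i j i<n j<n (Rg.trans (≈-reflexive (e₀ i j)) p)))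
          ... | no ne = bounded-unless (silentIn row x M i) (silentIn col y M j) (Bk.overlooked (bit z) M (bucket j) i) (𝟙≤1 _) caught
            where
            caught : silentIn row x M i ≡ false → silentIn col y M j ≡ false → Bk.overlooked (bit z) M (bucket j) i ≡ false →
              err M′ i j ≤ 0
            caught er ec eo =
              let u , t<q , u<w , eq = bucketFrom-spec j (silentIn col y M j) refl j<n ec
                  p , p<cI , Ip≡i    = complete (rows D) i i<n er
              in ≤-reflexive (err-0 M′ i j (subst₂ (λ i j → M′ i j ≈ prod row i j) Ip≡i eq
                (Bk.sweptCaught S (bucket j) t<q p p<cI
                  (trans (agree-cong (Bk.coin (bit z) (bucket j)) (width (bucket j))
                            (λ v _ → ≈-reflexive (cong (λ i → prod row i (item (bucket j) v)) Ip≡i))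
                            (λ v _ → ≈-reflexive (trans (cong (λ i → M₀ i (item (bucket j) v)) Ip≡i) (e₀ i _)))) eo) u u<w)))

      -- In the scale, 2 ^ n stands for the tapes of z and the factor 2 for the denominator of the
      -- survival probability. The bound of the continuation is linear in `vK`, so only the mean
      -- number of remaining errors enters.
      sweep-good : Good Q (2 * (2 ^ n * 1)) N (fill nZ ++ checkBuckets ++ ss , m)
        (2 ^ n * (2 * (n * 4 + 2 + (121 * (Qb * (k ⊓ n) * n) + B)) + σ * Σ< n (λ i → Σ< n (λ j → err M i j * weight x y M i j))))
      sweep-good = good-mono total (good-scale 2 (good-fill nZ m f (size (std s)) (one (std s)) (nil (std s)) after))
        where
        s : State m
        s = stateD D
        f : Vec Bool n → ℕ
        f z = Tc + B + σ * remaining z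
        after : ∀ z m′ → Frame (assigns (fill nZ)) m m′ → (∀ t → t < n → narr m′ nZ 0 t ≡ 𝟙 (bit z t)) →
          Good Q 1 N (checkBuckets ++ ss , m′) (f z)
        after z m′ fr hz = go (Bk.checkBuckets-run (bit z) m′ s′ (keepN fr vCntI) (λ p _ → keepNA fr nI 0 p)
            (keepN fr vCntJ) (λ p _ → keepNA fr nJ 0 p) (keepN fr vQ) (keepN fr vM) hz)
          where
          s′ : State m′
          s′ = State-frame fr s
          k′ : nvar m′ vK ≡ k
          k′ = trans (number s′) (trans (Correction.errors-cong n a b c′ (λ i j → trans (keepRA fr rC i j) (eqC i j))) (sym k≡))
          go : Run W checkBuckets m′ (3 + q * (10 + n * (Mw * 7 + 7) + cI * (12 + n * 13)))
                 (λ m″ → State m″ × Bk.Swept (bit z) (rarr m′ rC) (rarr m″ rC) q) →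
               Good Q 1 N (checkBuckets ++ ss , m′) (f z)
          go (mkRun {m″} {t} tr co (s″ , S)) = good-mono bound (good-exec tr (cont m″ s″ k″≤k))
            where
            k″≤rem : nvar m″ vK ≤ remaining z
            k″≤rem = ≤-trans (≤-reflexive (number s″))
              (remaining-bound z (rarr m′ rC) (rarr m″ rC) (λ i j → trans (keepRA fr rC i j) (eqC i j)) S)
            k″≤k : nvar m″ vK ≤ k
            k″≤k = subst₂ _≤_ (sym (number s″)) (trans (sym (number s′)) k′) (Correction.errors-mono n a b c′ (Bk.sweptImproves S))
            t≤ : t ≤ Tc
            t≤ = ≤-trans (m≤m+n t _) (≤-trans co (≤-trans (≤-reflexive (cong (λ v → 3 + q * (10 + n * (Mw * 7 + 7) + cI * (12 + n * 13)) + W * v) k′)) cost≤))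
            bound : t * 1 + (B + σ * nvar m″ vK) ≤ f z
            bound = ≤-trans (≤-reflexive (cong (_+ (B + σ * nvar m″ vK)) (*-identityʳ t)))
              (≤-trans (+-mono-≤ t≤ (+-monoʳ-≤ B (*-monoʳ-≤ σ k″≤rem))) (≤-reflexive (sym (+-assoc Tc B _))))
        S : ℕ
        S = Σ< n (λ i → Σ< n (λ j → err M i j * weight x y M i j))
        total : 2 * (2 ^ n * 1 * (n * 4 + 2) + sumTapes n f) ≤ 2 ^ n * (2 * (n * 4 + 2 + (Tc + B)) + σ * S)
        total = begin
          2 * (P * 1 * (n * 4 + 2) + sumTapes n f)
            ≡⟨ cong (λ v → 2 * (P * 1 * (n * 4 + 2) + v)) (trans (sumTapes-+ n _ _) (cong₂ _+_ (sumTapes-const n (Tc + B)) (sumTapes-* n σ remaining))) ⟩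
          2 * (P * 1 * (n * 4 + 2) + ((Tc + B) * P + σ * sumTapes n remaining))
            ≡⟨ sh P (n * 4 + 2) (Tc + B) σ (sumTapes n remaining) ⟩
          P * (2 * (n * 4 + 2 + (Tc + B))) + σ * (2 * sumTapes n remaining)
            ≤⟨ +-monoʳ-≤ (P * (2 * (n * 4 + 2 + (Tc + B)))) (*-monoʳ-≤ σ average-remaining) ⟩
          P * (2 * (n * 4 + 2 + (Tc + B))) + σ * (P * S)
            ≡⟨ sh′ P (2 * (n * 4 + 2 + (Tc + B))) σ S ⟩
          P * (2 * (n * 4 + 2 + (Tc + B)) + σ * S) ∎
          where
          open ≤-Reasoning
          sh : ∀ P u v σ r → 2 * (P * 1 * u + (v * P + σ * r)) ≡ P * (2 * (u + v)) + σ * (2 * r)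
          sh = solve-∀
          sh′ : ∀ P u σ S → P * u + σ * (P * S) ≡ P * (u + σ * S)
          sh′ = solve-∀

  round : Program
  round = fill nX ++ fill nY ++ detect ++ fill nZ ++ checkBuckets

  -- The summand is 1 if both line tests notice the error and 2 otherwise. As x and y are
  -- independent, the former has probability at least 1/4, so the mean is at most 7/4. Being twice
  -- the survival probability, this bounds the latter by 7/8.
  weights-average : ∀ N (r s : Vec Bool N → Bool) → 2 * sumTapes N (λ x → 𝟙 (r x)) ≤ 2 ^ N → 2 * sumTapes N (λ y → 𝟙 (s y)) ≤ 2 ^ N →
    4 * sumTapes N (λ x → sumTapes N (λ y → 1 * (1 + 𝟙 (r x ∨ s y)))) ≤ 7 * (1 * (2 ^ N * 2 ^ N))
  weights-average N r s hr hs = begin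
    4 * sumTapes N (λ x → sumTapes N (λ y → 1 * (1 + 𝟙 (r x ∨ s y))))          ≡⟨ *-assoc 2 2 (sumTapes N (λ x → sumTapes N (λ y → 1 * (1 + 𝟙 (r x ∨ s y))))) ⟩
    2 * (2 * sumTapes N (λ x → sumTapes N (λ y → 1 * (1 + 𝟙 (r x ∨ s y)))))    ≡⟨ cong (2 *_) (sumTapes-* N 2 _) ⟨
    2 * sumTapes N (λ x → 2 * sumTapes N (λ y → 1 * (1 + 𝟙 (r x ∨ s y))))      ≤⟨ *-monoʳ-≤ 2 (sumTapes-mono N (λ x → inner (r x))) ⟩
    2 * sumTapes N (λ x → P * (3 + 𝟙 (r x)))                                    ≡⟨ cong (2 *_) (trans (sumTapes-* N P _) (cong (P *_) (trans (sumTapes-+ N _ _) (cong (_+ V) (sumTapes-const N 3))))) ⟩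
    2 * (P * (3 * P + V))                                                       ≡⟨ sh P V ⟩
    P * (6 * P + 2 * V)                                                         ≤⟨ *-monoʳ-≤ P (+-monoʳ-≤ (6 * P) hr) ⟩
    P * (6 * P + P)                                                             ≡⟨ sh′ P ⟩
    7 * (1 * (P * P))                                                           ∎
    where
    open ≤-Reasoning
    P V : ℕ
    P = 2 ^ N
    V = sumTapes N (λ x → 𝟙 (r x))
    sh : ∀ P V → 2 * (P * (3 * P + V)) ≡ P * (6 * P + 2 * V)
    sh = solve-∀
    sh′ : ∀ P → P * (6 * P + P) ≡ 7 * (1 * (P * P))
    sh′ = solve-∀
    inner : ∀ v → 2 * sumTapes N (λ y → 1 * (1 + 𝟙 (v ∨ s y))) ≤ P * (3 + 𝟙 v)
    inner true  = ≤-reflexive (trans (cong (2 *_) (sumTapes-const N 2)) (four P))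
      where
      four : ∀ P → 2 * (2 * P) ≡ P * 4
      four = solve-∀
    inner false = begin
      2 * sumTapes N (λ y → 1 * (1 + 𝟙 (s y)))    ≡⟨ cong (2 *_) (sumTapes-cong N (λ y → *-identityˡ _)) ⟩
      2 * sumTapes N (λ y → 1 + 𝟙 (s y))          ≡⟨ cong (2 *_) (trans (sumTapes-+ N _ _) (cong (_+ S) (sumTapes-const N 1))) ⟩
      2 * (1 * P + S)                             ≡⟨ split P S ⟩
      2 * P + 2 * S                               ≤⟨ +-monoʳ-≤ (2 * P) hs ⟩
      2 * P + P                                   ≡⟨ three P ⟩
      P * 3                                       ∎
      where
      S : ℕ
      S = sumTapes N (λ y → 𝟙 (s y))
      split : ∀ P S → 2 * (1 * P + S) ≡ 2 * P + 2 * S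
      split = solve-∀
      three : ∀ P → 2 * P + P ≡ P * 3
      three = solve-∀

  module RoundLayer (n : ℕ) (a b c′ : ℕ → ℕ → Carrier) (n≥1 : 1 ≤ n) where
    open Correction n a b c′ using (State; err; errors; State-frame; number; std; size; one; nil; prod)
    open Detection n a b c′
    open SweepLayer n a b c′ n≥1

    total-weight : (ℕ → ℕ → Carrier) → (x y : ℕ → Bool) → ℕ
    total-weight M x y = Σ< n (λ i → Σ< n (λ j → err M i j * weight x y M i j))

    average-weight : ∀ M → 4 * sumTapes n (λ x → sumTapes n (λ y → total-weight M (bit x) (bit y))) ≤ 7 * (errors M * (2 ^ n * 2 ^ n))
    average-weight M = begin
      4 * sumTapes n (λ x → sumTapes n (λ y → total-weight M (bit x) (bit y)))
        ≡⟨ cong (4 *_) (trans (sumTapes-cong n (λ x → trans (sumTapes-Σ< n n _) (Σ<-cong n (λ i _ → sumTapes-Σ< n n _))))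
             (trans (sumTapes-Σ< n n _) (Σ<-cong n (λ i _ → sumTapes-Σ< n n _)))) ⟩
      4 * Σ< n (λ i → Σ< n (λ j → A i j))
        ≡⟨ trans (sym (Σ<-* n 4 _)) (Σ<-cong n (λ i _ → sym (Σ<-* n 4 _))) ⟩
      Σ< n (λ i → Σ< n (λ j → 4 * A i j))
        ≤⟨ Σ<-mono n (λ i i<n → Σ<-mono n (λ j j<n → pointwise i j i<n j<n)) ⟩
      Σ< n (λ i → Σ< n (λ j → 7 * (err M i j * PP)))
        ≡⟨ trans (Σ<-cong n (λ i _ → trans (Σ<-* n 7 _) (cong (7 *_) (right-factor (err M i)))))
             (trans (Σ<-* n 7 _) (cong (7 *_) (right-factor (λ i → Σ< n (err M i))))) ⟩
      7 * (errors M * PP) ∎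
      where
      open ≤-Reasoning
      PP : ℕ
      PP = 2 ^ n * 2 ^ n
      A : ℕ → ℕ → ℕ
      A i j = sumTapes n (λ x → sumTapes n (λ y → err M i j * weight (bit x) (bit y) M i j))
      right-factor : ∀ f → Σ< n (λ i → f i * PP) ≡ Σ< n f * PP
      right-factor f = trans (Σ<-cong n (λ i _ → *-comm (f i) PP)) (trans (Σ<-* n PP f) (*-comm PP _))
      pointwise : ∀ i j → i < n → j < n → 4 * A i j ≤ 7 * (err M i j * PP)
      pointwise i j i<n j<n with M i j ≟ prod row i j
      ... | yes _ = ≤-reflexive (cong (4 *_) (trans (sumTapes-cong n (λ _ → sumTapes-const n 0)) (sumTapes-const n 0)))
      ... | no ne = weights-average n (λ x → silentIn row (bit x) M i) (λ y → silentIn col (bit y) M j)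
          (agree-half n 0 n (prod row i) (M i) j<n j<n (λ e → ne (Rg.sym e)))
          (agree-half n 0 n (prod col j) (λ i → M i j) i<n i<n (λ e → ne (Rg.sym e)))

    module _ {q′} {Q : Memory → Set q′} {ss : Program} {N B σ : ℕ} (m : Memory) (st : State m) (k≥1 : 1 ≤ nvar m vK)
      (cont : ∀ m′ → State m′ → nvar m′ vK ≤ nvar m vK → Good Q 1 N (ss , m′) (B + σ * nvar m′ vK))
      (Qb : ℕ) (q≤Qb : ∀ q → Root (nvar m vK) q → q ≤ Qb) where

      private
        k P Td Tc U : ℕ
        k  = nvar m vK
        P  = 2 ^ n
        Td = 24 + n * (n * 40 + 52)
        Tc = 121 * (Qb * (k ⊓ n) * n)
        U  = Td + (n * 4 + 2 + (Tc + B))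
        M : ℕ → ℕ → Carrier
        M = rarr m rC

        f₂ : Vec Bool n → Vec Bool n → ℕ
        f₂ x y = P * (2 * U) + P * σ * total-weight M (bit x) (bit y)

        f₁ : Vec Bool n → ℕ
        f₁ x = P * (2 * (P * 1)) * (n * 4 + 2) + sumTapes n (f₂ x)

        detected-good : ∀ x y m₂ → State m₂ → (∀ i j → rarr m₂ rC i j ≡ M i j) →
          (∀ t → t < n → narr m₂ nX 0 t ≡ 𝟙 (bit x t)) → (∀ t → t < n → narr m₂ nY 0 t ≡ 𝟙 (bit y t)) →
          Good Q (2 * (P * 1)) N (detect ++ fill nZ ++ checkBuckets ++ ss , m₂) (f₂ x y)
        detected-good x y m₂ s₂ eqC hx hy = go (detect-run {W = 0} {x = bit x} {y = bit y} m₂ s₂ (subst (1 ≤_) (sym k₂) k≥1) hx hy)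
          where
          k₂ : nvar m₂ vK ≡ k
          k₂ = trans (number s₂) (trans (Correction.errors-cong n a b c′ eqC) (sym (number st)))
          go : Run 0 detect m₂ Td (Detected (bit x) (bit y) (rarr m₂ rC) (nvar m₂ vK)) →
               Good Q (2 * (P * 1)) N (detect ++ fill nZ ++ checkBuckets ++ ss , m₂) (f₂ x y)
          go (mkRun {m₃} {t} tr co D) = good-mono bound
            (good-exec {p = detect} tr (sweep-good {σ = σ} M (number st) k≥1 cont (bit x) (bit y) m₃
              (λ i j → trans (keepRA (Exec-frame tr) rC i j) (eqC i j)) D′ Qb (q≤Qb _ (root D′))))
            where
            D′ : Detected (bit x) (bit y) M k m₃
            D′ = record { stateD = stateD D ; rows = Listed-matrix eqC (rows D) ; columns = Listed-matrix eqC (columns D)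
                        ; root = subst (λ v → Root v (nvar m₃ vQ)) k₂ (root D) ; covers = covers D ; narrow = narrow D }
            t≤Td : t ≤ Td
            t≤Td = subst₂ _≤_ (+-identityʳ t) (+-identityʳ Td) co
            S : ℕ
            S = total-weight M (bit x) (bit y)
            bound : t * (2 * (P * 1)) + P * (2 * (n * 4 + 2 + (Tc + B)) + σ * S) ≤ f₂ x y
            bound = ≤-trans (+-monoˡ-≤ _ (*-monoˡ-≤ (2 * (P * 1)) t≤Td)) (≤-reflexive (sh P Td (n * 4 + 2 + (Tc + B)) σ S))
              where
              sh : ∀ P Td u σ S → Td * (2 * (P * 1)) + P * (2 * u + σ * S) ≡ P * (2 * (Td + u)) + P * σ * S
              sh = solve-∀

      -- The scale 8 · P³ combines the tapes of x, y and z with the denominators 4 of the line tests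
      -- and 2 of the bucket test. In the hypothesis, 7 · (σ · k) is eight times the potential that
      -- the surviving errors retain on average.
      round-good : ∀ A → 8 * (3 * (n * 4 + 2) + (24 + n * (n * 40 + 52)) + (121 * (Qb * (nvar m vK ⊓ n) * n) + B)) + 7 * (σ * nvar m vK) ≤ 8 * A →
        Good Q 1 N (round ++ ss , m) A
      round-good A hA = good-unscale (8 * (P * P * P)) {{m*n≢0 8 (P * P * P) {{_}} {{m*n≢0 (P * P) P {{m*n≢0 P P {{P≢0}} {{P≢0}}}} {{P≢0}}}}}}
        (subst (λ D → Good Q D N (round ++ ss , m) (8 * (P * P * P) * A)) (scale P)
          (good-mono total (good-scale 4 (good-fill nX m f₁ (size (std st)) (one (std st)) (nil (std st)) afterX))))
        where
        P≢0 : NonZero P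
        P≢0 = m^n≢0 2 n
        scale : ∀ P → 4 * (P * (P * (2 * (P * 1)))) ≡ 8 * (P * P * P) * 1
        scale = solve-∀
        afterX : ∀ x m₁ → Frame (assigns (fill nX)) m m₁ → (∀ t → t < n → narr m₁ nX 0 t ≡ 𝟙 (bit x t)) →
          Good Q (P * (2 * (P * 1))) N (fill nY ++ detect ++ fill nZ ++ checkBuckets ++ ss , m₁) (f₁ x)
        afterX x m₁ fr₁ hx = good-fill nY m₁ (f₂ x) (size (std s₁)) (one (std s₁)) (nil (std s₁))
          (λ y m₂ fr₂ hy → detected-good x y m₂ (State-frame fr₂ s₁)
            (λ i j → trans (keepRA fr₂ rC i j) (keepRA fr₁ rC i j))
            (λ t h → trans (keepNA fr₂ nX 0 t) (hx t h)) hy)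
          where
          s₁ : State m₁
          s₁ = State-frame fr₁ st
        SS : ℕ
        SS = sumTapes n (λ x → sumTapes n (λ y → total-weight M (bit x) (bit y)))
        sum₂ : ∀ x → sumTapes n (f₂ x) ≡ P * (2 * U) * P + P * σ * sumTapes n (λ y → total-weight M (bit x) (bit y))
        sum₂ x = trans (sumTapes-+ n _ _) (cong₂ _+_ (sumTapes-const n _) (sumTapes-* n (P * σ) _))
        sum₁ : sumTapes n f₁ ≡ (P * (2 * (P * 1)) * (n * 4 + 2) + P * (2 * U) * P) * P + P * σ * SS
        sum₁ = trans (sumTapes-cong n (λ x → trans (cong (P * (2 * (P * 1)) * (n * 4 + 2) +_) (sum₂ x)) (sym (+-assoc C (P * (2 * U) * P) (P * σ * sumTapes n (λ y → total-weight M (bit x) (bit y)))))))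
          (trans (sumTapes-+ n (λ _ → C + P * (2 * U) * P) _) (cong₂ _+_ (sumTapes-const n (C + P * (2 * U) * P)) (sumTapes-* n (P * σ) _)))
          where
          C : ℕ
          C = P * (2 * (P * 1)) * (n * 4 + 2)
        total : 4 * (P * (P * (2 * (P * 1))) * (n * 4 + 2) + sumTapes n f₁) ≤ 8 * (P * P * P) * A
        total = begin
          4 * (P * (P * (2 * (P * 1))) * (n * 4 + 2) + sumTapes n f₁)
            ≡⟨ cong (λ v → 4 * (P * (P * (2 * (P * 1))) * (n * 4 + 2) + v)) sum₁ ⟩
          4 * (P * (P * (2 * (P * 1))) * (n * 4 + 2) + ((P * (2 * (P * 1)) * (n * 4 + 2) + P * (2 * U) * P) * P + P * σ * SS))
            ≡⟨ sh P (n * 4 + 2) U σ SS ⟩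
          P * P * P * (8 * (2 * (n * 4 + 2) + U)) + P * σ * (4 * SS)
            ≤⟨ +-monoʳ-≤ (P * P * P * (8 * (2 * (n * 4 + 2) + U))) (*-monoʳ-≤ (P * σ) (average-weight M)) ⟩
          P * P * P * (8 * (2 * (n * 4 + 2) + U)) + P * σ * (7 * (errors M * (P * P)))
            ≡⟨ cong (λ v → P * P * P * (8 * (2 * (n * 4 + 2) + U)) + P * σ * (7 * (v * (P * P)))) (number st) ⟨
          P * P * P * (8 * (2 * (n * 4 + 2) + (Td + (n * 4 + 2 + (Tc + B))))) + P * σ * (7 * (k * (P * P)))
            ≡⟨ sh′ P (n * 4 + 2) Td (Tc + B) σ k ⟩
          P * P * P * (8 * (3 * (n * 4 + 2) + Td + (Tc + B)) + 7 * (σ * k))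
            ≤⟨ *-monoʳ-≤ (P * P * P) hA ⟩
          P * P * P * (8 * A)
            ≡⟨ sh″ (P * P * P) A ⟩
          8 * (P * P * P) * A ∎
          where
          open ≤-Reasoning
          sh : ∀ P u U σ S → 4 * (P * (P * (2 * (P * 1))) * u + ((P * (2 * (P * 1)) * u + P * (2 * U) * P) * P + P * σ * S)) ≡
            P * P * P * (8 * (2 * u + U)) + P * σ * (4 * S)
          sh = solve-∀
          sh′ : ∀ P u d w σ k → P * P * P * (8 * (2 * u + (d + (u + w)))) + P * σ * (7 * (k * (P * P))) ≡
            P * P * P * (8 * (3 * u + d + w) + 7 * (σ * k))
          sh′ = solve-∀
          sh″ : ∀ C A → C * (8 * A) ≡ 8 * C * A
          sh″ = solve-∀

  -- The algorithm

  loop : Stmt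
  loop = while (less vZero vK) round

  setup : Program
  setup = instr (const vOne 1) ∷ instr (const vZero 0) ∷ instr (const vC 0) ∷ for vC vN (instr (store nId vZero vC vC) ∷ []) ∷ []

  algorithm : Program
  algorithm = setup ++ loop ∷ []

  run-halted : ∀ {N} m (ω : Vec Bool N) → run ([] , m) ω ≡ ([] , m)
  run-halted m []      = refl
  run-halted m (b ∷ ω) = run-halted m ω

  good-halted : ∀ {q} {Q : Memory → Set q} {N m} → Q m → Good Q 1 N ([] , m) 0
  good-halted {Q = Q} {N} {m} h = record
    { halting = λ _ ω m′ e → subst Q (cong proj₂ (trans (sym (run-halted m ω)) e)) h
    ; average = λ {M} _ → ≤-reflexive (trans (cong (1 *_) (trans (sumTapes-cong M idle) (sumTapes-const M 0))) refl)
    }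
    where
    idle : ∀ {M} (ω : Vec Bool M) → time ([] , m) ω ≡ 0
    idle []      = refl
    idle (b ∷ ω) = refl

  module LoopLayer (n : ℕ) (a b c′ : ℕ → ℕ → Carrier) (n≥1 : 1 ≤ n) (c₁ c₂ : ℕ)
    (round≤ : ∀ {k} i → k ≤ 4 ^ suc i →
      suc (3 * (n * 4 + 2) + (24 + n * (n * 40 + 52)) + 121 * (4 * 2 ^ i * (k ⊓ n) * n)) ≤
      c₁ * (n * n) + c₂ * (2 ^ i * (4 ^ i ⊓ n) * n))
    {q} {Q : Memory → Set q} (final : ∀ m → Correction.State n a b c′ m → nvar m vK ≡ 0 → Q m) where
    open Correction n a b c′ using (State; std; nil)
    open RoundLayer n a b c′ n≥1
    open Potential c₁ c₂ n n≥1

    root-bound : ∀ {k} i → k ≤ 4 ^ suc i → ∀ q → Root k q → q ≤ 4 * 2 ^ i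
    root-bound {k} i h q r = square-cancel-≤ (≤-trans (q²≤4k r) (≤-trans (*-monoʳ-≤ 4 h)
      (≤-reflexive (trans (cong (λ p → 4 * (4 * p)) (4^≡2^*2^ i)) (sh (2 ^ i))))))
      where
      sh : ∀ p → 4 * (4 * (p * p)) ≡ 4 * p * (4 * p)
      sh = solve-∀

    -- Since k ≥ 4 ^ i, an eighth of σ i · k is at least τ i, which covers V and one more step. This
    -- step is the loop test before the round, and `pred` sets it aside.
    drop : ∀ i {k V} → 4 ^ i ≤ k → suc V ≤ τ i → 8 * (V + S i) + 7 * (σ i * k) ≤ 8 * (S i + pred (σ i * k))
    drop i {k} {V} lo h with σ i * k in e
    -- Impossible, as σ i · k is at least 8 · τ i and τ i is positive by `h`.
    ... | zero  = contradiction (≤-trans (*-monoʳ-≤ 8 h) (≤-trans (8τ≤σ4^ i) (≤-trans (*-monoʳ-≤ (σ i) lo) (≤-reflexive e)))) (λ ())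
    ... | suc p = begin
      8 * (V + S i) + 7 * suc p       ≡⟨ sh V (S i) p ⟩
      8 * S i + (8 * suc V + 7 * p) ∸ 1 ≤⟨ ∸-monoˡ-≤ 1 (+-monoʳ-≤ (8 * S i) (+-monoˡ-≤ (7 * p) 8V≤)) ⟩
      8 * S i + (suc p + 7 * p) ∸ 1   ≡⟨ sh′ (S i) p ⟩
      8 * (S i + p)                   ∎
      where
      open ≤-Reasoning
      8V≤ : 8 * suc V ≤ suc p
      8V≤ = ≤-trans (*-monoʳ-≤ 8 h) (≤-trans (8τ≤σ4^ i) (≤-trans (*-monoʳ-≤ (σ i) lo) (≤-reflexive e)))
      sh : ∀ V s p → 8 * (V + s) + 7 * suc p ≡ 8 * s + (8 * suc V + 7 * p) ∸ 1
      sh V s p = cong (_∸ 1) (sh₀ V s p)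
        where
        sh₀ : ∀ V s p → suc (8 * (V + s) + 7 * suc p) ≡ 8 * s + (8 * suc V + 7 * p)
        sh₀ = solve-∀
      sh′ : ∀ s p → 8 * s + (suc p + 7 * p) ∸ 1 ≡ 8 * (s + p)
      sh′ s p = cong (_∸ 1) (sh₀ s p)
        where
        sh₀ : ∀ s p → 8 * s + (suc p + 7 * p) ≡ suc (8 * (s + p))
        sh₀ = solve-∀

    -- Induction on N and, for equal N, on i. The loop test uses up one step before each round. The
    -- bound of level i is also valid below 4 ^ i errors, so a round needs no case distinction on
    -- how many errors it leaves; the level is lowered afterwards, without a step.
    loop-good : ∀ N i m → State m → nvar m vK ≤ 4 ^ suc i → Good Q 1 N (loop ∷ [] , m) (S i + σ i * nvar m vK)
    loop-good zero    i m st hi = good-zero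
    loop-good (suc N) i m st hi with nvar m vK in e
    -- The last loop test costs one step, and `S` is positive for its sake.
    ... | zero = good-mono (≤-trans (1≤S i) (m≤m+n (S i) _))
          (good-det _ (λ _ → cong (λ v → (if v then round ++ loop ∷ [] else []) , m) (cong₂ _<ᵇ_ (nil (std st)) e)) (good-halted (final m st e)))
    ... | suc k′ with 4 ^ i ≤? suc k′
    ...   | yes lo = good-mono (≤-reflexive pay)
            (good-det _ (λ _ → cong (λ v → (if v then round ++ loop ∷ [] else []) , m) (cong₂ _<ᵇ_ (nil (std st)) e))
              (round-good {ss = loop ∷ []} {N} {S i} {σ i} m st (subst (1 ≤_) (sym e) (s≤s z≤n))
                (λ m′ s′ le → loop-good N i m′ s′ (≤-trans le (≤-trans (≤-reflexive e) hi)))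
                (4 * 2 ^ i) (root-bound i (≤-trans (≤-reflexive e) hi)) (S i + pred (σ i * suc k′))
                (subst (λ k → 8 * (V₀ + (121 * (4 * 2 ^ i * (k ⊓ n) * n) + S i)) + 7 * (σ i * k) ≤ 8 * (S i + pred (σ i * suc k′))) (sym e)
                  (≤-trans (≤-reflexive (cong (λ v → 8 * v + 7 * (σ i * suc k′)) (sym (+-assoc V₀ _ (S i))))) (drop i lo (round≤ i hi))))))
      where
      V₀ : ℕ
      V₀ = 3 * (n * 4 + 2) + (24 + n * (n * 40 + 52))
      pay : 1 + (S i + pred (σ i * suc k′)) ≡ S i + σ i * suc k′
      pay = sym (+-suc (S i) _)
    ...   | no ¬lo with i
    ...     | zero   = contradiction (s≤s z≤n) ¬lo
    -- S (suc i′) equals S i′ + σ i′ · 4 ^ suc i′, and k is at most 4 ^ suc i′, so the lower level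
    -- has the smaller bound.
    ...     | suc i′ = good-mono (≤-trans (+-monoʳ-≤ (S i′) (*-monoʳ-≤ (σ i′) (≤-trans (≤-reflexive e) (<⇒≤ (≰⇒> ¬lo))))) (m≤m+n (S (suc i′)) _))
              (loop-good (suc N) i′ m st (≤-trans (≤-reflexive e) (<⇒≤ (≰⇒> ¬lo))))

  -- Back to matrices indexed by `Fin n` and to the given k

  open MonoidSum +-monoid using (sum)

  ∑-head : ∀ n g → ∑ (suc n) g ≈ g 0 +ᴿ ∑ n (g ∘ suc)
  ∑-head zero    g = Rg.+-comm 0# (g 0)
  ∑-head (suc n) g = Rg.trans (Rg.+-congʳ (∑-head n g)) (Rg.+-assoc _ _ _)

  ∑≈sum : ∀ n g (f : Fin n → Carrier) → (∀ i → g (toℕ i) ≈ f i) → ∑ n g ≈ sum f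
  ∑≈sum zero    g f e = Rg.refl
  ∑≈sum (suc n) g f e = Rg.trans (∑-head n g) (Rg.+-cong (e Fin.zero) (∑≈sum n (g ∘ suc) (f ∘ Fin.suc) (e ∘ Fin.suc)))

  entries-toℕ : ∀ {n} (M : Matrix n) i j → entries M (toℕ i) (toℕ j) ≡ M i j
  entries-toℕ {n} M i j with toℕ i <? n | toℕ j <? n
  ... | yes p | yes p′ = cong₂ M (fromℕ<-toℕ i p) (fromℕ<-toℕ j p′)
  ... | no ¬p | _      = contradiction (toℕ<n i) ¬p
  ... | yes _ | no ¬p  = contradiction (toℕ<n j) ¬p

  -- The constants c₁ and c₂ stay variables, since Agda would compute with their values in unary notation.
  module Correctness (c₁ c₂ : ℕ)
    (round≤ : ∀ n {k} i → 1 ≤ n → k ≤ 4 ^ suc i →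
      suc (3 * (n * 4 + 2) + (24 + n * (n * 40 + 52)) + 121 * (4 * 2 ^ i * (k ⊓ n) * n)) ≤
      c₁ * (n * n) + c₂ * (2 ^ i * (4 ^ i ⊓ n) * n))
    {n : ℕ} (n≥1 : 1 ≤ n) (A B C′ : Matrix n) (k : ℕ) (differ : DifferInExactly k C′ (A ⊗ B)) where
    open Correction n (entries A) (entries B) (entries C′)

    product : ∀ i j → prod row (toℕ i) (toℕ j) ≈ (A ⊗ B) i j
    product i j = ∑≈sum n _ _ (λ l → ≈-reflexive (cong₂ _*ᴿ_ (entries-toℕ A i l) (entries-toℕ B l j)))

    k≡errors : k ≡ errors (entries C′)
    k≡errors = trans (sym differ) (count-product (λ (i , j) → ¬? (C′ i j ≟ (A ⊗ B) i j)) n n id id (err (entries C′))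
      (λ i j → cong (λ v → 𝟙 (not v)) (sym (does-cong (≈-reflexive (entries-toℕ C′ i j)) (product i j)))))

    Solved : Memory → Set _
    Solved m = ErrorsIdentified C′ (A ⊗ B) m × Corrected (A ⊗ B) m

    -- A zero count leaves no wrong entry. So an entry that was never touched was right in the input
    -- and is rightly unmarked, while a marked one was wrong by `Status`.
    solved : ∀ m → State m → nvar m vK ≡ 0 → Solved m
    solved m st k≡0 = identified , λ i j → Rg.trans (exact (toℕ i) (toℕ j) (toℕ<n i) (toℕ<n j)) (product i j)
      where
      exact : ∀ i j → i < n → j < n → rarr m rC i j ≈ prod row i j
      exact i j i<n j<n with rarr m rC i j ≟ prod row i j in e
      ... | yes p = p
      ... | no ¬p = contradiction
        (≤-trans (≤-reflexive (sym (err-1 (rarr m rC) i j ¬p)))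
          (≤-trans (term≤Σ< n (err (rarr m rC) i) j<n)
            (≤-trans (term≤Σ< n (λ i → Σ< n (err (rarr m rC) i)) i<n) (≤-reflexive (trans (sym (number st)) k≡0))))) (λ ())
      identified : ErrorsIdentified C′ (A ⊗ B) m
      identified i j with status st (toℕ i) (toℕ j) (toℕ<n i) (toℕ<n j)
      ... | inj₁ (same , unmarked) =
        (λ wrong → contradiction
          (Rg.trans (≈-reflexive (trans (sym (entries-toℕ C′ i j)) (sym same)))
            (Rg.trans (exact (toℕ i) (toℕ j) (toℕ<n i) (toℕ<n j)) (product i j))) wrong)
        , λ _ → unmarked
      ... | inj₂ (_ , wrong , marked) =
        (λ _ → marked)
        , λ e → contradiction (Rg.trans (≈-reflexive (entries-toℕ C′ i j)) (Rg.trans e (Rg.sym (product i j)))) wrong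

    setup-run : Run 0 setup (input A B C′ k) (4 + n * 3) (λ m → State m × nvar m vK ≡ k)
    setup-run = ins (λ _ → refl) (ins (λ _ → refl) (ins (λ _ → refl) (weaken (≤-reflexive (+-comm (n * 3) 1))
      (Run-map conclude (for-run Inv m₁ 0 n 1 refl refl (λ _ _ _ h → h) body refl (λ _ ()))))))
      where
      m₁ : Memory
      m₁ = setN vC 0 (setN vZero 0 (setN vOne 1 (input A B C′ k)))
      Inv : ℕ → Memory → Set
      Inv t m = ∀ u → u < t → narr m nId 0 u ≡ u
      fillId : Program
      fillId = instr (store nId vZero vC vC) ∷ []
      body : ∀ t m → t < n → nvar m vC ≡ t → Frame (assigns [ for vC vN fillId ]) m₁ m → Inv t m → Run 0 fillId m 1 (Inv (suc t))
      body t m t<n hc fr inv = ins (λ _ → refl) (stop stored)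
        where
        nil′ : nvar m vZero ≡ 0
        nil′ = keepN fr vZero
        stored : Inv (suc t) (exec false (store nId vZero vC vC) m)
        stored u (s≤s u≤t) rewrite nil′ | hc with m≤n⇒m<n∨m≡n u≤t
        ... | inj₁ u<t rewrite <⇒≡ᵇ-false u<t = inv u u<t
        ... | inj₂ refl rewrite ≡ᵇ-refl u = refl
      conclude : ∀ m → Frame (assigns [ for vC vN fillId ]) m₁ m → Inv n m → State m × nvar m vK ≡ k
      conclude m fr inv = record
        { std = record
          { size  = keepN fr vN
          ; one   = keepN fr vOne
          ; nil   = keepN fr vZero
          ; left  = keepRA fr rA
          ; right = keepRA fr rB }
        ; identity = inv
        ; status   = λ i j _ _ → inj₁ (keepRA fr rC i j , keepNA fr nMark i j)
        ; number   = trans (keepN fr vK) (trans k≡errors (sym (errors-cong (keepRA fr rC))))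
        } , keepN fr vK

    open LoopLayer n (entries A) (entries B) (entries C′) n≥1 c₁ c₂ (λ i → round≤ n i n≥1) {Q = Solved} solved using (loop-good)
    open Potential c₁ c₂ n n≥1

    k≤n² : k ≤ n * n
    k≤n² = ≤-trans (≤-reflexive k≡errors) (Detection.errors≤n² n (entries A) (entries B) (entries C′) (entries C′))

    loop-bound : ∀ N m → State m → nvar m vK ≡ k →
      Good Solved 1 N (loop ∷ [] , m) ((17 + 64 * c₁ + 256 * c₂) * timeBound n k)
    loop-bound N m st e with 1 ≤? k
    -- Without errors there is no level containing k; level 0 serves, and its bound is the single
    -- failing test.
    ... | no ¬p = good-mono small (loop-good N 0 m st (≤-trans (≤-reflexive k≡0) z≤n))
      where
      k≡0 : nvar m vK ≡ 0
      k≡0 = trans e (n<1⇒n≡0 (≰⇒> ¬p))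
      small : 1 + σ 0 * nvar m vK ≤ (17 + 64 * c₁ + 256 * c₂) * timeBound n k
      small = ≤-trans (≤-reflexive (cong suc (trans (cong (σ 0 *_) k≡0) (*-zeroʳ (σ 0)))))
        (≤-trans 1≤n² (≤-trans (n²≤timeBound k) (m≤m+n (timeBound n k) _)))
    ... | yes k≥1 with bracket k k≥1
    ...   | i , lo , hi = good-mono
            (≤-trans (+-monoʳ-≤ (S i) (*-monoʳ-≤ (σ i) (≤-trans (≤-reflexive e) (<⇒≤ hi)))) (S≤timeBound i lo k≤n²))
            (loop-good N i m st (≤-trans (≤-reflexive e) (<⇒≤ hi)))

    -- The setup takes at most 7 n² steps, and the time bound is never below n²; this accounts for
    -- the 7.
    algorithm-good : ∀ N → Good Solved 1 N (algorithm , input A B C′ k) ((7 + (17 + 64 * c₁ + 256 * c₂)) * timeBound n k)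
    algorithm-good N = go setup-run
      where
      go : Run 0 setup (input A B C′ k) (4 + n * 3) (λ m → State m × nvar m vK ≡ k) → _
      go (mkRun {m} {t} tr co (st , e)) = good-mono
        (≤-trans (+-monoˡ-≤ _ (≤-trans (≤-reflexive (*-identityʳ t)) t≤)) (≤-reflexive (sym (*-distribʳ-+ (timeBound n k) 7 (17 + 64 * c₁ + 256 * c₂)))))
        (good-exec tr (loop-bound N m st e))
        where
        t≤ : t ≤ 7 * timeBound n k
        t≤ = begin
          t                      ≤⟨ subst₂ _≤_ (+-identityʳ t) (+-identityʳ _) co ⟩
          4 + n * 3              ≤⟨ +-mono-≤ (*-monoʳ-≤ 4 n≥1) ≤-refl ⟩
          4 * n + n * 3          ≡⟨ seven n ⟩
          7 * (n * 1)            ≤⟨ *-monoʳ-≤ 7 (*-monoʳ-≤ n n≥1) ⟩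
          7 * (n * n)            ≤⟨ *-monoʳ-≤ 7 (n²≤timeBound k) ⟩
          7 * timeBound n k      ∎
          where
          open ≤-Reasoning
          seven : ∀ n → 4 * n + n * 3 ≡ 7 * (n * 1)
          seven = solve-∀

  corrects : ∀ (c₁ c₂ : ℕ) →
    (∀ n {k} i → 1 ≤ n → k ≤ 4 ^ suc i →
      suc (3 * (n * 4 + 2) + (24 + n * (n * 40 + 52)) + 121 * (4 * 2 ^ i * (k ⊓ n) * n)) ≤
      c₁ * (n * n) + c₂ * (2 ^ i * (4 ^ i ⊓ n) * n)) →
    Σ[ K ∈ ℕ ]
      ((n : ℕ) .{{_ : NonZero n}} (A B C′ : Matrix n) (k : ℕ) →
       DifferInExactly k C′ (A ⊗ B) →
       OnHalting (algorithm , input A B C′ k)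
         (λ m → ErrorsIdentified C′ (A ⊗ B) m × Corrected (A ⊗ B) m) ×
       ExpectedTime≤ (algorithm , input A B C′ k) (K * timeBound n k))
  corrects c₁ c₂ round≤ = 7 + (17 + 64 * c₁ + 256 * c₂) , λ n A B C′ k differ →
    let good = Correctness.algorithm-good c₁ c₂ round≤ (>-nonZero⁻¹ n) A B C′ k differ in
    (λ {N} → halting (good N) ≤-refl) ,
    λ N → ≤-trans (≤-reflexive (sym (*-identityˡ _))) (average (good N) ≤-refl)

theorem5 : ∀ {c ℓ} (R : Ring c ℓ) (_≟_ : Decidable (Ring._≈_ R)) → let open Over R _≟_ in
    Σ[ algorithm ∈ Program ] Σ[ K ∈ ℕ ]
      ((n : ℕ) .{{_ : NonZero n}} (A B C′ : Matrix n) (k : ℕ) →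
       DifferInExactly k C′ (A ⊗ B) →
       OnHalting (algorithm , input A B C′ k)
         (λ m → ErrorsIdentified C′ (A ⊗ B) m × Corrected (A ⊗ B) m) ×
       ExpectedTime≤ (algorithm , input A B C′ k) (K * timeBound n k))
theorem5 R _≟_ = Algorithm.algorithm R _≟_ , Algorithm.corrects R _≟_ 135 (121 * 16) round-cost
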